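{- Let $m\geq 3$, $n\geq1$, $\epsilon\ge 0$, let $H\subseteq S_m$ be a fixing subgroup and let $f:S_m^n\to S_m/H$ be an $H$-social aggregator with $IR(f)\leq\epsilon$, where $$IR(f)=\sum_{i\in[n],\,j\in[m]}\mathbb{E}_{x^{ -i},x_i,y_i}\Big(\mathbf 1_{x_i^{ -1}(j)=y_i^{ -1}(j)}\Big\|\tfrac{1}{|H|}\big(\mathbf n_{f(x^{ -i},x_i)^{ -1}(j)}-\mathbf n_{f(x^{ -i},y_i)^{ -1}(j)}\big)\Big\|_2^2\Big)$$ with $x^{ -i}\in S_m^{n-1}$, $x_i,y_i\in S_m$ independent and uniform. Then there is a function $h:S_m^n\to S_m/H$ which is either constant or of the form $h(x)=\{x_i\circ y\circ h':h'\in H\}$ for some $i\in[n]$, $y\in S_m$, such that $$\mathbb{E}_{x\in S_m^n}\big\|\bar P(f(x))-\bar P(h(x))\big\|_F^2\leq O_H(\mathrm{poly}(m)\,\epsilon),$$ i.e. this is at most $c_H\,m^{k}\epsilon$ for an absolute constant $k$ and a constant $c_H$ depending only on $H$.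
   Context: $S_m$ is the symmetric group on $[m]$; a ranking $x\in S_m$ uses the convention $x(\text{rank})=\text{name}$. Profiles are $x\in S_m^n$; $(x^{ -i},y_i)$ is $x$ with $x_i$ replaced by $y_i$. $\circ$ is ordinary composition. A subgroup $H$ is fixing if there is a partition of $[m]$ into $k\geq2$ nonempty blocks $B_1,\dots,B_k$ with $H=\{h: h(B_l)=B_l\ \forall l\}$. The coset of $y$ is $Hy=\{y\circ h:h\in H\}$; $S_m/H$ is the set of such cosets, and an $H$-social aggregator is a map $S_m^n\to S_m/H$. The $j$-profile of a coset $K$ is the multiset $K^{ -1}(j)=\{z^{ -1}(j):z\in K\}$; for a multiset $S$ of elements of $[m]$, $\mathbf n_S\in\mathbb R^m$ has $a$-th entry equal to the multiplicity of $a$ in $S$. For $z\in S_m$, $P(z)_{ab}=\mathbf 1_{z(a)=b}$, and for a coset $K$, $\bar P(K)=\frac1{|H|}\sum_{z\in K}P(z)$; $\|\cdot\|_F$ is the Frobenius norm. (This distance equals the one between the encodings $\frac1{|H|}\sum_{z\in K}\rho^1(z)$ with $\rho^1$ the standard $(m-1)$-dimensional orthogonal representation.) -}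

module Defs where

open import Data.Nat as ℕ using (ℕ; zero; suc)
open import Data.Integer using (+_)
open import Data.Rational using (ℚ; _/_; _+_; _*_; _-_; 0ℚ)
open import Data.Fin using (Fin; _≟_)
open import Data.Fin.Properties using (all?)
open import Data.Vec as Vec using (Vec; []; _∷_; lookup; _[_]≔_)
open import Data.List as List using (List; []; _∷_; length; map; concatMap; mapMaybe; filter; allFin; foldr)
open import Data.Product using (Σ; _,_; proj₁; _×_)
open import Data.Bool using (Bool; true; false; T; _∧_; not)
open import Data.Maybe using (Maybe; just; nothing)
open import Relation.Nullary using (yes; no; does)
open import Relation.Binary.PropositionalEquality using (_≡_)

Σℚ : List ℚ → ℚ
Σℚ = foldr _+_ 0ℚ

ℕtoℚ : ℕ → ℚ
ℕtoℚ n = (+ n) / 1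

-- 1/n, with the convention 1/0 = 0 (never used on empty lists)
recip : ℕ → ℚ
recip zero = 0ℚ
recip (suc n) = (+ 1) / suc n

𝔼 : {A : Set} → List A → (A → ℚ) → ℚ
𝔼 L g = Σℚ (map g L) * recip (length L)

-- The symmetric group S_m.
-- A ranking is the vector (x(0),...,x(m-1)) with x(rank) = name,
-- and it is a permutation iff all entries are pairwise distinct.

allVecs : {A : Set} → List A → (k : ℕ) → List (Vec A k)
allVecs L zero = [] ∷ []
allVecs L (suc k) = concatMap (λ a → map (a ∷_) (allVecs L k)) L

notIn : {m : ℕ} → Fin m → {k : ℕ} → Vec (Fin m) k → Bool
notIn a [] = true
notIn a (b ∷ v) = not (does (a ≟ b)) ∧ notIn a v

distinct : {m k : ℕ} → Vec (Fin m) k → Bool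
distinct [] = true
distinct (a ∷ v) = notIn a v ∧ distinct v

Perm : ℕ → Set
Perm m = Σ (Vec (Fin m) m) (λ v → T (distinct v))

⟦_⟧ : {m : ℕ} → Perm m → Fin m → Fin m
⟦ x ⟧ a = lookup (proj₁ x) a

asPerm : {m : ℕ} → Vec (Fin m) m → Maybe (Perm m)
asPerm v with T? (distinct v)
  where open import Data.Bool.Properties using (T?)
... | yes p = just (v , p)
... | no _ = nothing

allPerms : (m : ℕ) → List (Perm m)
allPerms m = mapMaybe asPerm (allVecs (allFin m) m)

Profile : ℕ → ℕ → Set
Profile m n = Vec (Perm m) n

allProfiles : (m n : ℕ) → List (Profile m n)
allProfiles m n = allVecs (allPerms m) n

-- Inverse: z⁻¹(j) = the (unique for a permutation) a with z(a) = j.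
-- (first such a; default j if none, which never happens for permutations)

preimage : {m : ℕ} → (Fin m → Fin m) → Fin m → Fin m
preimage {m} z j with filter (λ a → z a ≟ j) (allFin m)
... | [] = j
... | a ∷ _ = a

-- Fixing subgroups.  A partition of [m] into nb ≥ 2 nonempty blocks is
-- given by a surjective block-labelling  b : Fin m → Fin nb ; the
-- corresponding fixing subgroup is H_b = { h ∈ S_m : b ∘ h = b }.

Hlist : {m nb : ℕ} → (Fin m → Fin nb) → List (Perm m)
Hlist {m} b = filter (λ h → all? (λ a → b (⟦ h ⟧ a) ≟ b a)) (allPerms m)

∣H∣ : {m nb : ℕ} → (Fin m → Fin nb) → ℕ
∣H∣ b = length (Hlist b)

-- The coset  Hy = { y ∘ h : h ∈ H }  of a representative y (given as a map),
-- listed (with each element once) as maps.  An H-social aggregator is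
-- represented by a choice of representative for each output coset; all
-- quantities below depend only on the coset.
coset : {m nb : ℕ} → (Fin m → Fin nb) → (Fin m → Fin m) → List (Fin m → Fin m)
coset b y = map (λ h a → y (⟦ h ⟧ a)) (Hlist b)

count : {m : ℕ} → Fin m → List (Fin m) → ℕ
count a S = length (filter (λ c → c ≟ a) S)

jProfile : {m nb : ℕ} → (Fin m → Fin nb) → (Fin m → Fin m) → Fin m → List (Fin m)
jProfile b y j = map (λ z → preimage z j) (coset b y)

sq : ℚ → ℚ
sq q = q * q

profDist : {m nb : ℕ} → (Fin m → Fin nb) → (Fin m → Fin m) → (Fin m → Fin m) → Fin m → ℚ
profDist {m} b y y' j =
  Σℚ (map (λ a → sq ((ℕtoℚ (count a (jProfile b y j)) - ℕtoℚ (count a (jProfile b y' j)))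
                      * recip (∣H∣ b)))
          (allFin m))

indicator : {m : ℕ} → Fin m → Fin m → ℚ
indicator a c with a ≟ c
... | yes _ = (+ 1) / 1
... | no _ = 0ℚ

Pbar : {m nb : ℕ} → (Fin m → Fin nb) → (Fin m → Fin m) → Fin m → Fin m → ℚ
Pbar b y a c = Σℚ (map (λ z → indicator (z a) c) (coset b y)) * recip (∣H∣ b)

frobDist : {m nb : ℕ} → (Fin m → Fin nb) → (Fin m → Fin m) → (Fin m → Fin m) → ℚ
frobDist {m} b y y' =
  Σℚ (map (λ a → Σℚ (map (λ c → sq (Pbar b y a c - Pbar b y' a c)) (allFin m))) (allFin m))

-- IR(f) for an H-social aggregator f (given via representatives).
-- E over x^{-i} ∈ S_m^{n-1}, x_i, y_i uniform and independent is the
-- same as E over a full profile x ∈ S_m^n and y_i ∈ S_m.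

IR : {m nb n : ℕ} → (Fin m → Fin nb) → (Profile m n → Perm m) → ℚ
IR {m} {nb} {n} b f =
  Σℚ (map (λ i → Σℚ (map (λ j →
      𝔼 (allProfiles m n) (λ x → 𝔼 (allPerms m) (λ yi →
         indicator (preimage ⟦ lookup x i ⟧ j) (preimage ⟦ yi ⟧ j)
         * profDist b ⟦ f x ⟧ ⟦ f (x [ i ]≔ yi) ⟧ j)))
    (allFin m))) (allFin n))

data Simple (m n : ℕ) : Set where
  const    : Perm m → Simple m n
  dictator : Fin n → Perm m → Simple m n

simpleRep : {m n : ℕ} → Simple m n → Profile m n → (Fin m → Fin m)
simpleRep (const y) x = ⟦ y ⟧
simpleRep (dictator i y) x = λ a → ⟦ lookup x i ⟧ (⟦ y ⟧ a)

{-# OPTIONS --safe #-}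
module Submission where

-- Encode the coset f(x) by colouring each name j with the block that contains its rank in f(x).  Changing
-- one ballot at a time, small IR(f) means that up to O(ε) the colour of j is a function G j of the ranks
-- that the voters give to j.  The colours always have the block sizes as multiplicities, so swapping two
-- names on the ballots of a set of voters only exchanges their two colours; since m ≥ 3 this makes every
-- G j nearly additive on random rectangles.  If some G j is far from constant, then for every set S of
-- voters G j nearly ignores S or its complement; growing S one voter at a time isolates one voter who
-- nearly determines all colours, and a colouring by a single voter is a dictatorship or constant.  If every
-- G j is near a constant, let W count the names of deviating colour: W ≠ 1 with high probability, so
-- E W² ≥ 2 E W - O(ε), while Var W ≤ (3/2) E W by tensorization, hence E W = O(ε).
-- The constant may depend on H, hence on m, so the exponent k = 0 suffices.

open import Defs
open import Data.Nat using (ℕ; _≤_; _^_)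
open import Data.Fin using (Fin)
open import Data.Rational using (ℚ; _*_; 0ℚ) renaming (_≤_ to _≤ℚ_)
open import Data.Product using (∃; ∃-syntax; _×_)
open import Relation.Binary.PropositionalEquality using (_≡_)

open import Data.Bool using (Bool; true; false; if_then_else_; not; _∧_; T)
open import Data.Bool.Properties using (T?; T-irrelevant)
open import Data.Fin as Fin using (zero; suc; toℕ; fromℕ<; punchOut; _≟_)
open import Data.Fin.Permutation.Components using (transpose; transpose-inverse)
import Data.Fin.Properties as FinP
import Data.Integer as ℤ
import Data.Integer.Properties as ℤP
open import Data.List as List using (List; []; _∷_; _++_; length; map; concatMap; mapMaybe; filter; allFin)
import Data.List.Properties as List
open import Data.List.Membership.Propositional using (_∈_)
open import Data.List.Membership.Propositional.Properties using (∈-filter⁺; ∈-filter⁻; ∈-allFin; ∈-map⁺; ∈-map⁻)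
import Data.List.Relation.Unary.All as All
open import Data.List.Relation.Unary.Any using (here; there)
open import Data.Maybe as Maybe using (Maybe; just; nothing)
open import Data.Nat as ℕ using (zero; suc)
import Data.Nat.Properties as ℕP
open import Data.Product using (_,_; proj₁; proj₂)
open import Data.Rational using (_+_; _-_; -_; 1ℚ; ½; nonNegative; toℚᵘ) renaming (_≟_ to _≟ℚ_)
open import Data.Rational.Properties hiding (_≟_)
import Data.Rational.Unnormalised as ℚᵘ
import Data.Rational.Unnormalised.Properties as ℚᵘP
open import Data.Sum using (_⊎_; inj₁; inj₂)
open import Data.Vec using (Vec; []; _∷_; lookup; _[_]≔_; tabulate)
import Data.Vec.Properties as VecP
open import Function using (_∘_; id)
open import Relation.Binary.Definitions using (DecidableEquality)
open import Relation.Binary.PropositionalEquality using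
  (_≢_; refl; sym; trans; cong; cong₂; subst; subst₂; module ≡-Reasoning)
open import Relation.Nullary using (Dec; yes; no; ¬_; does; contradiction; ¬?)
open import Relation.Nullary.Decidable using
  (dec⇒maybe; dec-true; dec-false; map′; decidable-stable; _×-dec_; _⊎-dec_)
open import Tactic.RingSolver using (solve-∀)
open import Tactic.RingSolver.Core.AlmostCommutativeRing using (AlmostCommutativeRing; fromCommutativeRing)

-- Near additivity is a statement about the indicator of each colour: a sum g(ballots in S) +
-- h(other ballots) with values in {0,1} cannot vary in both summands, whence the alternative for S.
-- Three names are needed twice. A rectangle for `G j` needs independent rank vectors of j while
-- another name k keeps its ranks, so j must trade places with a third name. And the variance
-- constant is m/(m-1), at most 3/2; the last step needs less than 2, the value at m = 2. No error
-- may grow with the number of voters. The passage to ranks is paid for by the total influence,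
-- itself a sum over voters; the search for the decisive voter applies the alternative afresh at
-- each step, so only two of its errors are ever added. For one voter the argument is exact: with
-- the other ballots fixed, an expected error below 1/m! is no error at any ballot, and a larger one
-- is absorbed by the trivial bound. This puts m! into the constant.

ℚ-ring : AlmostCommutativeRing _ _
ℚ-ring = fromCommutativeRing +-*-commutativeRing (λ x → dec⇒maybe (0ℚ ≟ℚ x))

-- Ordered-field arithmetic

0≤1 : 0ℚ ≤ℚ 1ℚ
0≤1 = nonNegative⁻¹ 1ℚ

≤-slack : ∀ {a b} s → 0ℚ ≤ℚ s → b ≡ a + s → a ≤ℚ b
≤-slack {a} s 0≤s refl = subst (_≤ℚ a + s) (+-identityʳ a) (+-monoʳ-≤ a 0≤s)

0≤+ : ∀ {a b} → 0ℚ ≤ℚ a → 0ℚ ≤ℚ b → 0ℚ ≤ℚ a + b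
0≤+ = +-mono-≤

0≤* : ∀ {a b} → 0ℚ ≤ℚ a → 0ℚ ≤ℚ b → 0ℚ ≤ℚ a * b
0≤* {a} {b} 0≤a 0≤b =
  subst (_≤ℚ a * b) (*-zeroʳ a) (*-monoˡ-≤-nonNeg a ⦃ nonNegative 0≤a ⦄ 0≤b)

*-monoˡ-≤ : ∀ {c a b} → 0ℚ ≤ℚ c → a ≤ℚ b → c * a ≤ℚ c * b
*-monoˡ-≤ {c} 0≤c = *-monoˡ-≤-nonNeg c ⦃ nonNegative 0≤c ⦄

*-monoʳ-≤ : ∀ {c a b} → 0ℚ ≤ℚ c → a ≤ℚ b → a * c ≤ℚ b * c
*-monoʳ-≤ {c} 0≤c = *-monoʳ-≤-nonNeg c ⦃ nonNegative 0≤c ⦄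

*-mono-≤ : ∀ {a b c d} → 0ℚ ≤ℚ b → 0ℚ ≤ℚ c → a ≤ℚ b → c ≤ℚ d → a * c ≤ℚ b * d
*-mono-≤ 0≤b 0≤c a≤b c≤d = ≤-trans (*-monoʳ-≤ 0≤c a≤b) (*-monoˡ-≤ 0≤b c≤d)

0≤sub : ∀ {a b} → a ≤ℚ b → 0ℚ ≤ℚ b - a
0≤sub {a} {b} a≤b = subst (_≤ℚ b - a) (+-inverseʳ a) (+-monoˡ-≤ (- a) a≤b)

0≤sq : ∀ a → 0ℚ ≤ℚ a * a
0≤sq a with ≤-total 0ℚ a
... | inj₁ 0≤a = 0≤* 0≤a 0≤a
... | inj₂ a≤0 = subst (0ℚ ≤ℚ_) (negneg a) (0≤* 0≤-a 0≤-a)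
  where
  negneg : ∀ a → (- a) * (- a) ≡ a * a
  negneg = solve-∀ ℚ-ring
  0≤-a : 0ℚ ≤ℚ - a
  0≤-a = neg-antimono-≤ a≤0

ℕtoℚ-suc : ∀ n → ℕtoℚ (suc n) ≡ 1ℚ + ℕtoℚ n
ℕtoℚ-suc n = toℚᵘ-injective (begin
  toℚᵘ (ℕtoℚ (suc n))                          ≈⟨ toℚᵘ-fromℚᵘ (ℚᵘ.mkℚᵘ (ℤ.+ suc n) 0) ⟩
  ℚᵘ.mkℚᵘ (ℤ.+ suc n) 0                          ≈⟨ ℚᵘ.*≡* (cong (λ k → (ℤ.+ 1 ℤ.+ k) ℤ.* ℤ.+ 1) (sym (ℤP.*-identityʳ (ℤ.+ n)))) ⟩
  ℚᵘ.1ℚᵘ ℚᵘ.+ ℚᵘ.mkℚᵘ (ℤ.+ n) 0                  ≈⟨ ℚᵘP.+-cong ℚᵘP.≃-refl (ℚᵘP.≃-sym (toℚᵘ-fromℚᵘ (ℚᵘ.mkℚᵘ (ℤ.+ n) 0))) ⟩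
  toℚᵘ 1ℚ ℚᵘ.+ toℚᵘ (ℕtoℚ n)                   ≈⟨ ℚᵘP.≃-sym (toℚᵘ-homo-+ 1ℚ (ℕtoℚ n)) ⟩
  toℚᵘ (1ℚ + ℕtoℚ n)                           ∎)
  where open ℚᵘP.≃-Reasoning

0≤ℕtoℚ : ∀ n → 0ℚ ≤ℚ ℕtoℚ n
0≤ℕtoℚ zero    = ≤-refl
0≤ℕtoℚ (suc n) = subst (0ℚ ≤ℚ_) (sym (ℕtoℚ-suc n)) (0≤+ 0≤1 (0≤ℕtoℚ n))

1≤ℕtoℚ-suc : ∀ n → 1ℚ ≤ℚ ℕtoℚ (suc n)
1≤ℕtoℚ-suc n = ≤-slack (ℕtoℚ n) (0≤ℕtoℚ n) (ℕtoℚ-suc n)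

recip-inverse : ∀ n → ℕtoℚ (suc n) * recip (suc n) ≡ 1ℚ
recip-inverse n = toℚᵘ-injective (begin
  toℚᵘ (ℕtoℚ (suc n) * recip (suc n))
    ≈⟨ toℚᵘ-homo-* (ℕtoℚ (suc n)) (recip (suc n)) ⟩
  toℚᵘ (ℕtoℚ (suc n)) ℚᵘ.* toℚᵘ (recip (suc n))
    ≈⟨ ℚᵘP.*-cong (toℚᵘ-fromℚᵘ (ℚᵘ.mkℚᵘ (ℤ.+ suc n) 0)) (toℚᵘ-fromℚᵘ (ℚᵘ.mkℚᵘ (ℤ.+ 1) n)) ⟩
  ℚᵘ.mkℚᵘ (ℤ.+ suc n) 0 ℚᵘ.* ℚᵘ.mkℚᵘ (ℤ.+ 1) n
    ≈⟨ ℚᵘ.*≡* (cong ℤ.+_ (cong suc (trans (ℕP.*-identityʳ (n ℕ.* 1)) (trans (ℕP.*-identityʳ n) (sym (trans (ℕP.+-identityʳ (n ℕ.+ 0)) (ℕP.+-identityʳ n))))))) ⟩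
  ℚᵘ.1ℚᵘ ∎)
  where open ℚᵘP.≃-Reasoning

recip-inverse-≡ : ∀ {n k} → n ≡ suc k → ℕtoℚ n * recip n ≡ 1ℚ
recip-inverse-≡ {k = k} refl = recip-inverse k

0≤recip : ∀ n → 0ℚ ≤ℚ recip n
0≤recip zero    = ≤-refl
0≤recip (suc n) = nonNegative⁻¹ (recip (suc n)) ⦃ normalize-nonNeg 1 (suc n) ⦄

-- Indicators and the discrete metric

opaque

  𝟙 : ∀ {p} {P : Set p} → Dec P → ℚ
  𝟙 P? = if does P? then 1ℚ else 0ℚ

module _ {p} {P : Set p} where opaque

  unfolding 𝟙

  𝟙-yes : (P? : Dec P) → P → 𝟙 P? ≡ 1ℚ
  𝟙-yes (yes _) _ = refl
  𝟙-yes (no ¬p) p = contradiction p ¬p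

  𝟙-no : (P? : Dec P) → ¬ P → 𝟙 P? ≡ 0ℚ
  𝟙-no (yes p) ¬p = contradiction p ¬p
  𝟙-no (no _)  _  = refl

  0≤𝟙 : (P? : Dec P) → 0ℚ ≤ℚ 𝟙 P?
  0≤𝟙 (yes _) = 0≤1
  0≤𝟙 (no _)  = ≤-refl

  𝟙≤1 : (P? : Dec P) → 𝟙 P? ≤ℚ 1ℚ
  𝟙≤1 (yes _) = ≤-refl
  𝟙≤1 (no _)  = 0≤1

𝟙-cong : ∀ {p q} {P : Set p} {Q : Set q} (P? : Dec P) (Q? : Dec Q) →
  (P → Q) → (Q → P) → 𝟙 P? ≡ 𝟙 Q?
𝟙-cong (yes p) Q? P⇒Q Q⇒P = trans (𝟙-yes (yes p) p) (sym (𝟙-yes Q? (P⇒Q p)))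
𝟙-cong (no ¬p) Q? P⇒Q Q⇒P = trans (𝟙-no (no ¬p) ¬p) (sym (𝟙-no Q? (¬p ∘ Q⇒P)))

module _ {A : Set} (_≟_ : DecidableEquality A) where opaque

  δ : A → A → ℚ
  δ a b = 𝟙 (a ≟ b)

  δ-def : ∀ a b → δ a b ≡ 𝟙 (a ≟ b)
  δ-def a b = refl

  δ-refl : ∀ {a b} → a ≡ b → δ a b ≡ 1ℚ
  δ-refl {a} {b} = 𝟙-yes (a ≟ b)

  δ-≢ : ∀ {a b} → a ≢ b → δ a b ≡ 0ℚ
  δ-≢ {a} {b} = 𝟙-no (a ≟ b)

  0≤δ : ∀ a b → 0ℚ ≤ℚ δ a b
  0≤δ a b = 0≤𝟙 (a ≟ b)

  δ≤1 : ∀ a b → δ a b ≤ℚ 1ℚ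
  δ≤1 a b = 𝟙≤1 (a ≟ b)

  dist : A → A → ℚ
  dist a b = 𝟙 (¬? (a ≟ b))

  dist-refl : ∀ {a b} → a ≡ b → dist a b ≡ 0ℚ
  dist-refl {a} {b} a≡b = 𝟙-no (¬? (a ≟ b)) λ a≢b → a≢b a≡b

  dist-≢ : ∀ {a b} → a ≢ b → dist a b ≡ 1ℚ
  dist-≢ {a} {b} = 𝟙-yes (¬? (a ≟ b))

  0≤dist : ∀ a b → 0ℚ ≤ℚ dist a b
  0≤dist a b = 0≤𝟙 (¬? (a ≟ b))

  dist≤1 : ∀ a b → dist a b ≤ℚ 1ℚ
  dist≤1 a b = 𝟙≤1 (¬? (a ≟ b))

  dist-sym : ∀ a b → dist a b ≡ dist b a
  dist-sym a b = 𝟙-cong (¬? (a ≟ b)) (¬? (b ≟ a)) (_∘ sym) (_∘ sym)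

module _ {A : Set} (_≟_ : DecidableEquality A) where

  private
    d = dist _≟_

  dist-triangle : ∀ a b c → d a c ≤ℚ d a b + d b c
  dist-triangle a b c with a ≟ b
  ... | yes refl = ≤-slack (d a b) (0≤dist _≟_ a b) (+-comm (d a b) _)
  ... | no  a≢b  = ≤-trans (dist≤1 _≟_ a c)
    (≤-slack (d b c) (0≤dist _≟_ b c) (cong (_+ d b c) (dist-≢ _≟_ a≢b)))

-- Finite sums

module _ {A : Set} where

  opaque

    ∑ : List A → (A → ℚ) → ℚ
    ∑ L φ = Σℚ (map φ L)

    ∑-def : ∀ L φ → ∑ L φ ≡ Σℚ (map φ L)
    ∑-def L φ = refl

    ∑-[] : ∀ φ → ∑ [] φ ≡ 0ℚ
    ∑-[] φ = refl

    ∑-∷ : ∀ a L φ → ∑ (a ∷ L) φ ≡ φ a + ∑ L φ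
    ∑-∷ a L φ = refl

    ∑-cong : ∀ L {φ ψ} → (∀ a → φ a ≡ ψ a) → ∑ L φ ≡ ∑ L ψ
    ∑-cong []      eq = refl
    ∑-cong (a ∷ L) eq = cong₂ _+_ (eq a) (∑-cong L eq)

    ∑-mono : ∀ L {φ ψ} → (∀ a → φ a ≤ℚ ψ a) → ∑ L φ ≤ℚ ∑ L ψ
    ∑-mono []      le = ≤-refl
    ∑-mono (a ∷ L) le = +-mono-≤ (le a) (∑-mono L le)

    ∑-0 : ∀ L → ∑ L (λ _ → 0ℚ) ≡ 0ℚ
    ∑-0 []      = refl
    ∑-0 (a ∷ L) = trans (+-identityˡ _) (∑-0 L)

    0≤∑ : ∀ L {φ} → (∀ a → 0ℚ ≤ℚ φ a) → 0ℚ ≤ℚ ∑ L φ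
    0≤∑ L {φ} 0≤φ = subst (_≤ℚ ∑ L φ) (∑-0 L) (∑-mono L 0≤φ)

    ∑-+ : ∀ L (φ ψ : A → ℚ) → ∑ L (λ a → φ a + ψ a) ≡ ∑ L φ + ∑ L ψ
    ∑-+ []      φ ψ = refl
    ∑-+ (a ∷ L) φ ψ = trans (cong (φ a + ψ a +_) (∑-+ L φ ψ)) (exchange (φ a) (ψ a) (∑ L φ) (∑ L ψ))
      where
      exchange : ∀ a b c d → (a + b) + (c + d) ≡ (a + c) + (b + d)
      exchange = solve-∀ ℚ-ring

    ∑-*ˡ : ∀ L c φ → ∑ L (λ a → c * φ a) ≡ c * ∑ L φ
    ∑-*ˡ []      c φ = sym (*-zeroʳ c)
    ∑-*ˡ (a ∷ L) c φ = trans (cong (c * φ a +_) (∑-*ˡ L c φ)) (sym (*-distribˡ-+ c (φ a) (∑ L φ)))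

    ∑-*ʳ : ∀ L c φ → ∑ L (λ a → φ a * c) ≡ ∑ L φ * c
    ∑-*ʳ L c φ = trans (∑-cong L λ a → *-comm (φ a) c) (trans (∑-*ˡ L c φ) (*-comm c (∑ L φ)))

    ∑-neg : ∀ L φ → ∑ L (λ a → - φ a) ≡ - ∑ L φ
    ∑-neg []      φ = refl
    ∑-neg (a ∷ L) φ = trans (cong (- φ a +_) (∑-neg L φ)) (sym (neg-distrib-+ (φ a) (∑ L φ)))

    ∑-- : ∀ L φ ψ → ∑ L (λ a → φ a - ψ a) ≡ ∑ L φ - ∑ L ψ
    ∑-- L φ ψ = trans (∑-+ L φ (λ a → - ψ a)) (cong (λ s → ∑ L φ + s) (∑-neg L ψ))

    ∑-const : ∀ L c → ∑ L (λ _ → c) ≡ ℕtoℚ (length L) * c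
    ∑-const []      c = sym (*-zeroˡ c)
    ∑-const (a ∷ L) c = trans (cong (c +_) (∑-const L c))
      (trans (factor c (ℕtoℚ (length L))) (cong (_* c) (sym (ℕtoℚ-suc (length L)))))
      where
      factor : ∀ c n → c + n * c ≡ (1ℚ + n) * c
      factor = solve-∀ ℚ-ring

    ∑-++ : ∀ L M φ → ∑ (L ++ M) φ ≡ ∑ L φ + ∑ M φ
    ∑-++ []      M φ = sym (+-identityˡ _)
    ∑-++ (a ∷ L) M φ = trans (cong (φ a +_) (∑-++ L M φ)) (sym (+-assoc (φ a) _ _))

    ∑-filter : ∀ {p} {P : A → Set p} (P? : ∀ a → Dec (P a)) L φ →
      ∑ (filter P? L) φ ≡ ∑ L (λ a → 𝟙 (P? a) * φ a)
    ∑-filter P? []      φ = refl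
    ∑-filter P? (a ∷ L) φ with P? a
    ... | yes p = cong₂ _+_ (sym (trans (cong (_* φ a) (𝟙-yes (yes p) p)) (*-identityˡ (φ a)))) (∑-filter P? L φ)
    ... | no ¬p = trans (∑-filter P? L φ)
      (sym (trans (cong (_+ _) (trans (cong (_* φ a) (𝟙-no (no ¬p) ¬p)) (*-zeroˡ (φ a)))) (+-identityˡ _)))

opaque
  unfolding ∑

  ∑-≤⇒term-≤ : ∀ {A : Set} (L : List A) {φ ψ k} → length L ≡ suc k → ∑ L φ ≤ℚ ∑ L ψ → ∃[ a ] φ a ≤ℚ ψ a
  ∑-≤⇒term-≤ (a ∷ []) {k = zero} _ le = a , subst₂ _≤ℚ_ (+-identityʳ _) (+-identityʳ _) le
  ∑-≤⇒term-≤ (a ∷ L) {φ} {ψ} {suc k} eq le with φ a ≤? ψ a | ∑ L φ ≤? ∑ L ψ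
  ... | yes φa≤ψa | _       = a , φa≤ψa
  ... | no  _     | yes le′ = ∑-≤⇒term-≤ L (ℕP.suc-injective eq) le′
  ... | no  φa≰ψa | no  nle = contradiction (≤-<-trans le (+-mono-< (≰⇒> φa≰ψa) (≰⇒> nle))) (<-irrefl refl)

  ∑-map : ∀ {A B : Set} (f : A → B) L φ → ∑ (map f L) φ ≡ ∑ L (φ ∘ f)
  ∑-map f []      φ = refl
  ∑-map f (a ∷ L) φ = cong (φ (f a) +_) (∑-map f L φ)

  ∑-concatMap : ∀ {A B : Set} (f : A → List B) L φ → ∑ (concatMap f L) φ ≡ ∑ L (λ a → ∑ (f a) φ)
  ∑-concatMap f []      φ = refl
  ∑-concatMap f (a ∷ L) φ = trans (∑-++ (f a) (concatMap f L) φ) (cong (∑ (f a) φ +_) (∑-concatMap f L φ))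

  ∑-swap : ∀ {A B : Set} (L : List A) (M : List B) (φ : A → B → ℚ) →
    ∑ L (λ a → ∑ M (φ a)) ≡ ∑ M (λ b → ∑ L (λ a → φ a b))
  ∑-swap []      M φ = sym (∑-0 M)
  ∑-swap (a ∷ L) M φ = trans (cong (∑ M (φ a) +_) (∑-swap L M φ))
    (sym (∑-+ M (φ a) (λ b → ∑ L (λ a → φ a b))))

-- Sums over lists enumerating a type without repetition

module _ {A : Set} (_≟_ : DecidableEquality A) where

  -- One equation says that every element occurs and that none occurs twice, in the form in which
  -- sums consume it.
  Enumerates : List A → Set
  Enumerates L = ∀ a → ∑ L (λ x → δ _≟_ x a) ≡ 1ℚ

module _ {A : Set} {_≟_ : DecidableEquality A} {L : List A} (enum : Enumerates _≟_ L) where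

  ∑-δ : ∀ (φ : A → ℚ) a → ∑ L (λ x → δ _≟_ x a * φ x) ≡ φ a
  ∑-δ φ a = trans (∑-cong L pointwise) (trans (∑-*ʳ L (φ a) (λ x → δ _≟_ x a))
    (trans (cong (_* φ a) (enum a)) (*-identityˡ (φ a))))
    where
    pointwise : ∀ x → δ _≟_ x a * φ x ≡ δ _≟_ x a * φ a
    pointwise x with x ≟ a
    ... | yes refl = refl
    ... | no  x≢a  = trans (trans (cong (_* φ x) (δ-≢ _≟_ x≢a)) (*-zeroˡ (φ x)))
      (sym (trans (cong (_* φ a) (δ-≢ _≟_ x≢a)) (*-zeroˡ (φ a))))

  -- Expanding `φ (f a)` in point masses and swapping the sums leaves, for each x, the weight of its
  -- fibre, which is the single point `g x`.
  ∑-bijection : (f g : A → A) → (∀ a → f (g a) ≡ a) → (∀ a → g (f a) ≡ a) →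
    ∀ (φ : _ → ℚ) → ∑ L (φ ∘ f) ≡ ∑ L φ
  ∑-bijection f g fg gf φ = begin
    ∑ L (λ a → φ (f a))                               ≡⟨ ∑-cong L (λ a → sym (∑-δ φ (f a))) ⟩
    ∑ L (λ a → ∑ L (λ x → δ _≟_ x (f a) * φ x))       ≡⟨ ∑-swap L L _ ⟩
    ∑ L (λ x → ∑ L (λ a → δ _≟_ x (f a) * φ x))       ≡⟨ ∑-cong L (λ x → ∑-*ʳ L (φ x) _) ⟩
    ∑ L (λ x → ∑ L (λ a → δ _≟_ x (f a)) * φ x)       ≡⟨ ∑-cong L (λ x → cong (_* φ x) (fibre x)) ⟩
    ∑ L (λ x → 1ℚ * φ x)                              ≡⟨ ∑-cong L (λ x → *-identityˡ (φ x)) ⟩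
    ∑ L φ                                             ∎
    where
    open ≡-Reasoning
    fibre : ∀ x → ∑ L (λ a → δ _≟_ x (f a)) ≡ 1ℚ
    fibre x = trans (∑-cong L λ a → trans (δ-def _≟_ x (f a)) (trans (𝟙-cong (x ≟ f a) (a ≟ g x)
        (λ x≡fa → trans (sym (gf a)) (cong g (sym x≡fa)))
        (λ a≡gx → trans (sym (fg x)) (cong f (sym a≡gx)))) (sym (δ-def _≟_ a (g x)))))
      (enum (g x))

  term≤∑ : ∀ {φ} → (∀ x → 0ℚ ≤ℚ φ x) → ∀ a → φ a ≤ℚ ∑ L φ
  term≤∑ {φ} 0≤φ a = subst (_≤ℚ ∑ L φ) (∑-δ φ a) (∑-mono L λ x →
    subst (δ _≟_ x a * φ x ≤ℚ_) (*-identityˡ (φ x)) (*-monoʳ-≤ (0≤φ x) (δ≤1 _≟_ x a)))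

  ∑-supported₂ : ∀ {a b} → a ≢ b → ∀ (φ : _ → ℚ) → (∀ x → x ≢ a → x ≢ b → φ x ≡ 0ℚ) →
    ∑ L φ ≡ φ a + φ b
  ∑-supported₂ {a} {b} a≢b φ vanish = trans (∑-cong L pointwise)
    (trans (∑-+ L _ _) (cong₂ _+_ (∑-δ φ a) (∑-δ φ b)))
    where
    1·+0· : ∀ {p q} c → p ≡ 1ℚ → q ≡ 0ℚ → c ≡ p * c + q * c
    1·+0· c refl refl = sym (trans (cong₂ _+_ (*-identityˡ c) (*-zeroˡ c)) (+-identityʳ c))
    pointwise : ∀ x → φ x ≡ δ _≟_ x a * φ x + δ _≟_ x b * φ x
    pointwise x with x ≟ a | x ≟ b
    ... | yes refl | _        = 1·+0· (φ x) (δ-refl _≟_ refl) (δ-≢ _≟_ a≢b)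
    ... | no x≢a   | yes refl = trans (1·+0· (φ x) (δ-refl _≟_ {x} refl) (δ-≢ _≟_ x≢a)) (+-comm (δ _≟_ x x * φ x) (δ _≟_ x a * φ x))
    ... | no x≢a   | no x≢b   = trans (vanish x x≢a x≢b)
      (sym (trans (cong (λ c → δ _≟_ x a * c + δ _≟_ x b * c) (vanish x x≢a x≢b))
        (trans (cong₂ _+_ (*-zeroʳ (δ _≟_ x a)) (*-zeroʳ (δ _≟_ x b))) (+-identityˡ 0ℚ))))

-- Finite probability spaces with the uniform measure

record Space (A : Set) : Set where
  constructor uniform
  field
    elements : List A
    nonempty : ∃[ k ] length elements ≡ suc k

open Space

module _ {A : Set} (s : Space A) where

  opaque

    E : (A → ℚ) → ℚ
    E φ = ∑ (elements s) φ * recip (length (elements s))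

    E-def : ∀ φ → E φ ≡ ∑ (elements s) φ * recip (length (elements s))
    E-def φ = refl

    private
      L : List A
      L = elements s

      w : ℚ
      w = recip (length L)

      0≤w : 0ℚ ≤ℚ w
      0≤w = 0≤recip (length L)

      total : ℕtoℚ (length L) * w ≡ 1ℚ
      total = recip-inverse-≡ (proj₂ (nonempty s))

    E-total : ∀ φ → ℕtoℚ (length (elements s)) * E φ ≡ ∑ (elements s) φ
    E-total φ = trans (rotate (ℕtoℚ (length L)) (∑ L φ) w) (trans (cong (∑ L φ *_) total) (*-identityʳ (∑ L φ)))
      where
      rotate : ∀ n t w → n * (t * w) ≡ t * (n * w)
      rotate = solve-∀ ℚ-ring

    E-cong : ∀ {φ ψ} → (∀ a → φ a ≡ ψ a) → E φ ≡ E ψ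
    E-cong eq = cong (_* w) (∑-cong L eq)

    E-mono : ∀ {φ ψ} → (∀ a → φ a ≤ℚ ψ a) → E φ ≤ℚ E ψ
    E-mono le = *-monoʳ-≤ 0≤w (∑-mono L le)

    0≤E : ∀ {φ} → (∀ a → 0ℚ ≤ℚ φ a) → 0ℚ ≤ℚ E φ
    0≤E 0≤φ = 0≤* (0≤∑ L 0≤φ) 0≤w

    E-+ : ∀ φ ψ → E (λ a → φ a + ψ a) ≡ E φ + E ψ
    E-+ φ ψ = trans (cong (_* w) (∑-+ L φ ψ)) (*-distribʳ-+ w (∑ L φ) (∑ L ψ))

    E-*ˡ : ∀ c φ → E (λ a → c * φ a) ≡ c * E φ
    E-*ˡ c φ = trans (cong (_* w) (∑-*ˡ L c φ)) (*-assoc c (∑ L φ) w)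

    E-*ʳ : ∀ c φ → E (λ a → φ a * c) ≡ E φ * c
    E-*ʳ c φ = trans (E-cong λ a → *-comm (φ a) c) (trans (E-*ˡ c φ) (*-comm c (E φ)))

    E-neg : ∀ (φ : _ → ℚ) → E (λ a → - φ a) ≡ - E φ
    E-neg φ = trans (cong (_* w) (∑-neg L φ)) (sym (neg-distribˡ-* (∑ L φ) w))

    E-- : ∀ φ ψ → E (λ a → φ a - ψ a) ≡ E φ - E ψ
    E-- φ ψ = trans (E-+ φ (λ a → - ψ a)) (cong (λ s → E φ + s) (E-neg ψ))

    E-const : ∀ c → E (λ _ → c) ≡ c
    E-const c = trans (cong (_* w) (∑-const L c)) (trans (rotate (ℕtoℚ (length L)) c w)
      (trans (cong (c *_) total) (*-identityʳ c)))
      where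
      rotate : ∀ n c w → n * c * w ≡ c * (n * w)
      rotate = solve-∀ ℚ-ring

    E-∑ : ∀ {B : Set} (M : List B) (φ : A → B → ℚ) → E (λ a → ∑ M (φ a)) ≡ ∑ M (λ b → E (λ a → φ a b))
    E-∑ M φ = trans (cong (_* w) (∑-swap L M φ)) (sym (∑-*ʳ M w _))

    E-bound : ∀ {φ c} → (∀ a → φ a ≤ℚ c) → E φ ≤ℚ c
    E-bound {φ} {c} le = subst (E φ ≤ℚ_) (E-const c) (E-mono le)

  opaque
    unfolding E

    -- Every later choice of a profile is made here. Where the chosen point must be good in several
    -- respects, the errors are first added into one `φ`.
    E-attained : ∀ φ → ∃[ a ] φ a ≤ℚ E φ
    E-attained φ = ∑-≤⇒term-≤ L (proj₂ (nonempty s)) (≤-reflexive average)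
      where
      average : ∑ L φ ≡ ∑ L (λ _ → E φ)
      average = sym (trans (∑-const L (E φ)) (E-total φ))

opaque
  unfolding E

  E-swap : ∀ {A B : Set} (s : Space A) (t : Space B) (φ : A → B → ℚ) →
    E s (λ a → E t (φ a)) ≡ E t (λ b → E s (λ a → φ a b))
  E-swap s t φ = trans (E-*ʳ s (recip (length (elements t))) _)
    (cong (_* recip (length (elements t))) (E-∑ s (elements t) φ))

length-product : ∀ {A B C : Set} (f : A → B → C) (L : List A) (M : List B) →
  length (concatMap (λ a → map (f a) M) L) ≡ length L ℕ.* length M
length-product f []      M = refl
length-product f (a ∷ L) M = trans (List.length-++ (map (f a) M))
  (cong₂ ℕ._+_ (List.length-map (f a) M) (length-product f L M))

recip-* : ∀ a b → recip (suc a ℕ.* suc b) ≡ recip (suc a) * recip (suc b)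
recip-* a b = begin
  r                                            ≡⟨ sym (trans (cong₂ _*_ (cong₂ _*_ (refl {x = r}) (recip-inverse a)) (recip-inverse b)) (units r)) ⟩
  r * (ℕtoℚ (suc a) * ra) * (ℕtoℚ (suc b) * rb) ≡⟨ shuffle r (ℕtoℚ (suc a)) ra (ℕtoℚ (suc b)) rb ⟩
  (ℕtoℚ (suc a) * ℕtoℚ (suc b)) * r * (ra * rb) ≡⟨ cong (λ t → t * r * (ra * rb)) (sym (ℕtoℚ-* (suc a) (suc b))) ⟩
  ℕtoℚ (suc a ℕ.* suc b) * r * (ra * rb)       ≡⟨ cong (_* (ra * rb)) (recip-inverse (b ℕ.+ a ℕ.* suc b)) ⟩
  1ℚ * (ra * rb)                               ≡⟨ *-identityˡ _ ⟩
  ra * rb                                      ∎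
  where
  open ≡-Reasoning
  r = recip (suc a ℕ.* suc b)
  ra = recip (suc a)
  rb = recip (suc b)
  units : ∀ r → r * 1ℚ * 1ℚ ≡ r
  units = solve-∀ ℚ-ring
  shuffle : ∀ r a ra b rb → r * (a * ra) * (b * rb) ≡ (a * b) * r * (ra * rb)
  shuffle = solve-∀ ℚ-ring
  ℕtoℚ-+ : ∀ a b → ℕtoℚ (a ℕ.+ b) ≡ ℕtoℚ a + ℕtoℚ b
  ℕtoℚ-+ zero    b = sym (+-identityˡ _)
  ℕtoℚ-+ (suc a) b = trans (ℕtoℚ-suc (a ℕ.+ b)) (trans (cong (1ℚ +_) (ℕtoℚ-+ a b))
    (trans (sym (+-assoc 1ℚ (ℕtoℚ a) (ℕtoℚ b))) (cong (_+ ℕtoℚ b) (sym (ℕtoℚ-suc a)))))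
  ℕtoℚ-* : ∀ a b → ℕtoℚ (a ℕ.* b) ≡ ℕtoℚ a * ℕtoℚ b
  ℕtoℚ-* zero    b = sym (*-zeroˡ (ℕtoℚ b))
  ℕtoℚ-* (suc a) b = trans (ℕtoℚ-+ b (a ℕ.* b)) (trans (cong (ℕtoℚ b +_) (ℕtoℚ-* a b))
    (trans (factor (ℕtoℚ a) (ℕtoℚ b)) (cong (_* ℕtoℚ b) (sym (ℕtoℚ-suc a)))))
    where
    factor : ∀ a b → b + a * b ≡ (1ℚ + a) * b
    factor = solve-∀ ℚ-ring

recip-*-≡ : ∀ {a b j k} → a ≡ suc j → b ≡ suc k → recip (a ℕ.* b) ≡ recip a * recip b
recip-*-≡ {j = j} {k} refl refl = recip-* j k

module _ {A B C : Set} (f : A → B → C) (s : Space A) (t : Space B) where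

  productSpace : Space C
  productSpace .elements = concatMap (λ a → map (f a) (elements t)) (elements s)
  productSpace .nonempty with nonempty s | nonempty t
  ... | j , eq | k , eq′ = _ , trans (length-product f (elements s) (elements t)) (cong₂ ℕ._*_ eq eq′)

  opaque
    unfolding E

    E-product : ∀ (φ : _ → ℚ) → E productSpace φ ≡ E s (λ a → E t (λ b → φ (f a b)))
    E-product φ = begin
      ∑ (elements productSpace) φ * recip (length (elements productSpace))
        ≡⟨ cong₂ _*_ (trans (∑-concatMap _ (elements s) φ) (∑-cong (elements s) λ a → ∑-map (f a) (elements t) φ))
                     (trans (cong recip (length-product f (elements s) (elements t))) (recip-*-≡ (proj₂ (nonempty s)) (proj₂ (nonempty t)))) ⟩
      S * (recip (length (elements s)) * recip (length (elements t)))
        ≡⟨ rotate S (recip (length (elements s))) (recip (length (elements t))) ⟩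
      S * recip (length (elements t)) * recip (length (elements s))
        ≡⟨ cong (_* recip (length (elements s))) (sym (∑-*ʳ (elements s) (recip (length (elements t))) _)) ⟩
      E s (λ a → E t (λ b → φ (f a b))) ∎
      where
      open ≡-Reasoning
      S : ℚ
      S = ∑ (elements s) (λ a → ∑ (elements t) (λ b → φ (f a b)))
      rotate : ∀ n t w → n * (t * w) ≡ n * w * t
      rotate = solve-∀ ℚ-ring

module _ {A : Set} (s : Space A) where

  vectors : ∀ n → Space (Vec A n)
  vectors zero    = uniform ([] ∷ []) (0 , refl)
  vectors (suc n) = productSpace _∷_ s (vectors n)

  vectors-elements : ∀ n → elements (vectors n) ≡ allVecs (elements s) n
  vectors-elements zero    = refl
  vectors-elements (suc n) rewrite vectors-elements n = refl

  opaque
    unfolding E ∑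

    E-vectors-[] : ∀ (φ : _ → ℚ) → E (vectors 0) φ ≡ φ []
    E-vectors-[] φ = trans (*-identityʳ _) (+-identityʳ _)

  E-vectors-∷ : ∀ n φ → E (vectors (suc n)) φ ≡ E s (λ a → E (vectors n) (λ v → φ (a ∷ v)))
  E-vectors-∷ n φ = E-product _∷_ s (vectors n) φ

-- Measure-preserving maps and selections on product spaces

-- The image under `f` of the uniform measure on `s` is that on `t`, expressed through test
-- functions.
MeasurePreserving : ∀ {A B : Set} → Space A → Space B → (A → B) → Set
MeasurePreserving s t f = ∀ φ → E s (φ ∘ f) ≡ E t φ

Mask : ℕ → Set
Mask n = Fin n → Bool

mapᵢ : ∀ {A B : Set} {n} → (Fin n → A → B) → Vec A n → Vec B n
mapᵢ f []      = []
mapᵢ f (a ∷ v) = f zero a ∷ mapᵢ (f ∘ suc) v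

lookup-mapᵢ : ∀ {A B : Set} {n} (f : Fin n → A → B) v i → lookup (mapᵢ f v) i ≡ f i (lookup v i)
lookup-mapᵢ f (a ∷ v) zero    = refl
lookup-mapᵢ f (a ∷ v) (suc i) = lookup-mapᵢ (f ∘ suc) v i

sel : ∀ {A : Set} {n} → Mask n → Vec A n → Vec A n → Vec A n
sel S []      []      = []
sel S (a ∷ u) (b ∷ v) = (if S zero then a else b) ∷ sel (S ∘ suc) u v

module _ {A B : Set} where

  mapᵢ-sel : ∀ {n} (S : Mask n) (f : A → B) u v →
    mapᵢ (λ _ → f) (sel S u v) ≡ sel S (mapᵢ (λ _ → f) u) (mapᵢ (λ _ → f) v)
  mapᵢ-sel S f []      []      = refl
  mapᵢ-sel S f (a ∷ u) (b ∷ v) with S zero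
  ... | true  = cong (f a ∷_) (mapᵢ-sel (S ∘ suc) f u v)
  ... | false = cong (f b ∷_) (mapᵢ-sel (S ∘ suc) f u v)

  mapᵢ-if : ∀ {n} (S : Mask n) (f g : A → B) v →
    mapᵢ (λ i a → if S i then f a else g a) v ≡ sel S (mapᵢ (λ _ → f) v) (mapᵢ (λ _ → g) v)
  mapᵢ-if S f g []      = refl
  mapᵢ-if S f g (a ∷ v) = cong (_ ∷_) (mapᵢ-if (S ∘ suc) f g v)

  mapᵢ-cong : ∀ {n} {f g : Fin n → A → B} → (∀ i a → f i a ≡ g i a) → ∀ v → mapᵢ f v ≡ mapᵢ g v
  mapᵢ-cong eq []      = refl
  mapᵢ-cong eq (a ∷ v) = cong₂ _∷_ (eq zero a) (mapᵢ-cong (eq ∘ suc) v)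

mapᵢ-∘ : ∀ {A B C : Set} {n} (f : Fin n → B → C) (g : Fin n → A → B) v →
  mapᵢ f (mapᵢ g v) ≡ mapᵢ (λ i → f i ∘ g i) v
mapᵢ-∘ f g []      = refl
mapᵢ-∘ f g (a ∷ v) = cong (f zero (g zero a) ∷_) (mapᵢ-∘ (f ∘ suc) (g ∘ suc) v)

module _ {A : Set} where

  sel-idem : ∀ {n} (S : Mask n) (x : Vec A n) → sel S x x ≡ x
  sel-idem S []      = refl
  sel-idem S (a ∷ x) with S zero
  ... | true  = cong (a ∷_) (sel-idem (S ∘ suc) x)
  ... | false = cong (a ∷_) (sel-idem (S ∘ suc) x)

  sel-selˡ : ∀ {n} (S : Mask n) (x y z : Vec A n) → sel S (sel S x y) z ≡ sel S x z
  sel-selˡ S []      []      []      = refl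
  sel-selˡ S (a ∷ x) (b ∷ y) (c ∷ z) with S zero
  ... | true  = cong (a ∷_) (sel-selˡ (S ∘ suc) x y z)
  ... | false = cong (c ∷_) (sel-selˡ (S ∘ suc) x y z)

  sel-selʳ : ∀ {n} (S : Mask n) (x y z : Vec A n) → sel S x (sel S y z) ≡ sel S x z
  sel-selʳ S []      []      []      = refl
  sel-selʳ S (a ∷ x) (b ∷ y) (c ∷ z) with S zero
  ... | true  = cong (a ∷_) (sel-selʳ (S ∘ suc) x y z)
  ... | false = cong (c ∷_) (sel-selʳ (S ∘ suc) x y z)

  sel-not : ∀ {n} (S : Mask n) (x y : Vec A n) → sel (not ∘ S) x y ≡ sel S y x
  sel-not S []      []      = refl
  sel-not S (a ∷ x) (b ∷ y) with S zero
  ... | true  = cong (b ∷_) (sel-not (S ∘ suc) x y)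
  ... | false = cong (a ∷_) (sel-not (S ∘ suc) x y)

  sel-∧ : ∀ {n} (S T : Mask n) (x y z : Vec A n) →
    sel T (sel S x y) z ≡ sel (λ i → S i ∧ T i) x (sel T y z)
  sel-∧ S T []      []      []      = refl
  sel-∧ S T (a ∷ x) (b ∷ y) (c ∷ z) with S zero | T zero
  ... | true  | true  = cong (a ∷_) (sel-∧ (S ∘ suc) (T ∘ suc) x y z)
  ... | true  | false = cong (c ∷_) (sel-∧ (S ∘ suc) (T ∘ suc) x y z)
  ... | false | true  = cong (b ∷_) (sel-∧ (S ∘ suc) (T ∘ suc) x y z)
  ... | false | false = cong (c ∷_) (sel-∧ (S ∘ suc) (T ∘ suc) x y z)

  sel-cong : ∀ {n} {S T : Mask n} → (∀ i → S i ≡ T i) → (x y : Vec A n) → sel S x y ≡ sel T x y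
  sel-cong eq []      []      = refl
  sel-cong eq (a ∷ x) (b ∷ y) =
    cong₂ _∷_ (cong (if_then a else b) (eq zero)) (sel-cong (eq ∘ suc) x y)

  sel-true : ∀ {n} (x y : Vec A n) → sel (λ _ → true) x y ≡ x
  sel-true []      []      = refl
  sel-true (a ∷ x) (b ∷ y) = cong (a ∷_) (sel-true x y)

  sel-false : ∀ {n} (x y : Vec A n) → sel (λ _ → false) x y ≡ y
  sel-false []      []      = refl
  sel-false (a ∷ x) (b ∷ y) = cong (b ∷_) (sel-false x y)

  sel-single : ∀ {n} (i : Fin n) (x y : Vec A n) →
    sel (λ k → does (k Fin.≟ i)) x y ≡ y [ i ]≔ lookup x i
  sel-single zero    (a ∷ x) (b ∷ y) = cong (a ∷_) (sel-false x y)
  sel-single (suc i) (a ∷ x) (b ∷ y) = cong (b ∷_) (sel-single i x y)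

module _ {A B : Set} {s : Space A} {t : Space B} where

  mapᵢ-preserving : ∀ {n} {f : Fin n → A → B} → (∀ i → MeasurePreserving s t (f i)) →
    MeasurePreserving (vectors s n) (vectors t n) (mapᵢ f)
  mapᵢ-preserving {zero} mp φ = trans (E-vectors-[] s _) (sym (E-vectors-[] t φ))
  mapᵢ-preserving {suc n} {f} mp φ = begin
    E (vectors s (suc n)) (φ ∘ mapᵢ f)
      ≡⟨ E-vectors-∷ s n _ ⟩
    E s (λ a → E (vectors s n) (λ v → φ (f zero a ∷ mapᵢ (f ∘ suc) v)))
      ≡⟨ E-cong s (λ a → mapᵢ-preserving (mp ∘ suc) (λ w → φ (f zero a ∷ w))) ⟩
    E s (λ a → E (vectors t n) (λ w → φ (f zero a ∷ w)))
      ≡⟨ mp zero (λ b → E (vectors t n) (λ w → φ (b ∷ w))) ⟩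
    E t (λ b → E (vectors t n) (λ w → φ (b ∷ w)))
      ≡⟨ sym (E-vectors-∷ t n φ) ⟩
    E (vectors t (suc n)) φ ∎
    where open ≡-Reasoning

module _ {A B : Set} {s : Space A} {t : Space B} {f g : A → B} where

  -- Coordinates are drawn independently, so independence of the two images of one coordinate passes
  -- to the two image vectors. This lifts a coupling of ballots to a coupling of profiles.
  mapᵢ-independent : (∀ (ψ : B → B → ℚ) → E s (λ a → ψ (f a) (g a)) ≡ E t (λ b → E t (ψ b))) →
    ∀ n (ψ : Vec B n → Vec B n → ℚ) → E (vectors s n) (λ v → ψ (mapᵢ (λ _ → f) v) (mapᵢ (λ _ → g) v)) ≡
            E (vectors t n) (λ x → E (vectors t n) (ψ x))
  mapᵢ-independent indep zero ψ = trans (E-vectors-[] s _)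
    (sym (trans (E-vectors-[] t _) (E-vectors-[] t _)))
  mapᵢ-independent indep (suc n) ψ = begin
    E (vectors s (suc n)) (λ v → ψ (mapᵢ (λ _ → f) v) (mapᵢ (λ _ → g) v))
      ≡⟨ E-vectors-∷ s n _ ⟩
    E s (λ a → E (vectors s n) (λ v → ψ (f a ∷ mapᵢ (λ _ → f) v) (g a ∷ mapᵢ (λ _ → g) v)))
      ≡⟨ E-cong s (λ a → mapᵢ-independent indep n (λ x y → ψ (f a ∷ x) (g a ∷ y))) ⟩
    E s (λ a → E (vectors t n) (λ x → E (vectors t n) (λ y → ψ (f a ∷ x) (g a ∷ y))))
      ≡⟨ indep (λ b c → E (vectors t n) (λ x → E (vectors t n) (λ y → ψ (b ∷ x) (c ∷ y)))) ⟩
    E t (λ b → E t (λ c → E (vectors t n) (λ x → E (vectors t n) (λ y → ψ (b ∷ x) (c ∷ y)))))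
      ≡⟨ E-cong t (λ b → E-swap t (vectors t n) _) ⟩
    E t (λ b → E (vectors t n) (λ x → E t (λ c → E (vectors t n) (λ y → ψ (b ∷ x) (c ∷ y)))))
      ≡⟨ E-cong t (λ b → E-cong (vectors t n) (λ x → sym (E-vectors-∷ t n (ψ (b ∷ x))))) ⟩
    E t (λ b → E (vectors t n) (λ x → E (vectors t (suc n)) (ψ (b ∷ x))))
      ≡⟨ sym (E-vectors-∷ t n _) ⟩
    E (vectors t (suc n)) (λ x → E (vectors t (suc n)) (ψ x)) ∎
    where open ≡-Reasoning

module _ {A : Set} (s : Space A) where

  -- Each coordinate comes from exactly one of two independent uniform vectors. Hence all corners of
  -- a random rectangle are uniform.
  E-sel : ∀ {n} (S : Mask n) φ →
    E (vectors s n) (λ u → E (vectors s n) (λ v → φ (sel S u v))) ≡ E (vectors s n) φ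
  E-sel {zero}  S φ = trans (E-vectors-[] s _) (trans (E-vectors-[] s _) (sym (E-vectors-[] s φ)))
  E-sel {suc n} S φ = begin
    E (vectors s (suc n)) (λ u → E (vectors s (suc n)) (λ v → φ (sel S u v)))
      ≡⟨ E-vectors-∷ s n _ ⟩
    E s (λ a → E (vectors s n) (λ u → E (vectors s (suc n)) (λ v → φ (sel S (a ∷ u) v))))
      ≡⟨ E-cong s (λ a → E-cong (vectors s n) (λ u → E-vectors-∷ s n _)) ⟩
    E s (λ a → E (vectors s n) (λ u → E s (λ b → E (vectors s n) (λ v → φ (sel S (a ∷ u) (b ∷ v))))))
      ≡⟨ E-cong s (λ a → E-swap (vectors s n) s _) ⟩
    E s (λ a → E s (λ b → E (vectors s n) (λ u → E (vectors s n) (λ v → φ (sel S (a ∷ u) (b ∷ v))))))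
      ≡⟨ E-cong s (λ a → E-cong s (λ b → E-sel (S ∘ suc) (λ w → φ ((if S zero then a else b) ∷ w)))) ⟩
    E s (λ a → E s (λ b → Φ (if S zero then a else b)))
      ≡⟨ head (S zero) ⟩
    E s Φ
      ≡⟨ sym (E-vectors-∷ s n φ) ⟩
    E (vectors s (suc n)) φ ∎
    where
    open ≡-Reasoning
    Φ : A → ℚ
    Φ c = E (vectors s n) (λ w → φ (c ∷ w))
    head : ∀ b → E s (λ a → E s (λ a′ → Φ (if b then a else a′))) ≡ E s Φ
    head true  = E-cong s (λ a → E-const s (Φ a))
    head false = E-const s (E s Φ)

  E-lookup : ∀ {n} (i : Fin n) φ → E (vectors s n) (λ v → φ (lookup v i)) ≡ E s φ
  E-lookup {suc n} zero    φ = trans (E-vectors-∷ s n _) (E-cong s λ a → E-const (vectors s n) (φ a))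
  E-lookup {suc n} (suc i) φ = trans (E-vectors-∷ s n _) (trans (E-const s _) (E-lookup i φ))

-- Equality of the two-element multisets {a, b} and {c, e}.
SamePair : {C : Set} → C → C → C → C → Set
SamePair a b c e = (a ≡ c × b ≡ e) ⊎ (a ≡ e × b ≡ c)

samePair? : {C : Set} → DecidableEquality C → (a b c e : C) → Dec (SamePair a b c e)
samePair? _≟_ a b c e = ((a ≟ c) ×-dec (b ≟ e)) ⊎-dec ((a ≟ e) ×-dec (b ≟ c))

-- Dependence of a function on the coordinates outside a mask

module Dependence {A C : Set} (s : Space A) (_≟_ : DecidableEquality C) {n} (G : Vec A n → C) where

  private
    V = vectors s n
    d : C → C → ℚ
    d = dist _≟_

  -- Coordinates in `S` are kept and the others resampled: a small value means that `G` nearly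
  -- ignores the complement of `S`.
  dependence : Mask n → ℚ
  dependence S = E V (λ x → E V (λ y → d (G x) (G (sel S x y))))

  -- x, y and their two mixtures are the corners of a rectangle. The value is 1 when the two
  -- diagonals carry different multisets of colours, that is, when the indicator of some colour is
  -- not additive on the rectangle.
  crossing : Mask n → Vec A n → Vec A n → ℚ
  crossing S x y = 𝟙 (¬? (samePair? _≟_ (G x) (G y) (G (sel S x y)) (G (sel S y x))))

  rectangleDefect : Mask n → ℚ
  rectangleDefect S = E V (λ x → E V (crossing S x))

  0≤dependence : ∀ S → 0ℚ ≤ℚ dependence S
  0≤dependence S = 0≤E V λ x → 0≤E V λ y → 0≤dist _≟_ (G x) (G (sel S x y))

  dependence-cong : ∀ {S T} → (∀ i → S i ≡ T i) → dependence S ≡ dependence T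
  dependence-cong eq = E-cong V λ x → E-cong V λ y → cong (λ z → d (G x) (G z)) (sel-cong eq x y)

  dependence-true : dependence (λ _ → true) ≡ 0ℚ
  dependence-true = trans (E-cong V λ x → trans (E-cong V λ y →
    dist-refl _≟_ (cong G (sym (sel-true x y)))) (E-const V 0ℚ)) (E-const V 0ℚ)

  dependence-false : dependence (λ _ → false) ≡ E V (λ x → E V (λ y → d (G x) (G y)))
  dependence-false = E-cong V λ x → E-cong V λ y → cong (λ z → d (G x) (G z)) (sel-false x y)

  dependence-not : ∀ S → dependence (not ∘ S) ≡ E V (λ x → E V (λ y → d (G y) (G (sel S x y))))
  dependence-not S = trans (E-swap V V _)
    (E-cong V λ x → E-cong V λ y → cong (λ z → d (G y) (G z)) (sel-not S y x))

  -- Resampling outside `S` and then outside `T` resamples outside the intersection, and the vector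
  -- in between is again uniform.
  dependence-∧ : ∀ S T → dependence (λ i → S i ∧ T i) ≤ℚ dependence S + dependence T
  dependence-∧ S T = begin
    dependence (λ i → S i ∧ T i)
      ≡⟨ E-cong V (λ x → sym (E-sel s T _)) ⟩
    E V (λ x → E V (λ y → E V (λ z → d (G x) (G (sel (λ i → S i ∧ T i) x (sel T y z))))))
      ≡⟨ E-cong V (λ x → E-cong V λ y → E-cong V λ z → cong (λ w → d (G x) (G w)) (sym (sel-∧ S T x y z))) ⟩
    E V (λ x → E V (λ y → E V (λ z → d (G x) (G (sel T (sel S x y) z)))))
      ≤⟨ E-mono V (λ x → E-mono V λ y → E-mono V λ z →
           dist-triangle _≟_ (G x) (G (sel S x y)) (G (sel T (sel S x y) z))) ⟩
    E V (λ x → E V (λ y → E V (λ z → d (G x) (G (sel S x y)) + d (G (sel S x y)) (G (sel T (sel S x y) z)))))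
      ≡⟨ E-cong V (λ x → E-cong V λ y → trans (E-+ V _ _) (cong (_+ Ψ (sel S x y)) (E-const V (d (G x) (G (sel S x y)))))) ⟩
    E V (λ x → E V (λ y → d (G x) (G (sel S x y)) + Ψ (sel S x y)))
      ≡⟨ trans (E-cong V (λ x → E-+ V _ _)) (E-+ V _ _) ⟩
    dependence S + E V (λ x → E V (λ y → Ψ (sel S x y)))
      ≡⟨ cong (dependence S +_) (E-sel s S Ψ) ⟩
    dependence S + dependence T ∎
    where
    open ≤-Reasoning
    Ψ : Vec A n → ℚ
    Ψ w = E V (λ z → d (G w) (G (sel T w z)))

  dependence-false≤ : ∀ S → dependence (λ _ → false) ≤ℚ dependence S + dependence (not ∘ S)
  dependence-false≤ S = begin
    dependence (λ _ → false)
      ≡⟨ dependence-false ⟩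
    E V (λ x → E V (λ y → d (G x) (G y)))
      ≤⟨ E-mono V (λ x → E-mono V λ y → ≤-trans (dist-triangle _≟_ (G x) (G (sel S x y)) (G y))
           (≤-reflexive (cong (d (G x) (G (sel S x y)) +_) (dist-sym _≟_ (G (sel S x y)) (G y))))) ⟩
    E V (λ x → E V (λ y → d (G x) (G (sel S x y)) + d (G y) (G (sel S x y))))
      ≡⟨ trans (E-cong V (λ x → E-+ V _ _)) (E-+ V _ _) ⟩
    dependence S + E V (λ x → E V (λ y → d (G y) (G (sel S x y))))
      ≡⟨ cong (dependence S +_) (sym (dependence-not S)) ⟩
    dependence S + dependence (not ∘ S) ∎
    where open ≤-Reasoning

  -- Both x and its mixture are uniform, so each can be compared with an independent z.
  dependence≤false : ∀ S → dependence S ≤ℚ dependence (λ _ → false) + dependence (λ _ → false)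
  dependence≤false S = begin
    dependence S
      ≡⟨ sym (E-const V _) ⟩
    E V (λ z → dependence S)
      ≤⟨ E-mono V (λ z → E-mono V λ x → E-mono V λ y → ≤-trans (dist-triangle _≟_ (G x) (G z) (G (sel S x y)))
           (≤-reflexive (cong (_+ d (G z) (G (sel S x y))) (dist-sym _≟_ (G x) (G z))))) ⟩
    E V (λ z → E V (λ x → E V (λ y → d (G z) (G x) + d (G z) (G (sel S x y)))))
      ≡⟨ E-cong V (λ z → trans (E-cong V λ x → E-+ V _ _) (E-+ V _ _)) ⟩
    E V (λ z → E V (λ x → E V (λ y → d (G z) (G x))) + E V (λ x → E V (λ y → d (G z) (G (sel S x y)))))
      ≡⟨ E-cong V (λ z → cong₂ _+_ (E-cong V λ x → E-const V _) (E-sel s S (λ w → d (G z) (G w)))) ⟩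
    E V (λ z → E V (λ x → d (G z) (G x)) + E V (λ x → d (G z) (G x)))
      ≡⟨ trans (E-+ V _ _) (sym (cong₂ _+_ dependence-false dependence-false)) ⟩
    dependence (λ _ → false) + dependence (λ _ → false) ∎
    where open ≤-Reasoning

  private
    defect : C → C → C → C → ℚ
    defect a b c e = 𝟙 (¬? (samePair? _≟_ a b c e))

    0≤defect : ∀ a b c e → 0ℚ ≤ℚ defect a b c e
    0≤defect a b c e = 0≤𝟙 (¬? (samePair? _≟_ a b c e))

    defect-no : ∀ {a b c e} → ¬ SamePair a b c e → 1ℚ ≤ℚ defect a b c e
    defect-no {a} {b} {c} {e} ¬r = ≤-reflexive (sym (𝟙-yes (¬? (samePair? _≟_ a b c e)) ¬r))

    -- Picture a grid whose rows are the parts in S and whose columns are the parts off S. The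
    -- change from p to q between two columns is carried by the first rectangle to another row, as z
    -- ≢ z₂; the change from p′ to q′ between two rows is carried by the second to another column,
    -- as z ≢ z₃. In the third rectangle z must equal z₂ or z₃.
    rectangles-exclude : ∀ {p q p′ q′ z z₂ z₃ w : C} → p ≢ q → p′ ≢ q′ →
      SamePair p z₂ q z → SamePair p′ z₃ z q′ → ¬ SamePair z w z₂ z₃
    rectangles-exclude p≢q p′≢q′ (inj₁ (p≡q , _))    _                     _ = p≢q p≡q
    rectangles-exclude p≢q p′≢q′ (inj₂ _)            (inj₂ (p′≡q′ , _))    _ = p′≢q′ p′≡q′
    rectangles-exclude p≢q p′≢q′ (inj₂ (refl , refl)) (inj₁ (refl , refl)) (inj₁ (z≡z₂ , _)) = p≢q z≡z₂
    rectangles-exclude p≢q p′≢q′ (inj₂ (refl , refl)) (inj₁ (refl , refl)) (inj₂ (z≡z₃ , _)) = p′≢q′ z≡z₃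

    decouple : ∀ p q p′ q′ z z₂ z₃ w →
      d p q * d p′ q′ ≤ℚ (defect p z₂ q z + defect p′ z₃ z q′) + defect z w z₂ z₃
    decouple p q p′ q′ z z₂ z₃ w = go (p ≟ q) (p′ ≟ q′) (samePair? _≟_ p z₂ q z) (samePair? _≟_ p′ z₃ z q′)
      where
      D₁ D₂ D₃ : ℚ
      D₁ = defect p z₂ q z
      D₂ = defect p′ z₃ z q′
      D₃ = defect z w z₂ z₃
      0≤D₁ : 0ℚ ≤ℚ D₁
      0≤D₁ = 0≤defect p z₂ q z
      0≤D₂ : 0ℚ ≤ℚ D₂
      0≤D₂ = 0≤defect p′ z₃ z q′
      0≤D₃ : 0ℚ ≤ℚ D₃
      0≤D₃ = 0≤defect z w z₂ z₃
      zero-case : d p q * d p′ q′ ≡ 0ℚ → d p q * d p′ q′ ≤ℚ (D₁ + D₂) + D₃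
      zero-case eq = ≤-trans (≤-reflexive eq) (0≤+ (0≤+ 0≤D₁ 0≤D₂) 0≤D₃)
      dd≤1 : d p q * d p′ q′ ≤ℚ 1ℚ
      dd≤1 = *-mono-≤ 0≤1 (0≤dist _≟_ p′ q′) (dist≤1 _≟_ p q) (dist≤1 _≟_ p′ q′)
      go : Dec (p ≡ q) → Dec (p′ ≡ q′) → Dec (SamePair p z₂ q z) → Dec (SamePair p′ z₃ z q′) →
        d p q * d p′ q′ ≤ℚ (D₁ + D₂) + D₃
      go (yes p≡q) _ _ _ = zero-case (trans (cong (_* d p′ q′) (dist-refl _≟_ p≡q)) (*-zeroˡ (d p′ q′)))
      go (no _) (yes p′≡q′) _ _ = zero-case (trans (cong (d p q *_) (dist-refl _≟_ p′≡q′)) (*-zeroʳ (d p q)))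
      go (no _) (no _) (no ¬r) _ = ≤-trans dd≤1 (≤-trans (defect-no ¬r)
        (≤-slack (D₂ + D₃) (0≤+ 0≤D₂ 0≤D₃) (+-assoc D₁ D₂ D₃)))
      go (no _) (no _) (yes _) (no ¬r) = ≤-trans dd≤1 (≤-trans (defect-no ¬r)
        (≤-slack (D₁ + D₃) (0≤+ 0≤D₁ 0≤D₃) (rotate D₁ D₂ D₃)))
        where
        rotate : ∀ a b c → (a + b) + c ≡ b + (a + c)
        rotate = solve-∀ ℚ-ring
      go (no p≢q) (no p′≢q′) (yes r) (yes r′) = ≤-trans dd≤1
        (≤-trans (defect-no (rectangles-exclude p≢q p′≢q′ r r′))
          (≤-slack (D₁ + D₂) (0≤+ 0≤D₁ 0≤D₂) (+-comm (D₁ + D₂) D₃)))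

  private
    E⁴ : (Vec A n → Vec A n → Vec A n → Vec A n → ℚ) → ℚ
    E⁴ φ = E V λ x → E V λ y → E V λ x′ → E V λ y′ → φ x y x′ y′

    E⁴-mono : ∀ {φ ψ} → (∀ x y x′ y′ → φ x y x′ y′ ≤ℚ ψ x y x′ y′) → E⁴ φ ≤ℚ E⁴ ψ
    E⁴-mono le = E-mono V λ x → E-mono V λ y → E-mono V λ x′ → E-mono V λ y′ → le x y x′ y′

    E⁴-cong : ∀ {φ ψ} → (∀ x y x′ y′ → φ x y x′ y′ ≡ ψ x y x′ y′) → E⁴ φ ≡ E⁴ ψ
    E⁴-cong eq = E-cong V λ x → E-cong V λ y → E-cong V λ x′ → E-cong V λ y′ → eq x y x′ y′

    E⁴-+ : ∀ φ ψ → E⁴ (λ x y x′ y′ → φ x y x′ y′ + ψ x y x′ y′) ≡ E⁴ φ + E⁴ ψ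
    E⁴-+ φ ψ = trans (E-cong V λ x → trans (E-cong V λ y → trans (E-cong V λ x′ →
      E-+ V _ _) (E-+ V _ _)) (E-+ V _ _)) (E-+ V _ _)

    E⁴-* : ∀ (φ ψ : Vec A n → Vec A n → ℚ) → E⁴ (λ x y x′ y′ → φ x y * ψ x′ y′) ≡
      E V (λ x → E V (φ x)) * E V (λ x → E V (ψ x))
    E⁴-* φ ψ = begin
      E⁴ (λ x y x′ y′ → φ x y * ψ x′ y′)
        ≡⟨ E-cong V (λ x → E-cong V λ y → trans (E-cong V λ x′ → E-*ˡ V (φ x y) (ψ x′)) (E-*ˡ V (φ x y) (λ x′ → E V (ψ x′)))) ⟩
      E V (λ x → E V (λ y → φ x y * E V (λ x → E V (ψ x))))
        ≡⟨ trans (E-cong V λ x → E-*ʳ V (E V λ x → E V (ψ x)) (φ x)) (E-*ʳ V (E V λ x → E V (ψ x)) (λ x → E V (φ x))) ⟩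
      E V (λ x → E V (φ x)) * E V (λ x → E V (ψ x)) ∎
      where open ≡-Reasoning

    module _ (S : Mask n) (φ : Vec A n → Vec A n → ℚ) where
      open ≡-Reasoning

      first-law : E⁴ (λ x y x′ y′ → φ x (sel S x′ y)) ≡ E V (λ x → E V (φ x))
      first-law = E-cong V λ x → begin
        E V (λ y → E V (λ x′ → E V (λ y′ → φ x (sel S x′ y))))
          ≡⟨ E-cong V (λ y → E-cong V λ x′ → E-const V _) ⟩
        E V (λ y → E V (λ x′ → φ x (sel S x′ y)))
          ≡⟨ E-swap V V _ ⟩
        E V (λ x′ → E V (λ y → φ x (sel S x′ y)))
          ≡⟨ E-sel s S (φ x) ⟩
        E V (φ x) ∎

      second-law : E⁴ (λ x y x′ y′ → φ x′ (sel S y′ x)) ≡ E V (λ x → E V (φ x))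
      second-law = begin
        E⁴ (λ x y x′ y′ → φ x′ (sel S y′ x))
          ≡⟨ E-cong V (λ x → E-const V _) ⟩
        E V (λ x → E V (λ x′ → E V (λ y′ → φ x′ (sel S y′ x))))
          ≡⟨ E-swap V V _ ⟩
        E V (λ x′ → E V (λ x → E V (λ y′ → φ x′ (sel S y′ x))))
          ≡⟨ E-cong V (λ x′ → E-swap V V _) ⟩
        E V (λ x′ → E V (λ y′ → E V (λ x → φ x′ (sel S y′ x))))
          ≡⟨ E-cong V (λ x′ → E-sel s S (φ x′)) ⟩
        E V (λ x → E V (φ x)) ∎

      third-law : E⁴ (λ x y x′ y′ → φ (sel S x′ x) (sel S y′ y)) ≡ E V (λ x → E V (φ x))
      third-law = begin
        E⁴ (λ x y x′ y′ → φ (sel S x′ x) (sel S y′ y))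
          ≡⟨ E-cong V (λ x → E-swap V V _) ⟩
        E V (λ x → E V (λ x′ → E V (λ y → E V (λ y′ → φ (sel S x′ x) (sel S y′ y)))))
          ≡⟨ E-cong V (λ x → E-cong V λ x′ → trans (E-swap V V _) (E-sel s S (φ (sel S x′ x)))) ⟩
        E V (λ x → E V (λ x′ → E V (φ (sel S x′ x))))
          ≡⟨ trans (E-swap V V _) (E-sel s S (λ z → E V (φ z))) ⟩
        E V (λ x → E V (φ x)) ∎

  -- The pairs (x, y) and (x′, y′) are independent, so the product is the probability that a change
  -- off S on the first pair and a change on S on the second both occur. By `decouple` this breaks
  -- one of three rectangles, and by the three laws each of them is spanned by two independent
  -- uniform vectors.
  dependence-product : ∀ S → dependence S * dependence (not ∘ S) ≤ℚ
    (rectangleDefect S + rectangleDefect S) + rectangleDefect S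
  dependence-product S = begin
    dependence S * dependence (not ∘ S)
      ≡⟨ sym (E⁴-* (λ x y → d (G x) (G (sel S x y))) (λ x y → d (G x) (G (sel (not ∘ S) x y)))) ⟩
    E⁴ (λ x y x′ y′ → d (G x) (G (sel S x y)) * d (G x′) (G (sel (not ∘ S) x′ y′)))
      ≤⟨ E⁴-mono (λ x y x′ y′ → decouple (G x) (G (sel S x y)) (G x′) (G (sel (not ∘ S) x′ y′))
           (G (sel S x′ x)) (G (sel S x′ y)) (G (sel S y′ x)) (G (sel S y′ y))) ⟩
    E⁴ (λ x y x′ y′ → (defect (G x) (G (sel S x′ y)) (G (sel S x y)) (G (sel S x′ x))
      + defect (G x′) (G (sel S y′ x)) (G (sel S x′ x)) (G (sel (not ∘ S) x′ y′)))
      + defect (G (sel S x′ x)) (G (sel S y′ y)) (G (sel S x′ y)) (G (sel S y′ x)))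
      ≡⟨ E⁴-cong (λ x y x′ y′ → cong₂ _+_ (cong₂ _+_
           (cong₂ (λ u v → defect (G x) (G (sel S x′ y)) (G u) (G v))
              (sym (sel-selʳ S x x′ y)) (sym (sel-selˡ S x′ y x)))
           (cong₂ (λ u v → defect (G x′) (G (sel S y′ x)) (G u) (G v))
              (sym (sel-selʳ S x′ y′ x)) (trans (sel-not S x′ y′) (sym (sel-selˡ S y′ x x′)))))
           (cong₂ (λ u v → defect (G (sel S x′ x)) (G (sel S y′ y)) (G u) (G v))
              (sym (trans (sel-selˡ S x′ x _) (sel-selʳ S x′ y′ y)))
              (sym (trans (sel-selˡ S y′ y _) (sel-selʳ S y′ x′ x))))) ⟩
    E⁴ (λ x y x′ y′ → (crossing S x (sel S x′ y) + crossing S x′ (sel S y′ x))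
      + crossing S (sel S x′ x) (sel S y′ y))
      ≡⟨ trans (E⁴-+ _ _) (cong (_+ E⁴ (λ x y x′ y′ → crossing S (sel S x′ x) (sel S y′ y))) (E⁴-+ _ _)) ⟩
    (E⁴ (λ x y x′ y′ → crossing S x (sel S x′ y)) + E⁴ (λ x y x′ y′ → crossing S x′ (sel S y′ x)))
      + E⁴ (λ x y x′ y′ → crossing S (sel S x′ x) (sel S y′ y))
      ≡⟨ cong₂ _+_ (cong₂ _+_ (first-law S (crossing S)) (second-law S (crossing S))) (third-law S (crossing S)) ⟩
    (rectangleDefect S + rectangleDefect S) + rectangleDefect S ∎
    where open ≤-Reasoning

  module _ {c ρ : ℚ} (defects : ∀ S → rectangleDefect S ≤ℚ ρ) (c≤ : c ≤ℚ dependence (λ _ → false)) where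

    private
      6ρ : ℚ
      6ρ = ((ρ + ρ) + ρ) + ((ρ + ρ) + ρ)

      product-bound : ∀ S → dependence S * dependence (not ∘ S) ≤ℚ (ρ + ρ) + ρ
      product-bound S = ≤-trans (dependence-product S)
        (+-mono-≤ (+-mono-≤ (defects S) (defects S)) (defects S))

    -- Since `a` is the smaller factor, `c` is at most 2b, so `a * c` is at most twice the product
    -- bound; this is the origin of `6ρ`.
    one-sided : ∀ {a b} → 0ℚ ≤ℚ a → c ≤ℚ a + b → a * b ≤ℚ (ρ + ρ) + ρ → a ≤ℚ b → a * c ≤ℚ 6ρ
    one-sided {a} {b} 0≤a c≤a+b ab≤3ρ a≤b = begin
      a * c             ≤⟨ *-monoˡ-≤ 0≤a c≤a+b ⟩
      a * (a + b)       ≤⟨ *-monoˡ-≤ 0≤a (+-monoˡ-≤ b a≤b) ⟩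
      a * (b + b)       ≡⟨ *-distribˡ-+ a b b ⟩
      a * b + a * b     ≤⟨ +-mono-≤ ab≤3ρ ab≤3ρ ⟩
      6ρ                ∎
      where open ≤-Reasoning

    dichotomy : ∀ S → dependence S * c ≤ℚ 6ρ ⊎ dependence (not ∘ S) * c ≤ℚ 6ρ
    dichotomy S with ≤-total (dependence S) (dependence (not ∘ S))
    ... | inj₁ le = inj₁ (one-sided (0≤dependence S) (≤-trans c≤ (dependence-false≤ S)) (product-bound S) le)
    ... | inj₂ ge = inj₂ (one-sided (0≤dependence (not ∘ S))
      (≤-trans c≤ (≤-trans (dependence-false≤ S) (≤-reflexive (+-comm (dependence S) _))))
      (≤-trans (≤-reflexive (*-comm (dependence (not ∘ S)) _)) (product-bound S)) ge)

    private
      prefix : ℕ → Mask n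
      prefix k i = does (toℕ i ℕP.<? k)

      prefix-step : ∀ {k} (k<n : k ℕ.< n) i →
        not (prefix k i) ∧ prefix (suc k) i ≡ does (i Fin.≟ fromℕ< k<n)
      prefix-step {k} k<n i with i Fin.≟ fromℕ< k<n
      ... | yes refl = cong₂ _∧_
        (cong not (dec-false (toℕ i ℕP.<? k) λ lt → ℕP.<-irrefl (FinP.toℕ-fromℕ< k<n) lt))
        (dec-true (toℕ i ℕP.<? suc k) (ℕ.s≤s (ℕP.≤-reflexive (FinP.toℕ-fromℕ< k<n))))
      ... | no i≢k with toℕ i ℕP.<? k
      ...   | yes i<k = cong (λ b → not b ∧ prefix (suc k) i) (dec-true (toℕ i ℕP.<? k) i<k)
      ...   | no  i≮k = cong₂ (λ b b′ → not b ∧ b′) (dec-false (toℕ i ℕP.<? k) i≮k)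
        (dec-false (toℕ i ℕP.<? suc k) λ i<1+k → i≢k (FinP.toℕ-injective
          (trans (ℕP.≤-antisym (ℕP.≤-pred i<1+k) (ℕP.≮⇒≥ i≮k)) (sym (FinP.toℕ-fromℕ< k<n)))))

      Found : Set
      Found = ∃[ i ] dependence (λ k → does (k Fin.≟ i)) * c ≤ℚ 6ρ + 6ρ

      -- Invariant: `G` nearly ignores the first k coordinates. Each step takes its bound anew from
      -- `dichotomy`, so errors do not accumulate. When the other alternative occurs, `G` nearly
      -- ignores both the coordinates before k and those after it, which isolates k at the price of
      -- two errors.
      search : 0ℚ ≤ℚ c → 0ℚ ≤ℚ ρ → ∀ k → k ℕ.≤ n → dependence (not ∘ prefix k) * c ≤ℚ 6ρ ⊎ Found
      search 0≤c 0≤ρ zero _ = inj₁ (≤-trans (≤-reflexive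
        (trans (cong (_* c) dependence-true) (*-zeroˡ c)))
        (0≤+ (0≤+ (0≤+ 0≤ρ 0≤ρ) 0≤ρ) (0≤+ (0≤+ 0≤ρ 0≤ρ) 0≤ρ)))
      search 0≤c 0≤ρ (suc k) k<n with search 0≤c 0≤ρ k (ℕP.<⇒≤ k<n) | dichotomy (prefix (suc k))
      ... | inj₂ found | _        = inj₂ found
      ... | inj₁ _     | inj₂ le  = inj₁ le
      ... | inj₁ le    | inj₁ le′ = inj₂ (fromℕ< k<n , (begin
        dependence (λ i → does (i Fin.≟ fromℕ< k<n)) * c
          ≡⟨ cong (_* c) (dependence-cong (λ i → sym (prefix-step k<n i))) ⟩
        dependence (λ i → not (prefix k i) ∧ prefix (suc k) i) * c
          ≤⟨ *-monoʳ-≤ 0≤c (dependence-∧ (not ∘ prefix k) (prefix (suc k))) ⟩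
        (dependence (not ∘ prefix k) + dependence (prefix (suc k))) * c
          ≡⟨ *-distribʳ-+ c (dependence (not ∘ prefix k)) (dependence (prefix (suc k))) ⟩
        dependence (not ∘ prefix k) * c + dependence (prefix (suc k)) * c
          ≤⟨ +-mono-≤ le le′ ⟩
        6ρ + 6ρ ∎))
        where open ≤-Reasoning

    -- Growing S one coordinate at a time, the coordinate at which the dichotomy changes sides carries G.
    essential-coordinate : 0ℚ ≤ℚ c → 0ℚ ≤ℚ ρ → Fin n → Found
    essential-coordinate 0≤c 0≤ρ i₀ with search 0≤c 0≤ρ n ℕP.≤-refl
    ... | inj₂ found = found
    -- The sides never change: `G` nearly ignores all coordinates and is close to constant, so any
    -- coordinate will do.
    ... | inj₁ le    = i₀ , (begin
      dependence S₀ * c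
        ≤⟨ *-monoʳ-≤ 0≤c (dependence≤false S₀) ⟩
      (D + D) * c
        ≡⟨ *-distribʳ-+ c D D ⟩
      D * c + D * c
        ≡⟨ cong (λ t → t * c + t * c) (dependence-cong (λ i → sym (cong not (dec-true (toℕ i ℕP.<? n) (FinP.toℕ<n i))))) ⟩
      dependence (not ∘ prefix n) * c + dependence (not ∘ prefix n) * c
        ≤⟨ +-mono-≤ le le ⟩
      6ρ + 6ρ ∎)
      where
      open ≤-Reasoning
      S₀ : Mask n
      S₀ k = does (k Fin.≟ i₀)
      D : ℚ
      D = dependence (λ _ → false)

-- Transpositions

module _ {n} (i j : Fin n) where

  transpose-left : transpose i j i ≡ j
  transpose-left rewrite dec-true (i ≟ i) refl = refl

  transpose-right : transpose i j j ≡ i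
  transpose-right with j ≟ i
  ... | yes refl = refl
  ... | no  _ rewrite dec-true (j ≟ j) refl = refl

  transpose-other : ∀ {k} → k ≢ i → k ≢ j → transpose i j k ≡ k
  transpose-other {k} k≢i k≢j rewrite dec-false (k ≟ i) k≢i | dec-false (k ≟ j) k≢j = refl

  transpose-injective : ∀ {k l} → transpose i j k ≡ transpose i j l → k ≡ l
  transpose-injective eq = trans (sym (transpose-inverse j i)) (trans (cong (transpose j i) eq) (transpose-inverse j i))

-- Permutations

notIn-lookup : ∀ {m k} {a : Fin m} (v : Vec (Fin m) k) → T (notIn a v) → ∀ i → a ≢ lookup v i
notIn-lookup {a = a} (b ∷ v) p i a≡ with a ≟ b | i
... | no a≢b | zero  = a≢b a≡
... | no _   | suc i = notIn-lookup v p i a≡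

lookup-notIn : ∀ {m k} {a : Fin m} (v : Vec (Fin m) k) → (∀ i → a ≢ lookup v i) → T (notIn a v)
lookup-notIn []      _  = _
lookup-notIn {a = a} (b ∷ v) ne with a ≟ b
... | yes a≡b = ne zero a≡b
... | no  _   = lookup-notIn v (ne ∘ suc)

T-∧ : ∀ {x y} → T (x ∧ y) → T x × T y
T-∧ {true} {true} _ = _ , _

∧-T : ∀ {x y} → T x → T y → T (x ∧ y)
∧-T {true} {true} _ _ = _

distinct⇒injective : ∀ {m k} (v : Vec (Fin m) k) → T (distinct v) → ∀ {i j} → lookup v i ≡ lookup v j → i ≡ j
distinct⇒injective (a ∷ v) p {zero}  {zero}  eq = refl
distinct⇒injective (a ∷ v) p {zero}  {suc j} eq = contradiction eq (notIn-lookup v (proj₁ (T-∧ p)) j)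
distinct⇒injective (a ∷ v) p {suc i} {zero}  eq = contradiction (sym eq) (notIn-lookup v (proj₁ (T-∧ p)) i)
distinct⇒injective (a ∷ v) p {suc i} {suc j} eq = cong suc (distinct⇒injective v (proj₂ (T-∧ {notIn a v} p)) eq)

injective⇒distinct : ∀ {m k} (v : Vec (Fin m) k) → (∀ {i j} → lookup v i ≡ lookup v j → i ≡ j) → T (distinct v)
injective⇒distinct []      inj = _
injective⇒distinct (a ∷ v) inj = ∧-T (lookup-notIn v λ i eq → FinP.0≢1+n (inj {zero} {suc i} eq))
  (injective⇒distinct v λ eq → FinP.suc-injective (inj eq))

module _ {m : ℕ} where

  ⟦⟧-injective : (p : Perm m) → ∀ {a c} → ⟦ p ⟧ a ≡ ⟦ p ⟧ c → a ≡ c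
  ⟦⟧-injective (v , dv) = distinct⇒injective v dv

  Perm-≡ : {p q : Perm m} → proj₁ p ≡ proj₁ q → p ≡ q
  Perm-≡ {v , d} {.v , e} refl = cong (v ,_) (T-irrelevant d e)

  Perm-ext : {p q : Perm m} → (∀ a → ⟦ p ⟧ a ≡ ⟦ q ⟧ a) → p ≡ q
  Perm-ext {v , _} {w , _} eq = Perm-≡ (trans (sym (VecP.tabulate∘lookup v))
    (trans (VecP.tabulate-cong eq) (VecP.tabulate∘lookup w)))

  _≟ₚ_ : DecidableEquality (Perm m)
  p ≟ₚ q = map′ Perm-≡ (cong proj₁) (VecP.≡-dec _≟_ (proj₁ p) (proj₁ q))

  fromInjective : (f : Fin m → Fin m) → (∀ {a c} → f a ≡ f c → a ≡ c) → Perm m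
  fromInjective f inj = tabulate f , injective⇒distinct (tabulate f) λ {i} {j} eq →
    inj (trans (sym (VecP.lookup∘tabulate f i)) (trans eq (VecP.lookup∘tabulate f j)))

injective⇒surjective : ∀ {m} (f : Fin m → Fin m) → (∀ {a c} → f a ≡ f c → a ≡ c) → ∀ j → ∃[ a ] f a ≡ j
injective⇒surjective {suc m} f inj j with FinP.any? (λ a → f a ≟ j)
... | yes found = found
... | no  none  = contradiction (FinP.injective⇒≤ punched-injective) (ℕP.<⇒≱ ℕP.≤-refl)
  where
  j≢f : ∀ a → j ≢ f a
  j≢f a j≡fa = none (a , sym j≡fa)
  punched : Fin (suc m) → Fin m
  punched a = punchOut (j≢f a)
  punched-injective : ∀ {a c} → punched a ≡ punched c → a ≡ c
  punched-injective {a} {c} = inj ∘ FinP.punchOut-injective (j≢f a) (j≢f c)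

preimage-correct : ∀ {m} (z : Fin m → Fin m) {j} → (∃[ a ] z a ≡ j) → z (preimage z j) ≡ j
preimage-correct {m} z {j} (a , za≡j)
  with filter (λ a → z a ≟ j) (allFin m) in eq
... | []     = contradiction (subst (a ∈_) eq (∈-filter⁺ (λ a → z a ≟ j) (∈-allFin a) za≡j)) λ ()
... | b ∷ bs = proj₂ (∈-filter⁻ (λ a → z a ≟ j) {xs = allFin m} (subst (b ∈_) (sym eq) (here refl)))

opaque

  rank : ∀ {m} → Perm m → Fin m → Fin m
  rank p j = preimage ⟦ p ⟧ j

  rank-def : ∀ {m} (p : Perm m) j → rank p j ≡ preimage ⟦ p ⟧ j
  rank-def p j = refl

  ⟦⟧-rank : ∀ {m} (p : Perm m) j → ⟦ p ⟧ (rank p j) ≡ j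
  ⟦⟧-rank p j = preimage-correct ⟦ p ⟧ (injective⇒surjective ⟦ p ⟧ (⟦⟧-injective p) j)

module _ {m : ℕ} where

  rank-unique : ∀ (p : Perm m) {a j} → ⟦ p ⟧ a ≡ j → rank p j ≡ a
  rank-unique p {a} {j} pa≡j = ⟦⟧-injective p (trans (⟦⟧-rank p j) (sym pa≡j))

  rank-⟦⟧ : ∀ (p : Perm m) a → rank p (⟦ p ⟧ a) ≡ a
  rank-⟦⟧ p a = rank-unique p refl

  rank-injective : ∀ (p : Perm m) {j k} → rank p j ≡ rank p k → j ≡ k
  rank-injective p {j} {k} eq = trans (sym (⟦⟧-rank p j)) (trans (cong ⟦ p ⟧ eq) (⟦⟧-rank p k))

  opaque

    identity : Perm m
    identity = fromInjective id id

    rank-identity : ∀ j → rank identity j ≡ j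
    rank-identity j = rank-unique identity (VecP.lookup∘tabulate id j)

    _∙_ : Perm m → Perm m → Perm m
    p ∙ q = fromInjective (⟦ p ⟧ ∘ ⟦ q ⟧) (⟦⟧-injective q ∘ ⟦⟧-injective p)

    ⟦∙⟧ : ∀ p q a → ⟦ p ∙ q ⟧ a ≡ ⟦ p ⟧ (⟦ q ⟧ a)
    ⟦∙⟧ p q = VecP.lookup∘tabulate (⟦ p ⟧ ∘ ⟦ q ⟧)

    _⁻¹ : Perm m → Perm m
    p ⁻¹ = fromInjective (rank p) (rank-injective p)

    ⟦⁻¹⟧ : ∀ p a → ⟦ p ⁻¹ ⟧ a ≡ rank p a
    ⟦⁻¹⟧ p = VecP.lookup∘tabulate (rank p)

    swapNames : Fin m → Fin m → Perm m → Perm m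
    swapNames j k p = fromInjective (transpose j k ∘ ⟦ p ⟧) (⟦⟧-injective p ∘ transpose-injective j k)

    ⟦swapNames⟧ : ∀ j k p a → ⟦ swapNames j k p ⟧ a ≡ transpose j k (⟦ p ⟧ a)
    ⟦swapNames⟧ j k p = VecP.lookup∘tabulate (transpose j k ∘ ⟦ p ⟧)

    swapRanks : Fin m → Fin m → Perm m → Perm m
    swapRanks a c p = fromInjective (⟦ p ⟧ ∘ transpose a c) (transpose-injective a c ∘ ⟦⟧-injective p)

    ⟦swapRanks⟧ : ∀ a c p b → ⟦ swapRanks a c p ⟧ b ≡ ⟦ p ⟧ (transpose a c b)
    ⟦swapRanks⟧ a c p = VecP.lookup∘tabulate (⟦ p ⟧ ∘ transpose a c)

  rank-∙ : ∀ p q j → rank (p ∙ q) j ≡ rank q (rank p j)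
  rank-∙ p q j = rank-unique (p ∙ q) (trans (⟦∙⟧ p q _) (trans (cong ⟦ p ⟧ (⟦⟧-rank q _)) (⟦⟧-rank p j)))

  rank-swapNames : ∀ j k p i → rank (swapNames j k p) i ≡ rank p (transpose k j i)
  rank-swapNames j k p i = rank-unique (swapNames j k p) (trans (⟦swapNames⟧ j k p _)
    (trans (cong (transpose j k) (⟦⟧-rank p _)) (transpose-inverse j k)))

  rank-swapRanks : ∀ a c p j → rank (swapRanks a c p) j ≡ transpose c a (rank p j)
  rank-swapRanks a c p j = rank-unique (swapRanks a c p) (trans (⟦swapRanks⟧ a c p _)
    (trans (cong ⟦ p ⟧ (transpose-inverse a c)) (⟦⟧-rank p j)))

  swapNames-inverse : ∀ j k p → swapNames j k (swapNames k j p) ≡ p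
  swapNames-inverse j k p = Perm-ext λ a → trans (⟦swapNames⟧ j k _ a)
    (trans (cong (transpose j k) (⟦swapNames⟧ k j p a)) (transpose-inverse j k))

  swapRanks-inverse : ∀ a c p → swapRanks a c (swapRanks c a p) ≡ p
  swapRanks-inverse a c p = Perm-ext λ b → trans (⟦swapRanks⟧ a c _ b)
    (trans (⟦swapRanks⟧ c a p _) (cong ⟦ p ⟧ (transpose-inverse c a)))

ranks : ∀ {m v} → Fin m → Vec (Perm m) v → Vec (Fin m) v
ranks j = mapᵢ (λ _ p → rank p j)

-- Enumerations

allFin-suc : ∀ n φ → ∑ (allFin (suc n)) φ ≡ φ zero + ∑ (allFin n) (φ ∘ suc)
allFin-suc n φ = trans (∑-∷ zero _ φ) (cong (φ zero +_)
  (trans (cong (λ L → ∑ L φ) (sym (List.map-tabulate id suc))) (∑-map suc (allFin n) φ)))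

allFin-enumerates : ∀ n → Enumerates _≟_ (allFin n)
allFin-enumerates (suc n) zero = trans (allFin-suc n _) (trans
  (cong₂ _+_ (δ-refl _≟_ {zero} {zero} refl) (trans (∑-cong (allFin n) λ x → δ-≢ _≟_ {suc x} {zero} λ ()) (∑-0 (allFin n))))
  (+-identityʳ 1ℚ))
allFin-enumerates (suc n) (suc a) = trans (allFin-suc n _) (trans
  (cong₂ _+_ (δ-≢ _≟_ {zero} {suc a} λ ()) (trans (∑-cong (allFin n) λ x → δ-cong (suc x ≟ suc a) (x ≟ a))
    (allFin-enumerates n a)))
  (+-identityˡ 1ℚ))
  where
  δ-cong : ∀ {x} → Dec (suc x ≡ suc a) → Dec (x ≡ a) → δ _≟_ (suc x) (suc a) ≡ δ _≟_ x a
  δ-cong {x} _ (yes x≡a) = trans (δ-refl _≟_ (cong suc x≡a)) (sym (δ-refl _≟_ x≡a))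
  δ-cong {x} _ (no  x≢a) = trans (δ-≢ _≟_ (x≢a ∘ FinP.suc-injective)) (sym (δ-≢ _≟_ x≢a))

module _ {A : Set} {_≟ᴬ_ : DecidableEquality A} {L : List A} (enum : Enumerates _≟ᴬ_ L) where

  allVecs-enumerates : ∀ k → Enumerates (VecP.≡-dec _≟ᴬ_) (allVecs L k)
  allVecs-enumerates zero [] = trans (∑-∷ [] [] _) (trans (cong₂ _+_ (δ-refl (VecP.≡-dec _≟ᴬ_) {[]} refl) (∑-[] _)) (+-identityʳ 1ℚ))
  allVecs-enumerates (suc k) (a ∷ w) = begin
    ∑ (allVecs L (suc k)) (λ v → δ (VecP.≡-dec _≟ᴬ_) v (a ∷ w))
      ≡⟨ trans (∑-concatMap _ L _) (∑-cong L λ b → ∑-map (b ∷_) (allVecs L k) _) ⟩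
    ∑ L (λ b → ∑ (allVecs L k) (λ v → δ (VecP.≡-dec _≟ᴬ_) (b ∷ v) (a ∷ w)))
      ≡⟨ ∑-cong L (λ b → ∑-cong (allVecs L k) λ v → δ-∷ b v (b ≟ᴬ a) (VecP.≡-dec _≟ᴬ_ v w)) ⟩
    ∑ L (λ b → ∑ (allVecs L k) (λ v → δ _≟ᴬ_ b a * δ (VecP.≡-dec _≟ᴬ_) v w))
      ≡⟨ ∑-cong L (λ b → trans (∑-*ˡ (allVecs L k) (δ _≟ᴬ_ b a) _)
           (trans (cong (δ _≟ᴬ_ b a *_) (allVecs-enumerates k w)) (*-identityʳ _))) ⟩
    ∑ L (λ b → δ _≟ᴬ_ b a)
      ≡⟨ enum a ⟩
    1ℚ ∎
    where
    open ≡-Reasoning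
    δ-∷ : ∀ b v → Dec (b ≡ a) → Dec (v ≡ w) →
      δ (VecP.≡-dec _≟ᴬ_) (b ∷ v) (a ∷ w) ≡ δ _≟ᴬ_ b a * δ (VecP.≡-dec _≟ᴬ_) v w
    δ-∷ b v (yes refl) (yes refl) = trans (δ-refl (VecP.≡-dec _≟ᴬ_) refl)
      (sym (cong₂ _*_ (δ-refl _≟ᴬ_ {b} refl) (δ-refl (VecP.≡-dec _≟ᴬ_) {v} refl)))
    δ-∷ b v (no b≢a) _ = trans (δ-≢ (VecP.≡-dec _≟ᴬ_) (b≢a ∘ VecP.∷-injectiveˡ))
      (sym (trans (cong (_* δ (VecP.≡-dec _≟ᴬ_) v w) (δ-≢ _≟ᴬ_ b≢a)) (*-zeroˡ (δ (VecP.≡-dec _≟ᴬ_) v w))))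
    δ-∷ b v (yes _) (no v≢w) = trans (δ-≢ (VecP.≡-dec _≟ᴬ_) (v≢w ∘ VecP.∷-injectiveʳ))
      (sym (trans (cong (δ _≟ᴬ_ b a *_) (δ-≢ (VecP.≡-dec _≟ᴬ_) v≢w)) (*-zeroʳ (δ _≟ᴬ_ b a))))

∑-mapMaybe : ∀ {A B : Set} (f : A → Maybe B) L φ →
  ∑ (mapMaybe f L) φ ≡ ∑ L (λ a → Maybe.maybe φ 0ℚ (f a))
∑-mapMaybe f []      φ = trans (∑-[] φ) (sym (∑-[] _))
∑-mapMaybe f (a ∷ L) φ with f a in eq
... | just b  = trans (∑-∷ b _ φ) (trans (cong (φ b +_) (∑-mapMaybe f L φ))
  (sym (trans (∑-∷ a L _) (cong (λ x → Maybe.maybe φ 0ℚ x + ∑ L (λ a → Maybe.maybe φ 0ℚ (f a))) eq))))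
... | nothing = trans (∑-mapMaybe f L φ) (sym (trans (∑-∷ a L _)
  (trans (cong (λ x → Maybe.maybe φ 0ℚ x + ∑ L (λ a → Maybe.maybe φ 0ℚ (f a))) eq) (+-identityˡ _))))

-- Proofs of distinctness are irrelevant, so point masses on permutations are point masses on
-- vectors, and the vectors rejected by `asPerm` contribute 0 on both sides.
allPerms-enumerates : ∀ m → Enumerates _≟ₚ_ (allPerms m)
allPerms-enumerates m p = trans (∑-mapMaybe asPerm (allVecs (allFin m) m) _)
  (trans (∑-cong (allVecs (allFin m) m) pointwise) (allVecs-enumerates {L = allFin m} (allFin-enumerates m) m (proj₁ p)))
  where
  pointwise : ∀ v → Maybe.maybe (λ q → δ _≟ₚ_ q p) 0ℚ (asPerm v) ≡ δ (VecP.≡-dec _≟_) v (proj₁ p)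
  pointwise v with T? (distinct v)
  ... | no ¬dv = sym (δ-≢ (VecP.≡-dec _≟_) λ v≡ → ¬dv (subst (T ∘ distinct) (sym v≡) (proj₂ p)))
  ... | yes dv with VecP.≡-dec _≟_ v (proj₁ p)
  ...   | yes v≡ = trans (δ-refl _≟ₚ_ {v , dv} {p} (Perm-≡ v≡)) (sym (δ-refl (VecP.≡-dec _≟_) v≡))
  ...   | no  v≢ = trans (δ-≢ _≟ₚ_ {v , dv} {p} (v≢ ∘ cong proj₁)) (sym (δ-≢ (VecP.≡-dec _≟_) v≢))

enumerates⇒nonempty : ∀ {A : Set} {_≟ᴬ_ : DecidableEquality A} {L} → Enumerates _≟ᴬ_ L → A → ∃[ k ] length L ≡ suc k
enumerates⇒nonempty {L = []}    enum a = contradiction (trans (sym (enum a)) (∑-[] _)) λ ()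
enumerates⇒nonempty {L = _ ∷ L} enum a = length L , refl

fins : ∀ m → Space (Fin (suc m))
fins m = uniform (allFin (suc m)) (enumerates⇒nonempty (allFin-enumerates (suc m)) zero)

perms : ∀ m → Space (Perm m)
perms m = uniform (allPerms m) (enumerates⇒nonempty (allPerms-enumerates m) identity)

-- Invariance of the uniform measure on permutations

module _ {m : ℕ} where

  E-bijection : (f g : Perm m → Perm m) → (∀ p → f (g p) ≡ p) → (∀ p → g (f p) ≡ p) →
    MeasurePreserving (perms m) (perms m) f
  E-bijection f g fg gf φ = trans (E-def (perms m) (φ ∘ f)) (trans
    (cong (_* recip (length (allPerms m))) (∑-bijection (allPerms-enumerates m) f g fg gf φ))
    (sym (E-def (perms m) φ)))

  swapNames-preserving : ∀ j k → MeasurePreserving (perms m) (perms m) (swapNames j k)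
  swapNames-preserving j k = E-bijection (swapNames j k) (swapNames k j) (swapNames-inverse j k) (swapNames-inverse k j)

  swapRanks-preserving : ∀ a c → MeasurePreserving (perms m) (perms m) (swapRanks a c)
  swapRanks-preserving a c = E-bijection (swapRanks a c) (swapRanks c a) (swapRanks-inverse a c) (swapRanks-inverse c a)

-- Laws of one and two ranks

∑-const-fins : ∀ n c → ∑ (allFin n) (λ _ → c) ≡ ℕtoℚ n * c
∑-const-fins n c = trans (∑-const (allFin n) c) (cong (λ k → ℕtoℚ k * c) (List.length-tabulate {n = n} id))

E-fins : ∀ m φ → ℕtoℚ (suc m) * E (fins m) φ ≡ ∑ (allFin (suc m)) φ
E-fins m φ = trans (cong (λ k → ℕtoℚ k * E (fins m) φ) (sym (List.length-tabulate {n = suc m} id))) (E-total (fins m) φ)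

ℕtoℚ-cancel : ∀ m {a b} → ℕtoℚ (suc m) * a ≡ ℕtoℚ (suc m) * b → a ≡ b
ℕtoℚ-cancel m {a} {b} eq = begin
  a                   ≡⟨ sym (*-identityˡ a) ⟩
  1ℚ * a              ≡⟨ cong (_* a) (sym (recip-inverse m)) ⟩
  (M * w) * a         ≡⟨ rotate M w a ⟩
  w * (M * a)         ≡⟨ cong (w *_) eq ⟩
  w * (M * b)         ≡⟨ sym (rotate M w b) ⟩
  (M * w) * b         ≡⟨ cong (_* b) (recip-inverse m) ⟩
  1ℚ * b              ≡⟨ *-identityˡ b ⟩
  b                   ∎
  where
  open ≡-Reasoning
  M = ℕtoℚ (suc m)
  w = recip (suc m)
  rotate : ∀ a b c → (a * b) * c ≡ b * (a * c)
  rotate = solve-∀ ℚ-ring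

module _ {n : ℕ} where

  δ-sym : ∀ (a c : Fin n) → δ _≟_ a c ≡ δ _≟_ c a
  δ-sym a c = trans (δ-def _≟_ a c) (trans (𝟙-cong (a ≟ c) (c ≟ a) sym sym) (sym (δ-def _≟_ c a)))

  δ-transpose : ∀ (a c b r : Fin n) → δ _≟_ b (transpose c a r) ≡ δ _≟_ (transpose a c b) r
  δ-transpose a c b r = trans (δ-def _≟_ b _) (trans
    (𝟙-cong (b ≟ transpose c a r) (transpose a c b ≟ r)
      (λ eq → trans (cong (transpose a c) eq) (transpose-inverse a c))
      (λ eq → trans (sym (transpose-inverse c a)) (cong (transpose c a) eq)))
    (sym (δ-def _≟_ _ r)))

  δ-expand : ∀ (φ : Fin n → ℚ) r → φ r ≡ ∑ (allFin n) (λ a → δ _≟_ a r * φ a)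
  δ-expand φ r = sym (∑-δ (allFin-enumerates n) φ r)

module _ (m : ℕ) where

  private
    n = suc m
    P = perms n
    F = allFin n

  private
    ν : Fin n → Fin n → ℚ
    ν j a = E P (λ p → δ _≟_ a (rank p j))

    ν-transpose : ∀ j a c b → ν j b ≡ ν j (transpose a c b)
    ν-transpose j a c b = begin
      E P (λ p → δ _≟_ b (rank p j))
        ≡⟨ sym (swapRanks-preserving a c (λ p → δ _≟_ b (rank p j))) ⟩
      E P (λ p → δ _≟_ b (rank (swapRanks a c p) j))
        ≡⟨ E-cong P (λ p → trans (cong (δ _≟_ b) (rank-swapRanks a c p j)) (δ-transpose a c b (rank p j))) ⟩
      E P (λ p → δ _≟_ (transpose a c b) (rank p j)) ∎
      where open ≡-Reasoning

    ν-const : ∀ j a c → ν j a ≡ ν j c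
    ν-const j a c = trans (ν-transpose j a c a) (cong (ν j) (transpose-left a c))

    ν-value : ∀ j a → ℕtoℚ n * ν j a ≡ 1ℚ
    ν-value j a = begin
      ℕtoℚ n * ν j a                            ≡⟨ sym (∑-const-fins n (ν j a)) ⟩
      ∑ F (λ _ → ν j a)                         ≡⟨ ∑-cong F (λ c → ν-const j a c) ⟩
      ∑ F (ν j)                                 ≡⟨ sym (E-∑ P F _) ⟩
      E P (λ p → ∑ F (λ c → δ _≟_ c (rank p j))) ≡⟨ E-cong P (λ p → allFin-enumerates n (rank p j)) ⟩
      E P (λ p → 1ℚ)                            ≡⟨ E-const P 1ℚ ⟩
      1ℚ                                        ∎
      where open ≡-Reasoning

  -- Swapping two ranks preserves the measure, so all n values of the rank of j have equal mass.
  rank-uniform : ∀ j → MeasurePreserving P (fins m) (λ p → rank p j)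
  rank-uniform j φ = ℕtoℚ-cancel m (begin
    ℕtoℚ n * E P (λ p → φ (rank p j))
      ≡⟨ cong (ℕtoℚ n *_) (trans (E-cong P λ p → δ-expand φ (rank p j)) (E-∑ P F _)) ⟩
    ℕtoℚ n * ∑ F (λ a → E P (λ p → δ _≟_ a (rank p j) * φ a))
      ≡⟨ sym (∑-*ˡ F (ℕtoℚ n) _) ⟩
    ∑ F (λ a → ℕtoℚ n * E P (λ p → δ _≟_ a (rank p j) * φ a))
      ≡⟨ ∑-cong F (λ a → trans (cong (ℕtoℚ n *_) (E-*ʳ P (φ a) _)) (trans (sym (*-assoc (ℕtoℚ n) (ν j a) (φ a)))
           (trans (cong (_* φ a) (ν-value j a)) (*-identityˡ (φ a))))) ⟩
    ∑ F φ
      ≡⟨ sym (E-fins m φ) ⟩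
    ℕtoℚ n * E (fins m) φ ∎)
    where open ≡-Reasoning

  module _ {j k : Fin n} (j≢k : j ≢ k) where

    private
      ω : Fin n → Fin n → ℚ
      ω a c = E P (λ p → δ _≟_ a (rank p j) * δ _≟_ c (rank p k))

      ω-transpose : ∀ b d a c → ω a c ≡ ω (transpose b d a) (transpose b d c)
      ω-transpose b d a c = begin
        ω a c
          ≡⟨ sym (swapRanks-preserving b d _) ⟩
        E P (λ p → δ _≟_ a (rank (swapRanks b d p) j) * δ _≟_ c (rank (swapRanks b d p) k))
          ≡⟨ E-cong P (λ p → cong₂ _*_
               (trans (cong (δ _≟_ a) (rank-swapRanks b d p j)) (δ-transpose b d a (rank p j)))
               (trans (cong (δ _≟_ c) (rank-swapRanks b d p k)) (δ-transpose b d c (rank p k)))) ⟩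
        ω (transpose b d a) (transpose b d c) ∎
        where open ≡-Reasoning

      ω-diagonal : ∀ a → ω a a ≡ 0ℚ
      ω-diagonal a = trans (E-cong P pointwise) (E-const P 0ℚ)
        where
        pointwise : ∀ p → δ _≟_ a (rank p j) * δ _≟_ a (rank p k) ≡ 0ℚ
        pointwise p with a ≟ rank p j
        ... | no a≢   = trans (cong (_* δ _≟_ a (rank p k)) (δ-≢ _≟_ a≢)) (*-zeroˡ (δ _≟_ a (rank p k)))
        ... | yes eq  = trans (cong (δ _≟_ a (rank p j) *_) (δ-≢ _≟_ λ eq′ → j≢k (rank-injective p (trans (sym eq) eq′))))
          (*-zeroʳ (δ _≟_ a (rank p j)))

      -- Two transpositions of ranks suffice: the first sends a to a′ and c to some e ≢ a′, the
      -- second sends e to c′ and fixes a′.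
      ω-const : ∀ {a c a′ c′} → a ≢ c → a′ ≢ c′ → ω a c ≡ ω a′ c′
      ω-const {a} {c} {a′} {c′} a≢c a′≢c′ = begin
        ω a c
          ≡⟨ ω-transpose a a′ a c ⟩
        ω (transpose a a′ a) e
          ≡⟨ cong (λ x → ω x e) (transpose-left a a′) ⟩
        ω a′ e
          ≡⟨ ω-transpose e c′ a′ e ⟩
        ω (transpose e c′ a′) (transpose e c′ e)
          ≡⟨ cong₂ ω (transpose-other e c′ a′≢e a′≢c′) (transpose-left e c′) ⟩
        ω a′ c′ ∎
        where
        open ≡-Reasoning
        e : Fin n
        e = transpose a a′ c
        a′≢e : a′ ≢ e
        a′≢e eq = a≢c (transpose-injective a a′ (trans (transpose-left a a′) eq))

      ω-row : ∀ a → ∑ F (ω a) ≡ ν j a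
      ω-row a = begin
        ∑ F (ω a)
          ≡⟨ sym (E-∑ P F _) ⟩
        E P (λ p → ∑ F (λ c → δ _≟_ a (rank p j) * δ _≟_ c (rank p k)))
          ≡⟨ E-cong P (λ p → trans (∑-*ˡ F (δ _≟_ a (rank p j)) _)
               (trans (cong (δ _≟_ a (rank p j) *_) (allFin-enumerates n (rank p k))) (*-identityʳ _))) ⟩
        ν j a ∎
        where open ≡-Reasoning

      -- With q the common off-diagonal value of ω: ω a c = q (1 - δ a c).
      q : ℚ
      q = ω j k

      ω-value : ∀ a c → ω a c ≡ q - δ _≟_ c a * q
      ω-value a c with c ≟ a
      ... | yes refl = trans (ω-diagonal a) (sym (trans (cong (λ x → q - x * q) (δ-refl _≟_ {a} refl))
        (trans (cong (λ x → q - x) (*-identityˡ q)) (+-inverseʳ q))))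
      ... | no c≢a = trans (ω-const (c≢a ∘ sym) j≢k) (sym (trans (cong (λ x → q - x * q) (δ-≢ _≟_ c≢a))
        (trans (cong (λ x → q - x) (*-zeroˡ q)) (+-identityʳ q))))

      mq : ℕtoℚ m * q ≡ ν j j
      mq = begin
        ℕtoℚ m * q                                ≡⟨ split (ℕtoℚ m) q ⟩
        (1ℚ + ℕtoℚ m) * q - q                     ≡⟨ cong (λ x → x * q - q) (sym (ℕtoℚ-suc m)) ⟩
        ℕtoℚ n * q - q                            ≡⟨ cong₂ _-_ (sym (∑-const-fins n q)) (sym (∑-δ (allFin-enumerates n) (λ _ → q) j)) ⟩
        ∑ F (λ _ → q) - ∑ F (λ c → δ _≟_ c j * q) ≡⟨ sym (∑-- F _ _) ⟩
        ∑ F (λ c → q - δ _≟_ c j * q)             ≡⟨ ∑-cong F (λ c → sym (ω-value j c)) ⟩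
        ∑ F (ω j)                                 ≡⟨ ω-row j ⟩
        ν j j                                     ∎
        where
        open ≡-Reasoning
        split : ∀ m q → m * q ≡ (1ℚ + m) * q - q
        split = solve-∀ ℚ-ring

      nmq : ℕtoℚ n * (ℕtoℚ m * q) ≡ 1ℚ
      nmq = trans (cong (ℕtoℚ n *_) mq) (ν-value j j)

    -- Two independent ranks agree with probability 1/n, and are otherwise distributed as the ranks of two names.
    pair-law : ∀ (φ : Fin n → Fin n → ℚ) →
      E (fins m) (λ a → φ a a) + ℕtoℚ m * E P (λ p → φ (rank p j) (rank p k)) ≡
      ℕtoℚ n * E (fins m) (λ a → E (fins m) (φ a))
    pair-law φ = ℕtoℚ-cancel m (begin
      N * (E (fins m) (λ a → φ a a) + M * E P (λ p → φ (rank p j) (rank p k)))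
        ≡⟨ distribute N (E (fins m) (λ a → φ a a)) M _ ⟩
      N * E (fins m) (λ a → φ a a) + N * (M * E P (λ p → φ (rank p j) (rank p k)))
        ≡⟨ cong₂ (λ s t → s + N * (M * t)) (E-fins m _) expand ⟩
      D + N * (M * (q * (W - D)))
        ≡⟨ regroup D N M q W ⟩
      D + (N * (M * q)) * (W - D)
        ≡⟨ cong (λ x → D + x * (W - D)) nmq ⟩
      D + 1ℚ * (W - D)
        ≡⟨ cancel D W ⟩
      W
        ≡⟨ ∑-cong F (λ a → sym (E-fins m (φ a))) ⟩
      ∑ F (λ a → N * E (fins m) (φ a))
        ≡⟨ ∑-*ˡ F N _ ⟩
      N * ∑ F (λ a → E (fins m) (φ a))
        ≡⟨ cong (N *_) (sym (E-fins m _)) ⟩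
      N * (N * E (fins m) (λ a → E (fins m) (φ a))) ∎)
      where
      open ≡-Reasoning
      N = ℕtoℚ n
      M = ℕtoℚ m
      D W : ℚ
      D = ∑ F (λ a → φ a a)
      W = ∑ F (λ a → ∑ F (φ a))
      distribute : ∀ N e M x → N * (e + M * x) ≡ N * e + N * (M * x)
      distribute = solve-∀ ℚ-ring
      regroup : ∀ D N M q W → D + N * (M * (q * (W - D))) ≡ D + (N * (M * q)) * (W - D)
      regroup = solve-∀ ℚ-ring
      cancel : ∀ D W → D + 1ℚ * (W - D) ≡ W
      cancel = solve-∀ ℚ-ring
      weight : ∀ a c → E P (λ p → δ _≟_ a (rank p j) * (δ _≟_ c (rank p k) * φ a c)) ≡ q * (φ a c - δ _≟_ c a * φ a c)
      weight a c = begin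
        E P (λ p → δ _≟_ a (rank p j) * (δ _≟_ c (rank p k) * φ a c))
          ≡⟨ trans (E-cong P λ p → sym (*-assoc (δ _≟_ a (rank p j)) (δ _≟_ c (rank p k)) (φ a c))) (E-*ʳ P (φ a c) _) ⟩
        ω a c * φ a c
          ≡⟨ cong (_* φ a c) (ω-value a c) ⟩
        (q - δ _≟_ c a * q) * φ a c
          ≡⟨ factor q (δ _≟_ c a) (φ a c) ⟩
        q * (φ a c - δ _≟_ c a * φ a c) ∎
        where
        factor : ∀ q d f → (q - d * q) * f ≡ q * (f - d * f)
        factor = solve-∀ ℚ-ring
      expand : E P (λ p → φ (rank p j) (rank p k)) ≡ q * (W - D)
      expand = begin
        E P (λ p → φ (rank p j) (rank p k))
          ≡⟨ E-cong P (λ p → trans (δ-expand (λ a → φ a (rank p k)) (rank p j))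
               (∑-cong F λ a → trans (cong (δ _≟_ a (rank p j) *_) (δ-expand (φ a) (rank p k))) (sym (∑-*ˡ F (δ _≟_ a (rank p j)) (λ c → δ _≟_ c (rank p k) * φ a c))))) ⟩
        E P (λ p → ∑ F (λ a → ∑ F (λ c → δ _≟_ a (rank p j) * (δ _≟_ c (rank p k) * φ a c))))
          ≡⟨ trans (E-∑ P F _) (∑-cong F λ a → E-∑ P F _) ⟩
        ∑ F (λ a → ∑ F (λ c → E P (λ p → δ _≟_ a (rank p j) * (δ _≟_ c (rank p k) * φ a c))))
          ≡⟨ ∑-cong F (λ a → trans (∑-cong F (weight a)) (trans (∑-*ˡ F q _) (cong (q *_) (trans (∑-- F (φ a) _)
               (cong (λ x → ∑ F (φ a) - x) (∑-δ (allFin-enumerates n) (φ a) a)))))) ⟩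
        ∑ F (λ a → q * (∑ F (φ a) - φ a a))
          ≡⟨ trans (∑-*ˡ F q _) (cong (q *_) (∑-- F _ _)) ⟩
        q * (W - D) ∎

  -- Exchanges two positions of t so that j lands at rank a. For uniform t the result is uniform
  -- among the rankings that give j rank a.
  place : Fin n → Fin n → Perm n → Perm n
  place j a t = swapRanks a (rank t j) t

  rank-place : ∀ j a t → rank (place j a t) j ≡ a
  rank-place j a t = trans (rank-swapRanks a (rank t j) t j) (transpose-left (rank t j) a)

  -- The right side is the expectation conditioned on rank a for j, an event of probability 1/n. For
  -- each former rank c of j, the swap of c and a maps the rankings with j at c bijectively onto
  -- those with j at a.
  E-place : ∀ j a φ → E P (λ t → φ (place j a t)) ≡ ℕtoℚ n * E P (λ y → δ _≟_ a (rank y j) * φ y)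
  E-place j a φ = begin
    E P (λ t → φ (swapRanks a (rank t j) t))
      ≡⟨ trans (E-cong P λ t → δ-expand (λ c → φ (swapRanks a c t)) (rank t j)) (E-∑ P F _) ⟩
    ∑ F (λ c → E P (λ t → δ _≟_ c (rank t j) * φ (swapRanks a c t)))
      ≡⟨ ∑-cong F (λ c → sym (swapRanks-preserving c a _)) ⟩
    ∑ F (λ c → E P (λ t → δ _≟_ c (rank (swapRanks c a t) j) * φ (swapRanks a c (swapRanks c a t))))
      ≡⟨ ∑-cong F (λ c → E-cong P λ t → cong₂ _*_
           (trans (cong (δ _≟_ c) (rank-swapRanks c a t j)) (trans (δ-transpose c a c (rank t j))
             (cong (λ x → δ _≟_ x (rank t j)) (transpose-left c a))))
           (cong φ (swapRanks-inverse a c t))) ⟩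
    ∑ F (λ c → E P (λ y → δ _≟_ a (rank y j) * φ y))
      ≡⟨ ∑-const-fins n _ ⟩
    ℕtoℚ n * E P (λ y → δ _≟_ a (rank y j) * φ y) ∎
    where open ≡-Reasoning

  module _ (j i : Fin n) where

    -- Keeping the ranking with probability 1/n makes the ranks of j before and after independent.
    rerolled : Perm n × Fin n → Perm n
    rerolled (p , zero)  = p
    rerolled (p , suc _) = swapNames j i p

    couplings : Space (Perm n × Fin n)
    couplings = productSpace _,_ P (fins m)

    proj₁-preserving : MeasurePreserving couplings P proj₁
    proj₁-preserving φ = trans (E-product _,_ P (fins m) _) (E-cong P λ p → E-const (fins m) (φ p))

    rerolled-preserving : MeasurePreserving couplings P rerolled
    rerolled-preserving φ = trans (E-product _,_ P (fins m) _) (trans (E-swap P (fins m) _)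
      (trans (E-cong (fins m) pointwise) (E-const (fins m) _)))
      where
      pointwise : ∀ s → E P (λ p → φ (rerolled (p , s))) ≡ E P φ
      pointwise zero    = refl
      pointwise (suc _) = swapNames-preserving j i φ

    module _ (j≢i : j ≢ i) where

      -- This is `pair-law` read as a coupling: `zero` has probability 1/n and supplies the
      -- diagonal; otherwise j takes over the rank of i. Every name other than j and i keeps its
      -- rank, and that is the purpose of the construction.
      rerolled-independent : ∀ (ψ : Fin n → Fin n → ℚ) →
        E couplings (λ o → ψ (rank (proj₁ o) j) (rank (rerolled o) j)) ≡
        E (fins m) (λ a → E (fins m) (ψ a))
      rerolled-independent ψ = ℕtoℚ-cancel m (begin
        N * E couplings (λ o → ψ (rank (proj₁ o) j) (rank (rerolled o) j))
          ≡⟨ cong (N *_) (trans (E-product _,_ P (fins m) _) (E-swap P (fins m) _)) ⟩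
        N * E (fins m) (λ s → E P (λ p → ψ (rank p j) (rank (rerolled (p , s)) j)))
          ≡⟨ trans (E-fins m _) (allFin-suc m _) ⟩
        E P (λ p → ψ (rank p j) (rank p j)) + ∑ (allFin m) (λ _ → E P (λ p → ψ (rank p j) (rank (swapNames j i p) j)))
          ≡⟨ cong₂ _+_ (rank-uniform j (λ a → ψ a a)) (trans (∑-const-fins m _)
               (cong (ℕtoℚ m *_) (E-cong P λ p → cong (ψ (rank p j))
                 (trans (rank-swapNames j i p j) (cong (rank p) (transpose-right i j)))))) ⟩
        E (fins m) (λ a → ψ a a) + ℕtoℚ m * E P (λ p → ψ (rank p j) (rank p i))
          ≡⟨ pair-law j≢i ψ ⟩
        N * E (fins m) (λ a → E (fins m) (ψ a)) ∎)
        where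
        open ≡-Reasoning
        N = ℕtoℚ n

-- Variance of a sum over names

jensen : ∀ {A : Set} (s : Space A) φ → E s φ * E s φ ≤ℚ E s (λ a → φ a * φ a)
jensen s φ = ≤-slack (E s (λ a → (φ a - e) * (φ a - e))) (0≤E s λ a → 0≤sq (φ a - e)) (sym (begin
  e * e + E s (λ a → (φ a - e) * (φ a - e))
    ≡⟨ cong (e * e +_) (E-cong s λ a → square (φ a) e) ⟩
  e * e + E s (λ a → (φ a * φ a - (e + e) * φ a) + e * e)
    ≡⟨ cong (e * e +_) (trans (E-+ s _ _) (cong₂ _+_ (trans (E-- s _ _)
         (cong (λ x → E s (λ a → φ a * φ a) - x) (E-*ˡ s (e + e) φ))) (E-const s (e * e)))) ⟩
  e * e + ((E s (λ a → φ a * φ a) - (e + e) * e) + e * e)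
    ≡⟨ collect e (E s (λ a → φ a * φ a)) ⟩
  E s (λ a → φ a * φ a) ∎))
  where
  open ≡-Reasoning
  e = E s φ
  square : ∀ x e → (x - e) * (x - e) ≡ (x * x - (e + e) * x) + e * e
  square = solve-∀ ℚ-ring
  collect : ∀ e s → e * e + ((s - (e + e) * e) + e * e) ≡ s
  collect = solve-∀ ℚ-ring

∑-square : ∀ {A : Set} (L : List A) φ → ∑ L φ * ∑ L φ ≡ ∑ L (λ j → ∑ L (λ k → φ j * φ k))
∑-square L φ = sym (trans (∑-cong L λ j → ∑-*ˡ L (φ j) φ) (∑-*ʳ L (∑ L φ) φ))

2ℚ 3ℚ : ℚ
2ℚ = 1ℚ + 1ℚ
3ℚ = 2ℚ + 1ℚ

module _ (m′ : ℕ) where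

  private
    m n : ℕ
    m = suc (suc m′)
    n = suc m
    P : Space (Perm n)
    P = perms n
    F : List (Fin n)
    F = allFin n
    A : Space (Fin n)
    A = fins m
    M N : ℚ
    M = ℕtoℚ m
    N = ℕtoℚ n

    N≡ : N ≡ 1ℚ + M
    N≡ = ℕtoℚ-suc m

    0≤M-2 : 0ℚ ≤ℚ M - 2ℚ
    0≤M-2 = subst (0ℚ ≤ℚ_) (trans (shift (ℕtoℚ m′)) (cong (_- 2ℚ) (sym (trans (ℕtoℚ-suc (suc m′)) (cong (1ℚ +_) (ℕtoℚ-suc m′)))))) (0≤ℕtoℚ m′)
      where
      shift : ∀ x → x ≡ (1ℚ + (1ℚ + x)) - (1ℚ + 1ℚ)
      shift = solve-∀ ℚ-ring

  module SingleVariance (μ : Fin n → Fin n → ℚ) where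

    private
      e s : Fin n → ℚ
      e j = E A (μ j)
      s j = E A (λ a → μ j a * μ j a)

      Var : ℚ
      Var = ∑ F s - ∑ F (λ j → e j * e j)

      0≤Var : 0ℚ ≤ℚ Var
      0≤Var = 0≤sub (∑-mono F λ j → jensen A (μ j))

      W : Fin n → Fin n → ℚ
      W j k = E P (λ p → μ j (rank p j) * μ k (rank p k))

      -- For distinct names this is `pair-law` on a product. The δ term corrects the diagonal, so
      -- that the double sum over names can be evaluated at once.
      covariance : ∀ j k → M * W j k ≡ (N * (e j * e k) - E A (λ a → μ j a * μ k a)) + δ _≟_ k j * (N * (s j - e j * e j))
      covariance j k with k ≟ j
      ... | yes refl = begin
        M * W j j
          ≡⟨ cong (M *_) (rank-uniform m j (λ a → μ j a * μ j a)) ⟩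
        M * s j
          ≡⟨ split M (e j) (s j) ⟩
        ((1ℚ + M) * (e j * e j) - s j) + 1ℚ * ((1ℚ + M) * (s j - e j * e j))
          ≡⟨ cong₂ (λ x d → (x * (e j * e j) - s j) + d * (x * (s j - e j * e j))) (sym N≡) (sym (δ-refl _≟_ {j} refl)) ⟩
        (N * (e j * e j) - s j) + δ _≟_ j j * (N * (s j - e j * e j)) ∎
        where
        open ≡-Reasoning
        split : ∀ M e s → M * s ≡ ((1ℚ + M) * (e * e) - s) + 1ℚ * ((1ℚ + M) * (s - e * e))
        split = solve-∀ ℚ-ring
      ... | no k≢j = begin
        M * W j k
          ≡⟨ move (E A (λ a → μ j a * μ k a)) (M * W j k) ⟩
        (E A (λ a → μ j a * μ k a) + M * W j k) - E A (λ a → μ j a * μ k a)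
          ≡⟨ cong (_- E A (λ a → μ j a * μ k a)) (pair-law m (k≢j ∘ sym) (λ a c → μ j a * μ k c)) ⟩
        N * E A (λ a → E A (λ c → μ j a * μ k c)) - E A (λ a → μ j a * μ k a)
          ≡⟨ cong (λ x → N * x - E A (λ a → μ j a * μ k a)) (trans (E-cong A λ a → E-*ˡ A (μ j a) (μ k)) (E-*ʳ A (e k) (μ j))) ⟩
        N * (e j * e k) - E A (λ a → μ j a * μ k a)
          ≡⟨ sym (+-identityʳ _) ⟩
        (N * (e j * e k) - E A (λ a → μ j a * μ k a)) + 0ℚ
          ≡⟨ cong ((N * (e j * e k) - E A (λ a → μ j a * μ k a)) +_)
               (sym (trans (cong (_* (N * (s j - e j * e j))) (δ-≢ _≟_ k≢j)) (*-zeroˡ (N * (s j - e j * e j))))) ⟩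
        (N * (e j * e k) - E A (λ a → μ j a * μ k a)) + δ _≟_ k j * (N * (s j - e j * e j)) ∎
        where
        open ≡-Reasoning
        move : ∀ a b → b ≡ (a + b) - a
        move = solve-∀ ℚ-ring

      second-moment : M * E P (λ p → ∑ F (λ j → μ j (rank p j)) * ∑ F (λ j → μ j (rank p j))) ≡
        (N * (∑ F e * ∑ F e) - E A (λ a → ∑ F (λ j → μ j a) * ∑ F (λ j → μ j a))) + N * Var
      second-moment = begin
        M * E P (λ p → ∑ F (λ j → μ j (rank p j)) * ∑ F (λ j → μ j (rank p j)))
          ≡⟨ cong (M *_) (trans (E-cong P λ p → ∑-square F _) (trans (E-∑ P F _) (∑-cong F λ j → E-∑ P F _))) ⟩
        M * ∑ F (λ j → ∑ F (W j))
          ≡⟨ sym (trans (∑-cong F λ j → ∑-*ˡ F M (W j)) (∑-*ˡ F M _)) ⟩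
        ∑ F (λ j → ∑ F (λ k → M * W j k))
          ≡⟨ ∑-cong F (λ j → ∑-cong F λ k → covariance j k) ⟩
        ∑ F (λ j → ∑ F (λ k → (N * (e j * e k) - E A (λ a → μ j a * μ k a)) + δ _≟_ k j * (N * (s j - e j * e j))))
          ≡⟨ trans (∑-cong F λ j → trans (∑-+ F _ _) (cong₂ _+_ (∑-- F _ _) (∑-δ (allFin-enumerates n) (λ _ → N * (s j - e j * e j)) j)))
               (trans (∑-+ F _ _) (cong (_+ ∑ F (λ j → N * (s j - e j * e j))) (∑-- F _ _))) ⟩
        (∑ F (λ j → ∑ F (λ k → N * (e j * e k))) - ∑ F (λ j → ∑ F (λ k → E A (λ a → μ j a * μ k a))))
          + ∑ F (λ j → N * (s j - e j * e j))
          ≡⟨ cong₂ _+_ (cong₂ _-_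
               (trans (∑-cong F λ j → ∑-*ˡ F N _) (trans (∑-*ˡ F N _) (cong (N *_) (sym (∑-square F e)))))
               (sym (trans (E-cong A λ a → ∑-square F _) (trans (E-∑ A F _) (∑-cong F λ j → E-∑ A F _)))))
               (trans (∑-*ˡ F N _) (cong (N *_) (∑-- F _ _))) ⟩
        (N * (∑ F e * ∑ F e) - E A (λ a → ∑ F (λ j → μ j a) * ∑ F (λ j → μ j a))) + N * Var ∎
        where open ≡-Reasoning

    -- Rearranged: twice the variance of the sum is at most three times the sum of the variances.
    -- The exact factor is N/M plus a nonpositive Jensen term `S * S - B`, and N/M = n/(n-1) is at
    -- most 3/2 from three names on, which is `0≤M-2`.
    single : 2ℚ * E P (λ p → ∑ F (λ j → μ j (rank p j)) * ∑ F (λ j → μ j (rank p j)))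
        + 3ℚ * ∑ F (λ j → e j * e j)
      ≤ℚ 2ℚ * (∑ F e * ∑ F e) + 3ℚ * ∑ F s
    single = *-cancelˡ-≤-pos M ⦃ normalize-pos m 1 ⦄
      (≤-slack (2ℚ * (B - S * S) + (M - 2ℚ) * Var)
        (0≤+ (0≤* (0≤+ 0≤1 0≤1) (0≤sub S²≤B)) (0≤* 0≤M-2 0≤Var))
        (begin
          M * (2ℚ * (S * S) + 3ℚ * ∑ F s)
            ≡⟨ balance M S B (∑ F s) q ⟩
          (2ℚ * (((1ℚ + M) * (S * S) - B) + (1ℚ + M) * Var) + M * (3ℚ * q)) + (2ℚ * (B - S * S) + (M - 2ℚ) * Var)
            ≡⟨ cong (λ x → (2ℚ * ((x * (S * S) - B) + x * Var) + M * (3ℚ * q)) + (2ℚ * (B - S * S) + (M - 2ℚ) * Var)) (sym N≡) ⟩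
          (2ℚ * ((N * (S * S) - B) + N * Var) + M * (3ℚ * q)) + (2ℚ * (B - S * S) + (M - 2ℚ) * Var)
            ≡⟨ cong (λ x → (2ℚ * x + M * (3ℚ * q)) + (2ℚ * (B - S * S) + (M - 2ℚ) * Var)) (sym second-moment) ⟩
          (2ℚ * (M * X) + M * (3ℚ * q)) + (2ℚ * (B - S * S) + (M - 2ℚ) * Var)
            ≡⟨ cong (_+ (2ℚ * (B - S * S) + (M - 2ℚ) * Var)) (pull M X q) ⟩
          M * (2ℚ * X + 3ℚ * q) + (2ℚ * (B - S * S) + (M - 2ℚ) * Var) ∎))
      where
      open ≡-Reasoning
      S B q X : ℚ
      S = ∑ F e
      B = E A (λ a → ∑ F (λ j → μ j a) * ∑ F (λ j → μ j a))
      q = ∑ F (λ j → e j * e j)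
      X = E P (λ p → ∑ F (λ j → μ j (rank p j)) * ∑ F (λ j → μ j (rank p j)))
      S²≤B : S * S ≤ℚ B
      S²≤B = subst (λ x → x * x ≤ℚ B) (E-∑ A F _) (jensen A _)
      balance : ∀ M S B s q → M * ((1ℚ + 1ℚ) * (S * S) + ((1ℚ + 1ℚ) + 1ℚ) * s) ≡
        ((1ℚ + 1ℚ) * (((1ℚ + M) * (S * S) - B) + (1ℚ + M) * (s - q)) + M * (((1ℚ + 1ℚ) + 1ℚ) * q))
          + ((1ℚ + 1ℚ) * (B - S * S) + (M - (1ℚ + 1ℚ)) * (s - q))
      balance = solve-∀ ℚ-ring
      pull : ∀ M X q → (1ℚ + 1ℚ) * (M * X) + M * (((1ℚ + 1ℚ) + 1ℚ) * q) ≡ M * ((1ℚ + 1ℚ) * X + ((1ℚ + 1ℚ) + 1ℚ) * q)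
      pull = solve-∀ ℚ-ring

  -- Both sides are quadratic in the conditional means given the first voter, so the inequality tensorizes.
  variance : ∀ v (μ : Fin n → Vec (Fin n) v → ℚ) →
    2ℚ * E (vectors P v) (λ x → ∑ F (λ j → μ j (ranks j x)) * ∑ F (λ j → μ j (ranks j x)))
      + 3ℚ * ∑ F (λ j → E (vectors A v) (μ j) * E (vectors A v) (μ j))
    ≤ℚ 2ℚ * (∑ F (λ j → E (vectors A v) (μ j)) * ∑ F (λ j → E (vectors A v) (μ j)))
      + 3ℚ * ∑ F (λ j → E (vectors A v) (λ r → μ j r * μ j r))
  variance zero μ = ≤-reflexive (cong₂ _+_
    (cong (2ℚ *_) (trans (E-vectors-[] P _) (cong₂ _*_ means means)))
    (cong (3ℚ *_) (∑-cong F λ j → trans (cong₂ _*_ (E-vectors-[] A (μ j)) (E-vectors-[] A (μ j))) (sym (E-vectors-[] A _)))))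
    where
    means : ∑ F (λ j → μ j []) ≡ ∑ F (λ j → E (vectors A 0) (μ j))
    means = ∑-cong F λ j → sym (E-vectors-[] A (μ j))
  variance (suc v) μ = ≤-slack (slack₁ + slack₂) (0≤+ (0≤sub step₁) (0≤sub step₂)) (begin
    2ℚ * (S * S) + 3ℚ * s
      ≡⟨ juggle X X₁ q q₁ s (S * S) ⟩
    (2ℚ * X + 3ℚ * q) + (slack₁ + slack₂) ∎)
    where
    open ≡-Reasoning
    μ₁ : Fin n → Fin n → ℚ
    μ₁ j a = E (vectors A v) (λ r → μ j (a ∷ r))
    X X₁ S q q₁ s slack₁ slack₂ : ℚ
    X = E (vectors P (suc v)) (λ x → ∑ F (λ j → μ j (ranks j x)) * ∑ F (λ j → μ j (ranks j x)))
    X₁ = E P (λ p → ∑ F (λ j → μ₁ j (rank p j)) * ∑ F (λ j → μ₁ j (rank p j)))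
    S = ∑ F (λ j → E (vectors A (suc v)) (μ j))
    q = ∑ F (λ j → E (vectors A (suc v)) (μ j) * E (vectors A (suc v)) (μ j))
    q₁ = ∑ F (λ j → E A (λ a → μ₁ j a * μ₁ j a))
    s = ∑ F (λ j → E (vectors A (suc v)) (λ r → μ j r * μ j r))
    slack₁ = (2ℚ * X₁ + 3ℚ * s) - (2ℚ * X + 3ℚ * q₁)
    slack₂ = (2ℚ * (S * S) + 3ℚ * q₁) - (2ℚ * X₁ + 3ℚ * q)
    means : ∀ j → E A (μ₁ j) ≡ E (vectors A (suc v)) (μ j)
    means j = sym (E-vectors-∷ A v (μ j))
    -- The one-voter inequality for the means `μ₁` conditioned on the first voter's rank.
    step₂ : 2ℚ * X₁ + 3ℚ * q ≤ℚ 2ℚ * (S * S) + 3ℚ * q₁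
    step₂ = subst₂ (λ x y → 2ℚ * X₁ + 3ℚ * x ≤ℚ 2ℚ * (y * y) + 3ℚ * q₁)
      (∑-cong F λ j → cong₂ _*_ (means j) (means j)) (∑-cong F means) (SingleVariance.single μ₁)
    averaged : ∀ (φ : Fin n → Fin n → ℚ) → E P (λ p → ∑ F (λ j → φ j (rank p j))) ≡ ∑ F (λ j → E A (φ j))
    averaged φ = trans (E-∑ P F _) (∑-cong F λ j → rank-uniform m j (φ j))
    -- The induction hypothesis with the first ballot p fixed, averaged over p. Its term in squared
    -- means becomes `q₁`, and `X₁` and `q₁` cancel when the two steps are added.
    step₁ : 2ℚ * X + 3ℚ * q₁ ≤ℚ 2ℚ * X₁ + 3ℚ * s
    step₁ = subst₂ _≤ℚ_
      (trans (E-+ P _ _) (cong₂ _+_ (trans (E-*ˡ P 2ℚ _) (cong (2ℚ *_) (sym (E-vectors-∷ P v _))))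
        (trans (E-*ˡ P 3ℚ _) (cong (3ℚ *_) (averaged (λ j a → μ₁ j a * μ₁ j a))))))
      (trans (E-+ P _ _) (cong₂ _+_ (E-*ˡ P 2ℚ _)
        (trans (E-*ˡ P 3ℚ _) (cong (3ℚ *_) (trans (averaged (λ j a → E (vectors A v) (λ r → μ j (a ∷ r) * μ j (a ∷ r))))
          (∑-cong F λ j → sym (E-vectors-∷ A v _)))))))
      (E-mono P λ p → variance v (λ j r → μ j (rank p j ∷ r)))
    juggle : ∀ X X₁ q q₁ s S² → ((1ℚ + 1ℚ) * S² + ((1ℚ + 1ℚ) + 1ℚ) * s) ≡
      ((1ℚ + 1ℚ) * X + ((1ℚ + 1ℚ) + 1ℚ) * q) +
      ((((1ℚ + 1ℚ) * X₁ + ((1ℚ + 1ℚ) + 1ℚ) * s) - ((1ℚ + 1ℚ) * X + ((1ℚ + 1ℚ) + 1ℚ) * q₁)) +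
      (((1ℚ + 1ℚ) * S² + ((1ℚ + 1ℚ) + 1ℚ) * q₁) - ((1ℚ + 1ℚ) * X₁ + ((1ℚ + 1ℚ) + 1ℚ) * q)))
    juggle = solve-∀ ℚ-ring

-- Approximation by functions of the ranks of one name

module _ (m : ℕ) {C : Set} (_≟ᶜ_ : DecidableEquality C) where

  private
    n : ℕ
    n = suc m
    P : Space (Perm n)
    P = perms n
    d : C → C → ℚ
    d = dist _≟ᶜ_

  placeAll : ∀ {v} → Fin n → Vec (Fin n) v → Vec (Perm n) v → Vec (Perm n) v
  placeAll j []      []       = []
  placeAll j (a ∷ r) (t ∷ ts) = place m j a t ∷ placeAll j r ts

  -- The event of equal ranks is not conditioned on but only weighted by δ; its probability 1/n
  -- returns as the factor n in `hybrid`.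
  influence : ∀ {v} → Fin n → (Vec (Perm n) v → C) → Fin v → ℚ
  influence {v} j Ψ i = E (vectors P v) (λ x → E P (λ y →
    δ _≟_ (rank (lookup x i) j) (rank y j) * d (Ψ x) (Ψ (x [ i ]≔ y))))

  totalInfluence : ∀ {v} → Fin n → (Vec (Perm n) v → C) → ℚ
  totalInfluence {v} j Ψ = ∑ (allFin v) (influence j Ψ)

  totalInfluence-suc : ∀ {v} j (Ψ : Vec (Perm n) (suc v) → C) →
    totalInfluence j Ψ ≡
    E P (λ p → E (vectors P v) (λ x → E P (λ y → δ _≟_ (rank p j) (rank y j) * d (Ψ (p ∷ x)) (Ψ (y ∷ x)))))
      + E P (λ p → totalInfluence j (λ x → Ψ (p ∷ x)))
  totalInfluence-suc {v} j Ψ = trans (allFin-suc v (influence j Ψ)) (cong₂ _+_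
    (E-vectors-∷ P v _)
    (trans (∑-cong (allFin v) λ i → E-vectors-∷ P v _) (sym (E-∑ P (allFin v) _))))

  E-place-random : ∀ j φ → E P (λ p → E P (λ t → φ (place m j (rank p j) t))) ≡ E P φ
  E-place-random j φ = begin
    E P (λ p → E P (λ t → φ (place m j (rank p j) t)))
      ≡⟨ E-cong P (λ p → E-place m j (rank p j) φ) ⟩
    E P (λ p → ℕtoℚ n * E P (λ y → δ _≟_ (rank p j) (rank y j) * φ y))
      ≡⟨ trans (E-*ˡ P (ℕtoℚ n) _) (cong (ℕtoℚ n *_) (E-swap P P _)) ⟩
    ℕtoℚ n * E P (λ y → E P (λ p → δ _≟_ (rank p j) (rank y j) * φ y))
      ≡⟨ sym (E-*ˡ P (ℕtoℚ n) _) ⟩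
    E P (λ y → ℕtoℚ n * E P (λ p → δ _≟_ (rank p j) (rank y j) * φ y))
      ≡⟨ E-cong P (λ y → trans (cong (ℕtoℚ n *_) (E-cong P λ p → cong (_* φ y) (δ-sym (rank p j) (rank y j))))
           (trans (sym (E-place m j (rank y j) (λ _ → φ y))) (E-const P (φ y)))) ⟩
    E P φ ∎
    where open ≡-Reasoning

  -- Ballots are replaced one at a time by random ballots with the same rank of j. Replacing voter i
  -- costs n times the influence of i, and the profile reached is again uniform by `E-place-random`,
  -- so the costs add up to the total influence without a factor for the number of voters.
  hybrid : ∀ v j (Ψ : Vec (Perm n) v → C) →
    E (vectors P v) (λ x → E (vectors P v) (λ t → d (Ψ x) (Ψ (placeAll j (ranks j x) t)))) ≤ℚ
    ℕtoℚ n * totalInfluence j Ψ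
  hybrid zero j Ψ = ≤-reflexive (trans (E-vectors-[] P _) (trans (E-vectors-[] P _)
    (trans (dist-refl _≟ᶜ_ refl) (sym (trans (cong (ℕtoℚ n *_) (∑-[] (influence j Ψ))) (*-zeroʳ (ℕtoℚ n)))))))
  hybrid (suc v) j Ψ = begin
    E (vectors P (suc v)) (λ x → E (vectors P (suc v)) (λ t → d (Ψ x) (Ψ (placeAll j (ranks j x) t))))
      ≡⟨ trans (E-vectors-∷ P v _) (E-cong P λ p → trans (E-cong V λ x → E-vectors-∷ P v _) (E-swap V P _)) ⟩
    E P (λ p → E P (λ t → E V (λ x → E V (λ ts → d (Ψ (p ∷ x)) (Ψ (pl p t ∷ placeAll j (ranks j x) ts))))))
      ≤⟨ E-mono P (λ p → E-mono P λ t → E-mono V λ x → E-mono V λ ts → dist-triangle _≟ᶜ_ _ (Ψ (pl p t ∷ x)) _) ⟩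
    E P (λ p → E P (λ t → E V (λ x → E V (λ ts → d (Ψ (p ∷ x)) (Ψ (pl p t ∷ x))
      + d (Ψ (pl p t ∷ x)) (Ψ (pl p t ∷ placeAll j (ranks j x) ts))))))
      ≡⟨ E-cong P (λ p → E-cong P λ t → trans (E-cong V λ x → trans (E-+ V _ _)
           (cong (_+ E V (λ ts → d (Ψ (pl p t ∷ x)) (Ψ (pl p t ∷ placeAll j (ranks j x) ts)))) (E-const V (d (Ψ (p ∷ x)) (Ψ (pl p t ∷ x))))))
           (E-+ V _ _)) ⟩
    E P (λ p → E P (λ t → E V (λ x → d (Ψ (p ∷ x)) (Ψ (pl p t ∷ x))) + Φ (pl p t)))
      ≡⟨ trans (E-cong P λ p → E-+ P _ _) (E-+ P _ _) ⟩
    E P (λ p → E P (λ t → E V (λ x → d (Ψ (p ∷ x)) (Ψ (pl p t ∷ x))))) + E P (λ p → E P (λ t → Φ (pl p t)))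
      ≡⟨ cong₂ _+_ head (E-place-random j Φ) ⟩
    ℕtoℚ n * H + E P Φ
      ≤⟨ +-monoʳ-≤ (ℕtoℚ n * H)
           (E-mono P λ p → hybrid v j (λ x → Ψ (p ∷ x))) ⟩
    ℕtoℚ n * H
      + E P (λ p → ℕtoℚ n * totalInfluence j (λ x → Ψ (p ∷ x)))
      ≡⟨ trans (cong (ℕtoℚ n * H +_) (E-*ˡ P (ℕtoℚ n) _))
           (trans (sym (*-distribˡ-+ (ℕtoℚ n) H (E P (λ p → totalInfluence j (λ x → Ψ (p ∷ x)))))) (cong (ℕtoℚ n *_) (sym (totalInfluence-suc j Ψ)))) ⟩
    ℕtoℚ n * totalInfluence j Ψ ∎
    where
    open ≤-Reasoning
    V : Space (Vec (Perm n) v)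
    V = vectors P v
    pl : Perm n → Perm n → Perm n
    pl p t = place m j (rank p j) t
    Φ : Perm n → ℚ
    Φ p = E V (λ x → E V (λ ts → d (Ψ (p ∷ x)) (Ψ (p ∷ placeAll j (ranks j x) ts))))
    H : ℚ
    H = E P (λ p → E V (λ x → E P (λ y → δ _≟_ (rank p j) (rank y j) * d (Ψ (p ∷ x)) (Ψ (y ∷ x)))))
    head : E P (λ p → E P (λ t → E V (λ x → d (Ψ (p ∷ x)) (Ψ (pl p t ∷ x))))) ≡
      ℕtoℚ n * H
    head = trans (E-cong P λ p → trans (E-place m j (rank p j) (λ y → E V (λ x → d (Ψ (p ∷ x)) (Ψ (y ∷ x)))))
        (cong (ℕtoℚ n *_) (trans (E-cong P λ y → sym (E-*ˡ V (δ _≟_ (rank p j) (rank y j)) _)) (E-swap P V _))))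
      (E-*ˡ P (ℕtoℚ n) _)

  -- `G` plants the given ranks of j into one fixed profile t that does no worse than the average in
  -- `hybrid`.
  rank-approximation : ∀ {v} j (Ψ : Vec (Perm n) v → C) → ∃[ G ]
    E (vectors P v) (λ x → d (Ψ x) (G (ranks j x))) ≤ℚ ℕtoℚ n * totalInfluence j Ψ
  rank-approximation {v} j Ψ with E-attained (vectors P v) (λ t → E (vectors P v) (λ x → d (Ψ x) (Ψ (placeAll j (ranks j x) t))))
  ... | t , le = (λ r → Ψ (placeAll j r t)) , ≤-trans le (≤-trans (≤-reflexive (E-swap (vectors P v) (vectors P v) _)) (hybrid v j Ψ))

-- Exchanging two names

-- A pointwise union bound: either the event holds, or the error count `q` has reached 1 and pays
-- for anything bounded by 1. `_⊗_` adds the counts.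
Certain : Set → ℚ → Set
Certain A q = A ⊎ 1ℚ ≤ℚ q

infixr 4 _⊗_

_⊗_ : ∀ {A B q r} → (0ℚ ≤ℚ q × Certain A q) → (0ℚ ≤ℚ r × Certain B r) → 0ℚ ≤ℚ q + r × Certain (A × B) (q + r)
_⊗_ {q = q} {r} (0≤q , ca) (0≤r , cb) = 0≤+ 0≤q 0≤r , combine ca cb
  where
  combine : Certain _ q → Certain _ r → Certain _ (q + r)
  combine (inj₁ a) (inj₁ b)  = inj₁ (a , b)
  combine (inj₁ _) (inj₂ le) = inj₂ (≤-trans le (≤-slack q 0≤q (+-comm q r)))
  combine (inj₂ le) _        = inj₂ (≤-trans le (≤-slack r 0≤r refl))

module _ {C : Set} (_≟ᶜ_ : DecidableEquality C) where

  private
    cancelˡ : ∀ {a b c} → a + b ≡ a + c → b ≡ c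
    cancelˡ {a} {b} {c} eq = trans (shift a b) (trans (cong (_- a) eq) (sym (shift a c)))
      where
      shift : ∀ a b → b ≡ (a + b) - a
      shift = solve-∀ ℚ-ring

  δ-determines : ∀ {b e} → (∀ l → δ _≟ᶜ_ b l ≡ δ _≟ᶜ_ e l) → b ≡ e
  δ-determines {b} {e} eq with e ≟ᶜ b
  ... | yes e≡b = sym e≡b
  ... | no  e≢b = contradiction (trans (sym (δ-refl _≟ᶜ_ {b} refl)) (trans (eq b) (δ-≢ _≟ᶜ_ e≢b))) λ ()

  -- At l = a the left side is at least 1, so a is c or e; cancelling that point mass identifies the
  -- other two.
  δ-sums⇒SamePair : ∀ {a b c e} →
    (∀ l → δ _≟ᶜ_ a l + δ _≟ᶜ_ b l ≡ δ _≟ᶜ_ c l + δ _≟ᶜ_ e l) → SamePair a b c e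
  δ-sums⇒SamePair {a} {b} {c} {e} eq with c ≟ᶜ a | e ≟ᶜ a
  ... | yes refl | _        = inj₁ (refl , δ-determines (λ l → cancelˡ {δ _≟ᶜ_ c l} (eq l)))
  ... | no _     | yes refl = inj₂ (refl , δ-determines (λ l → cancelˡ {δ _≟ᶜ_ e l} (trans (eq l) (+-comm (δ _≟ᶜ_ c l) (δ _≟ᶜ_ e l)))))
  ... | no c≢a   | no e≢a   = contradiction (≤-antisym 1≤0 0≤1) 1≢0
    where
    1≤0 : 1ℚ ≤ℚ 0ℚ
    1≤0 = subst (1ℚ ≤ℚ_) (trans (eq a) (cong₂ _+_ (δ-≢ _≟ᶜ_ c≢a) (δ-≢ _≟ᶜ_ e≢a)))
      (≤-slack (δ _≟ᶜ_ b a) (0≤δ _≟ᶜ_ b a) (cong (_+ δ _≟ᶜ_ b a) (δ-refl _≟ᶜ_ {a} refl)))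

module Approximation {m nb v : ℕ} (b : Fin (suc m) → Fin nb) (f : Vec (Perm (suc m)) v → Perm (suc m))
  (G : Fin (suc m) → Vec (Fin (suc m)) v → Fin nb) where

  n : ℕ
  n = suc m
  P : Space (Perm n)
  P = perms n
  V : Space (Vec (Perm n) v)
  V = vectors P v
  R : Space (Vec (Fin n) v)
  R = vectors (fins m) v
  names : List (Fin n)
  names = allFin n
  d : Fin nb → Fin nb → ℚ
  d = dist _≟_

  -- The coset of f x, as the assignment to each name of the block containing its rank.
  colour : Vec (Perm n) v → Fin n → Fin nb
  colour x j = b (rank (f x) j)

  bad : Vec (Perm n) v → ℚ
  bad x = ∑ names (λ j → d (colour x j) (G j (ranks j x)))

  Good : Vec (Perm n) v → Set
  Good x = ∀ j → colour x j ≡ G j (ranks j x)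

  0≤bad : ∀ x → 0ℚ ≤ℚ bad x
  0≤bad x = 0≤∑ names λ j → 0≤dist _≟_ (colour x j) (G j (ranks j x))

  good? : ∀ x → Certain (Good x) (bad x)
  good? x with FinP.all? (λ j → colour x j ≟ G j (ranks j x))
  ... | yes good = inj₁ good
  ... | no ¬good with FinP.¬∀⟶∃¬ n _ (λ j → colour x j ≟ G j (ranks j x)) ¬good
  ...   | j , ≢ = inj₂ (≤-trans (≤-reflexive (sym (dist-≢ _≟_ ≢)))
          (term≤∑ (allFin-enumerates n) (λ j → 0≤dist _≟_ (colour x j) (G j (ranks j x))) j))

  good : ∀ x → 0ℚ ≤ℚ bad x × Certain (Good x) (bad x)
  good x = 0≤bad x , good? x

  colour-count : ∀ (p : Perm n) (φ : Fin n → ℚ) → ∑ names (λ j → φ (rank p j)) ≡ ∑ names φ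
  colour-count p = ∑-bijection (allFin-enumerates n) (rank p) ⟦ p ⟧ (rank-⟦⟧ p) (⟦⟧-rank p)

  -- In a good profile the values of `G` are the true colours, and the ranks of the names run once
  -- through all ranks, so each colour occurs as often as its block has elements.
  good-count : ∀ {x} → Good x → ∀ l → ∑ names (λ j → δ _≟_ (G j (ranks j x)) l) ≡ ∑ names (λ a → δ _≟_ (b a) l)
  good-count {x} g l = trans (∑-cong names λ j → cong (λ c → δ _≟_ c l) (sym (g j)))
    (colour-count (f x) (λ a → δ _≟_ (b a) l))

  swapOff : Mask v → Fin n → Fin n → Vec (Perm n) v → Vec (Perm n) v
  swapOff S j k = mapᵢ (λ i p → if S i then p else swapNames j k p)

  ranks-swapOff : ∀ S j k l x → ranks l (swapOff S j k x) ≡ sel S (ranks l x) (ranks (transpose k j l) x)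
  ranks-swapOff S j k l x = trans (mapᵢ-∘ (λ _ p → rank p l) _ x)
    (trans (mapᵢ-cong (λ i → pointwise (S i)) x) (mapᵢ-if S (λ p → rank p l) (λ p → rank p (transpose k j l)) x))
    where
    pointwise : ∀ s p → rank (if s then p else swapNames j k p) l ≡ (if s then rank p l else rank p (transpose k j l))
    pointwise true  p = refl
    pointwise false p = rank-swapNames j k p l

  swapOff-preserving : ∀ S j k → MeasurePreserving V V (swapOff S j k)
  swapOff-preserving S j k = mapᵢ-preserving λ i → pointwise (S i)
    where
    pointwise : ∀ s → MeasurePreserving P P (λ p → if s then p else swapNames j k p)
    pointwise true  φ = refl
    pointwise false φ = swapNames-preserving j k φ

  -- Swapping j and k off S keeps the ranks of every other name and hence its colour; as the colour
  -- counts are fixed, the colours of j and k must balance by themselves.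
  exchange : ∀ {j k} → j ≢ k → ∀ S x → Good x → Good (swapOff S j k x) → ∀ l →
    δ _≟_ (G j (ranks j x)) l + δ _≟_ (G k (ranks k x)) l ≡
    δ _≟_ (G j (sel S (ranks j x) (ranks k x))) l + δ _≟_ (G k (sel S (ranks k x) (ranks j x))) l
  exchange {j} {k} j≢k S x g g′ l = begin
    δ _≟_ (G j (ranks j x)) l + δ _≟_ (G k (ranks k x)) l
      ≡⟨ rearrange (δ _≟_ (G j (ranks j x)) l) (δ _≟_ (G k (ranks k x)) l) (δ _≟_ (G j (ranks j x′)) l) (δ _≟_ (G k (ranks k x′)) l) ⟩
    (φ j + φ k) + (δ _≟_ (G j (ranks j x′)) l + δ _≟_ (G k (ranks k x′)) l)
      ≡⟨ cong (_+ (δ _≟_ (G j (ranks j x′)) l + δ _≟_ (G k (ranks k x′)) l)) (trans (sym (∑-supported₂ (allFin-enumerates n) j≢k φ vanish)) ∑φ≡0) ⟩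
    0ℚ + (δ _≟_ (G j (ranks j x′)) l + δ _≟_ (G k (ranks k x′)) l)
      ≡⟨ +-identityˡ _ ⟩
    δ _≟_ (G j (ranks j x′)) l + δ _≟_ (G k (ranks k x′)) l
      ≡⟨ cong₂ (λ r s → δ _≟_ (G j r) l + δ _≟_ (G k s) l)
           (trans (ranks-swapOff S j k j x) (cong (λ i → sel S (ranks j x) (ranks i x)) (transpose-right k j)))
           (trans (ranks-swapOff S j k k x) (cong (λ i → sel S (ranks k x) (ranks i x)) (transpose-left k j))) ⟩
    δ _≟_ (G j (sel S (ranks j x) (ranks k x))) l + δ _≟_ (G k (sel S (ranks k x) (ranks j x))) l ∎
    where
    open ≡-Reasoning
    x′ : Vec (Perm n) v
    x′ = swapOff S j k x
    φ : Fin n → ℚ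
    φ i = δ _≟_ (G i (ranks i x)) l - δ _≟_ (G i (ranks i x′)) l
    ∑φ≡0 : ∑ names φ ≡ 0ℚ
    ∑φ≡0 = trans (∑-- names _ _) (trans (cong₂ _-_ (good-count g l) (good-count g′ l)) (+-inverseʳ (∑ names (λ a → δ _≟_ (b a) l))))
    vanish : ∀ i → i ≢ j → i ≢ k → φ i ≡ 0ℚ
    vanish i i≢j i≢k = trans (cong (λ r → δ _≟_ (G i (ranks i x)) l - δ _≟_ (G i r) l)
      (trans (ranks-swapOff S j k i x) (trans (cong (λ h → sel S (ranks i x) (ranks h x)) (transpose-other k j i≢k i≢j)) (sel-idem S (ranks i x)))))
      (+-inverseʳ (δ _≟_ (G i (ranks i x)) l))
    rearrange : ∀ a b c e → a + b ≡ ((a - c) + (b - e)) + (c + e)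
    rearrange = solve-∀ ℚ-ring

  badPair : Mask v → Fin n → Fin n → Vec (Perm n) v → ℚ
  badPair S j k x = bad x + bad (swapOff S j k x)

  goodPair : ∀ S j k x → 0ℚ ≤ℚ badPair S j k x × Certain (Good x × Good (swapOff S j k x)) (badPair S j k x)
  goodPair S j k x = good x ⊗ good (swapOff S j k x)

  corners : Mask v → Fin n → Fin n → Vec (Perm n) v → Vec (Perm n) v → ℚ
  corners S j k x y =
    (badPair S j k x + badPair S j k y) + (badPair S j k (sel S x y) + badPair S j k (sel S y x))

  module _ {j k : Fin n} (j≢k : j ≢ k) (S : Mask v) where

    open Dependence (fins m) _≟_ (G j) using (crossing)

    -- The four exchange identities have the terms of k in common with alternating signs.
    crossing≤corners : ∀ x y → ranks k x ≡ ranks k y → crossing S (ranks j x) (ranks j y) ≤ℚ corners S j k x y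
    crossing≤corners x y γ≡ with (goodPair S j k x ⊗ goodPair S j k y) ⊗ (goodPair S j k (sel S x y) ⊗ goodPair S j k (sel S y x))
    ... | _   , inj₂ 1≤corners = ≤-trans (𝟙≤1 (¬? (samePair? _≟_ _ _ _ _))) 1≤corners
    ... | 0≤c , inj₁ (((gx , gx′) , (gy , gy′)) , ((gxy , gxy′) , (gyx , gyx′))) =
      ≤-trans (≤-reflexive (𝟙-no (¬? (samePair? _≟_ _ _ _ _)) (λ ¬same → ¬same (δ-sums⇒SamePair _≟_ additive)))) 0≤c
      where
      α β γ : Vec (Fin n) v
      α = ranks j x
      β = ranks j y
      γ = ranks k x
      e : Fin n → Vec (Fin n) v → Fin nb → ℚ
      e i r l = δ _≟_ (G i r) l
      j-xy : ranks j (sel S x y) ≡ sel S α β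
      j-xy = mapᵢ-sel S (λ p → rank p j) x y
      j-yx : ranks j (sel S y x) ≡ sel S β α
      j-yx = mapᵢ-sel S (λ p → rank p j) y x
      k-xy : ranks k (sel S x y) ≡ γ
      k-xy = trans (mapᵢ-sel S (λ p → rank p k) x y) (trans (cong (sel S γ) (sym γ≡)) (sel-idem S γ))
      k-yx : ranks k (sel S y x) ≡ γ
      k-yx = trans (mapᵢ-sel S (λ p → rank p k) y x) (trans (cong (λ r → sel S r γ) (sym γ≡)) (sel-idem S γ))
      at-x : ∀ l → e j α l + e k γ l ≡ e j (sel S α γ) l + e k (sel S γ α) l
      at-x l = exchange j≢k S x gx gx′ l
      at-y : ∀ l → e j β l + e k γ l ≡ e j (sel S β γ) l + e k (sel S γ β) l
      at-y l = subst (λ r → e j β l + e k r l ≡ e j (sel S β r) l + e k (sel S r β) l) (sym γ≡) (exchange j≢k S y gy gy′ l)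
      at-xy : ∀ l → e j (sel S α β) l + e k γ l ≡ e j (sel S α γ) l + e k (sel S γ β) l
      at-xy l = trans (subst₂ (λ r s → e j r l + e k s l ≡ e j (sel S r s) l + e k (sel S s r) l) j-xy k-xy
        (exchange j≢k S (sel S x y) gxy gxy′ l))
        (cong₂ (λ r s → e j r l + e k s l) (sel-selˡ S α β γ) (sel-selʳ S γ α β))
      at-yx : ∀ l → e j (sel S β α) l + e k γ l ≡ e j (sel S β γ) l + e k (sel S γ α) l
      at-yx l = trans (subst₂ (λ r s → e j r l + e k s l ≡ e j (sel S r s) l + e k (sel S s r) l) j-yx k-yx
        (exchange j≢k S (sel S y x) gyx gyx′ l))
        (cong₂ (λ r s → e j r l + e k s l) (sel-selˡ S β α γ) (sel-selʳ S γ β α))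
      additive : ∀ l → e j α l + e j β l ≡ e j (sel S α β) l + e j (sel S β α) l
      additive l = begin
        e j α l + e j β l
          ≡⟨ out (e j α l) (e j β l) (e k γ l) ⟩
        ((e j α l + e k γ l) + (e j β l + e k γ l)) - (e k γ l + e k γ l)
          ≡⟨ cong (_- (e k γ l + e k γ l)) (trans (cong₂ _+_ (at-x l) (at-y l))
               (cross (e j (sel S α γ) l) (e k (sel S γ α) l) (e j (sel S β γ) l) (e k (sel S γ β) l))) ⟩
        ((e j (sel S α γ) l + e k (sel S γ β) l) + (e j (sel S β γ) l + e k (sel S γ α) l)) - (e k γ l + e k γ l)
          ≡⟨ cong (_- (e k γ l + e k γ l)) (sym (cong₂ _+_ (at-xy l) (at-yx l))) ⟩
        ((e j (sel S α β) l + e k γ l) + (e j (sel S β α) l + e k γ l)) - (e k γ l + e k γ l)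
          ≡⟨ sym (out (e j (sel S α β) l) (e j (sel S β α) l) (e k γ l)) ⟩
        e j (sel S α β) l + e j (sel S β α) l ∎
        where
        open ≡-Reasoning
        out : ∀ a b c → a + b ≡ ((a + c) + (b + c)) - (c + c)
        out = solve-∀ ℚ-ring
        cross : ∀ a b c e → (a + b) + (c + e) ≡ (a + e) + (c + b)
        cross = solve-∀ ℚ-ring

  module _ {θ : ℚ} (bad≤ : E V bad ≤ℚ θ) where

    2θ 4θ 8θ : ℚ
    2θ = θ + θ
    4θ = 2θ + 2θ
    8θ = 4θ + 4θ

    badPair≤ : ∀ S j k → E V (badPair S j k) ≤ℚ 2θ
    badPair≤ S j k = ≤-trans (≤-reflexive (trans (E-+ V _ _) (cong (E V bad +_) (swapOff-preserving S j k bad)))) (+-mono-≤ bad≤ bad≤)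

    module _ {j k i : Fin n} (j≢k : j ≢ k) (j≢i : j ≢ i) (k≢i : k ≢ i) (S : Mask v) where

      private
        Ω : Space (Vec (Perm n × Fin n) v)
        Ω = vectors (couplings m j i) v
        X Y : Vec (Perm n × Fin n) v → Vec (Perm n) v
        X = mapᵢ (λ _ → proj₁)
        Y = mapᵢ (λ _ → rerolled m j i)

        same-k : ∀ o → ranks k (X o) ≡ ranks k (Y o)
        same-k o = trans (mapᵢ-∘ _ _ o) (trans (mapᵢ-cong (λ _ → pointwise) o) (sym (mapᵢ-∘ _ _ o)))
          where
          pointwise : ∀ o → rank (proj₁ o) k ≡ rank (rerolled m j i o) k
          pointwise (p , zero)  = refl
          pointwise (p , suc _) = sym (trans (rank-swapNames j i p k) (cong (rank p) (transpose-other i j k≢i (j≢k ∘ sym))))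

        X-preserving : MeasurePreserving Ω V X
        X-preserving = mapᵢ-preserving λ _ → proj₁-preserving m j i

        Y-preserving : MeasurePreserving Ω V Y
        Y-preserving = mapᵢ-preserving λ _ → rerolled-preserving m j i

        mixed-preserving : ∀ {f g : Perm n × Fin n → Perm n} →
          MeasurePreserving (couplings m j i) P f → MeasurePreserving (couplings m j i) P g →
          MeasurePreserving Ω V (λ o → sel S (mapᵢ (λ _ → f) o) (mapᵢ (λ _ → g) o))
        mixed-preserving {f} {g} mf mg φ = trans (E-cong Ω λ o → cong φ (sym (mapᵢ-if S f g o)))
          (mapᵢ-preserving (λ h → pointwise (S h)) φ)
          where
          pointwise : ∀ s → MeasurePreserving (couplings m j i) P (λ o → if s then f o else g o)
          pointwise true  = mf
          pointwise false = mg

        independent : ∀ (ψ : Vec (Fin n) v → Vec (Fin n) v → ℚ) →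
          E Ω (λ o → ψ (ranks j (X o)) (ranks j (Y o))) ≡ E R (λ a → E R (ψ a))
        independent ψ = trans (E-cong Ω λ o → cong₂ ψ (mapᵢ-∘ _ _ o) (mapᵢ-∘ _ _ o))
          (mapᵢ-independent (rerolled-independent m j i j≢i) v ψ)

      open Dependence (fins m) _≟_ (G j)

      -- `crossing≤corners` needs two profiles with equal ranks of k, while `rectangleDefect` asks
      -- for independent ranks of j. Rerolling j against the third name i gives both. All four
      -- corners are uniform, and each costs one `badPair`.
      rectangleDefect≤ : rectangleDefect S ≤ℚ 8θ
      rectangleDefect≤ = begin
        rectangleDefect S
          ≡⟨ sym (independent (crossing S)) ⟩
        E Ω (λ o → crossing S (ranks j (X o)) (ranks j (Y o)))
          ≤⟨ E-mono Ω (λ o → crossing≤corners j≢k S (X o) (Y o) (same-k o)) ⟩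
        E Ω (λ o → corners S j k (X o) (Y o))
          ≡⟨ trans (E-+ Ω _ _) (cong₂ _+_ (E-+ Ω _ _) (E-+ Ω _ _)) ⟩
        (E Ω (λ o → badPair S j k (X o)) + E Ω (λ o → badPair S j k (Y o)))
          + (E Ω (λ o → badPair S j k (sel S (X o) (Y o))) + E Ω (λ o → badPair S j k (sel S (Y o) (X o))))
          ≡⟨ cong₂ _+_ (cong₂ _+_ (X-preserving _) (Y-preserving _))
               (cong₂ _+_ (mixed-preserving (proj₁-preserving m j i) (rerolled-preserving m j i) _)
                          (mixed-preserving (rerolled-preserving m j i) (proj₁-preserving m j i) _)) ⟩
        (E V (badPair S j k) + E V (badPair S j k)) + (E V (badPair S j k) + E V (badPair S j k))
          ≤⟨ +-mono-≤ (+-mono-≤ (badPair≤ S j k) (badPair≤ S j k)) (+-mono-≤ (badPair≤ S j k) (badPair≤ S j k)) ⟩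
        8θ ∎
        where open ≤-Reasoning

      private
        τ : ℚ
        τ = E V (λ x → d (G j (ranks j x)) (G j (sel S (ranks j x) (ranks k x))))

      -- Detour through the mixture whose ranks off S are those of k. The second leg has the law of
      -- the first: the mixed profile gives j the ranks `sel S (α o) (β o)` and leaves k its ranks.
      dependence≤τ : dependence S ≤ℚ τ + τ
      dependence≤τ = begin
        dependence S
          ≡⟨ sym (independent (λ a c → d (G j a) (G j (sel S a c)))) ⟩
        E Ω (λ o → d (G j (α o)) (G j (sel S (α o) (β o))))
          ≤⟨ E-mono Ω (λ o → dist-triangle _≟_ _ (G j (sel S (α o) (ranks k (X o)))) _) ⟩
        E Ω (λ o → d (G j (α o)) (G j (sel S (α o) (ranks k (X o)))) + d (G j (sel S (α o) (ranks k (X o)))) (G j (sel S (α o) (β o))))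
          ≡⟨ trans (E-+ Ω _ _) (cong₂ _+_ (X-preserving (λ x → d (G j (ranks j x)) (G j (sel S (ranks j x) (ranks k x))))) second) ⟩
        τ + τ ∎
        where
        open ≤-Reasoning
        α β : Vec (Perm n × Fin n) v → Vec (Fin n) v
        α o = ranks j (X o)
        β o = ranks j (Y o)
        pointwise : ∀ o → d (G j (sel S (α o) (ranks k (X o)))) (G j (sel S (α o) (β o))) ≡
          d (G j (ranks j (sel S (X o) (Y o)))) (G j (sel S (ranks j (sel S (X o) (Y o))) (ranks k (sel S (X o) (Y o)))))
        pointwise o = trans (dist-sym _≟_ _ _) (cong₂ (λ r s → d (G j r) (G j s)) (sym (mapᵢ-sel S (λ p → rank p j) (X o) (Y o)))
          (sym (trans (cong₂ (sel S) (mapᵢ-sel S (λ p → rank p j) (X o) (Y o))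
                 (trans (mapᵢ-sel S (λ p → rank p k) (X o) (Y o)) (trans (cong (sel S _) (sym (same-k o))) (sel-idem S _))))
            (sel-selˡ S (α o) (β o) (ranks k (X o))))))
        second : E Ω (λ o → d (G j (sel S (α o) (ranks k (X o)))) (G j (sel S (α o) (β o)))) ≡ τ
        second = trans (E-cong Ω pointwise) (mixed-preserving (proj₁-preserving m j i) (rerolled-preserving m j i) _)

      private
        τ′ : ℚ
        τ′ = E V (λ x → d (G k (ranks k x)) (G k (sel S (ranks k x) (ranks j x))))

        same-change : ∀ {a b c e : Fin nb} → SamePair a b c e → d a c ≤ℚ d b e
        same-change {a} {b} {c} {e} (inj₁ (refl , _))    = ≤-trans (≤-reflexive (dist-refl _≟_ {a} refl)) (0≤dist _≟_ b e)
        same-change {a} {b} {c} {e} (inj₂ (refl , refl)) = ≤-reflexive (dist-sym _≟_ a b)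

      -- Where both profiles are good, j and k carry the same pair of colours before and after the
      -- swap, so one of them changes only if the other does.
      τ≤τ′ : τ ≤ℚ τ′ + 2θ
      τ≤τ′ = begin
        τ ≤⟨ E-mono V pointwise ⟩
        E V (λ x → d (G k (ranks k x)) (G k (sel S (ranks k x) (ranks j x))) + badPair S j k x)
          ≡⟨ E-+ V _ _ ⟩
        τ′ + E V (badPair S j k)
          ≤⟨ +-monoʳ-≤ τ′ (badPair≤ S j k) ⟩
        τ′ + 2θ ∎
        where
        open ≤-Reasoning
        pointwise : ∀ x → d (G j (ranks j x)) (G j (sel S (ranks j x) (ranks k x))) ≤ℚ
          d (G k (ranks k x)) (G k (sel S (ranks k x) (ranks j x))) + badPair S j k x
        pointwise x with goodPair S j k x
        ... | 0≤bp , inj₁ (g , g′) = ≤-trans (same-change (δ-sums⇒SamePair _≟_ (exchange j≢k S x g g′))) (≤-slack (badPair S j k x) 0≤bp refl)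
        ... | _    , inj₂ 1≤bp     = ≤-trans (dist≤1 _≟_ _ _) (≤-trans 1≤bp
          (≤-slack _ (0≤dist _≟_ (G k (ranks k x)) (G k (sel S (ranks k x) (ranks j x)))) (+-comm _ (badPair S j k x))))

      private
        module K = Dependence (fins m) _≟_ (G k)

      -- Detour through an independent vector c off S. On the second leg the starting point is the
      -- rank vector of k after the swap, which is again uniform.
      τ′≤dependence : τ′ ≤ℚ K.dependence S + K.dependence S
      τ′≤dependence = begin
        τ′
          ≡⟨ E-cong V (λ x → sym (E-const R _)) ⟩
        E V (λ x → E R (λ c → d (G k (ranks k x)) (G k (sel S (ranks k x) (ranks j x)))))
          ≤⟨ E-mono V (λ x → E-mono R λ c → dist-triangle _≟_ _ (G k (sel S (ranks k x) c)) _) ⟩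
        E V (λ x → E R (λ c → d (G k (ranks k x)) (G k (sel S (ranks k x) c)) + d (G k (sel S (ranks k x) c)) (G k (sel S (ranks k x) (ranks j x)))))
          ≡⟨ trans (E-cong V λ x → E-+ R _ _) (E-+ V _ _) ⟩
        E V (λ x → E R (λ c → d (G k (ranks k x)) (G k (sel S (ranks k x) c))))
          + E V (λ x → E R (λ c → d (G k (sel S (ranks k x) c)) (G k (sel S (ranks k x) (ranks j x)))))
          ≡⟨ cong₂ _+_ (uniform-k Δ) (trans (E-cong V λ x → E-cong R λ c → trans (dist-sym _≟_ _ _) (cong₂ (λ r s → d (G k r) (G k s)) (sym (swapped x))
               (sym (trans (cong (λ r → sel S r c) (swapped x)) (sel-selˡ S (ranks k x) (ranks j x) c)))))
               (trans (swapOff-preserving S j k (λ x → Δ (ranks k x))) (uniform-k Δ))) ⟩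
        K.dependence S + K.dependence S ∎
        where
        open ≤-Reasoning
        Δ : Vec (Fin n) v → ℚ
        Δ r = E R (λ c → d (G k r) (G k (sel S r c)))
        uniform-k : MeasurePreserving V R (ranks k)
        uniform-k = mapᵢ-preserving λ _ → rank-uniform m k
        swapped : ∀ x → ranks k (swapOff S j k x) ≡ sel S (ranks k x) (ranks j x)
        swapped x = trans (ranks-swapOff S j k k x) (cong (λ i → sel S (ranks k x) (ranks i x)) (transpose-left k j))

      -- A voter who nearly determines the colour of one name thereby nearly determines the colour
      -- of every name.
      dependence-transfer : dependence S ≤ℚ ((K.dependence S + K.dependence S) + 2θ) + ((K.dependence S + K.dependence S) + 2θ)
      dependence-transfer = ≤-trans dependence≤τ (+-mono-≤ step step)
        where
        step : τ ≤ℚ (K.dependence S + K.dependence S) + 2θ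
        step = ≤-trans τ≤τ′ (+-monoˡ-≤ 2θ τ′≤dependence)

-- Near-constant colourings

third-name : ∀ {m} (j k : Fin (3 ℕ.+ m)) → ∃[ i ] (j ≢ i × k ≢ i)
third-name j k with j ≟ zero | k ≟ zero | j ≟ suc zero | k ≟ suc zero
... | no j≢0   | no k≢0   | _        | _        = zero , j≢0 , k≢0
... | _        | _        | no j≢1   | no k≢1   = suc zero , j≢1 , k≢1
... | yes refl | _        | _        | yes refl = suc (suc zero) , (λ ()) , (λ ())
... | _        | yes refl | yes refl | _        = suc (suc zero) , (λ ()) , (λ ())
... | yes refl | no _     | yes ()   | _
... | no _     | yes refl | _        | yes ()

module _ {A : Set} {_≟ᴬ_ : DecidableEquality A} {L : List A} (enum : Enumerates _≟ᴬ_ L) where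

  terms≤∑ : ∀ {a c} → a ≢ c → ∀ {φ} → (∀ x → 0ℚ ≤ℚ φ x) → φ a + φ c ≤ℚ ∑ L φ
  terms≤∑ {a} {c} a≢c {φ} 0≤φ = subst (_≤ℚ ∑ L φ)
    (trans (∑-+ L _ _) (cong₂ _+_ (∑-δ enum φ a) (∑-δ enum φ c))) (∑-mono L pointwise)
    where
    bound : ∀ {p q} x → (p ≡ 1ℚ × q ≡ 0ℚ) ⊎ (p ≡ 0ℚ × q ≤ℚ 1ℚ) → p * φ x + q * φ x ≤ℚ φ x
    bound x (inj₁ (refl , refl)) = ≤-reflexive (trans (cong₂ _+_ (*-identityˡ (φ x)) (*-zeroˡ (φ x))) (+-identityʳ (φ x)))
    bound {q = q} x (inj₂ (refl , q≤1)) = ≤-trans (≤-reflexive (trans (cong (_+ q * φ x) (*-zeroˡ (φ x))) (+-identityˡ (q * φ x))))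
      (≤-trans (*-monoʳ-≤ (0≤φ x) q≤1) (≤-reflexive (*-identityˡ (φ x))))
    pointwise : ∀ x → δ _≟ᴬ_ x a * φ x + δ _≟ᴬ_ x c * φ x ≤ℚ φ x
    pointwise x with x ≟ᴬ a
    ... | yes refl = bound x (inj₁ (δ-refl _≟ᴬ_ refl , δ-≢ _≟ᴬ_ a≢c))
    ... | no  x≢a  = bound x (inj₂ (δ-≢ _≟ᴬ_ x≢a , δ≤1 _≟ᴬ_ x c))

dist-idem : ∀ {A : Set} (_≟ᴬ_ : DecidableEquality A) a c → dist _≟ᴬ_ a c * dist _≟ᴬ_ a c ≡ dist _≟ᴬ_ a c
dist-idem _≟ᴬ_ a c with a ≟ᴬ c
... | yes a≡c = trans (cong₂ _*_ (dist-refl _≟ᴬ_ a≡c) (dist-refl _≟ᴬ_ a≡c)) (sym (dist-refl _≟ᴬ_ a≡c))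
... | no  a≢c = trans (cong₂ _*_ (dist-≢ _≟ᴬ_ a≢c) (dist-≢ _≟ᴬ_ a≢c)) (sym (dist-≢ _≟ᴬ_ a≢c))

-- Place j first. Placing k then exchanges two positions that both differ from a, so j stays.
two-ranks : ∀ m {j k a c : Fin (suc m)} → j ≢ k → a ≢ c → ∃[ p ] (rank p j ≡ a × rank p k ≡ c)
two-ranks m {j} {k} {a} {c} j≢k a≢c = place m k c p , kept , rank-place m k c p
  where
  p : Perm (suc m)
  p = place m j a identity
  kept : rank (place m k c p) j ≡ a
  kept = trans (rank-swapRanks c (rank p k) p j) (trans
    (transpose-other (rank p k) c (j≢k ∘ rank-injective p) (λ eq → a≢c (trans (sym (rank-place m j a identity)) eq)))
    (rank-place m j a identity))

mapᵢ-[]≔ : ∀ {A B : Set} {n} (f : A → B) (x : Vec A n) i a → mapᵢ (λ _ → f) (x [ i ]≔ a) ≡ mapᵢ (λ _ → f) x [ i ]≔ f a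
mapᵢ-[]≔ f (_ ∷ x) zero    a = refl
mapᵢ-[]≔ f (b ∷ x) (suc i) a = cong (f b ∷_) (mapᵢ-[]≔ f x i a)

mapᵢ-id : ∀ {A : Set} {n} (x : Vec A n) → mapᵢ (λ _ a → a) x ≡ x
mapᵢ-id []      = refl
mapᵢ-id (a ∷ x) = cong (a ∷_) (mapᵢ-id x)

opaque

  eighth : ℚ
  eighth = ½ * (½ * ½)

  quarter : ℚ
  quarter = ½ * ½

  0≤eighth : 0ℚ ≤ℚ eighth
  0≤eighth = 0≤* {½} (nonNegative⁻¹ ½) (0≤* {½} (nonNegative⁻¹ ½) (nonNegative⁻¹ ½))

  eighth+eighth : eighth + eighth ≡ quarter
  eighth+eighth = trans (double ½ (½ * ½)) (*-identityˡ (½ * ½))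
    where
    double : ∀ h q → h * q + h * q ≡ (h + h) * q
    double = solve-∀ ℚ-ring

  quarters : (quarter + quarter) + (quarter + quarter) ≡ 1ℚ
  quarters = refl

¬1≤quarter : ¬ (1ℚ ≤ℚ quarter)
¬1≤quarter 1≤q = contradiction (≤-antisym (≤-slack (1ℚ - 2ℚ) (0≤sub 2≤1) refl) 0≤1) 1≢0
  where
  0≤q : 0ℚ ≤ℚ quarter
  0≤q = ≤-trans 0≤1 1≤q
  2≤1 : 2ℚ ≤ℚ 1ℚ
  2≤1 = ≤-trans (+-mono-≤ 1≤q 1≤q) (≤-trans (≤-slack (quarter + quarter) (0≤+ 0≤q 0≤q) refl) (≤-reflexive quarters))

module Cases {m′ nb v : ℕ} (b : Fin (3 ℕ.+ m′) → Fin nb) (f : Vec (Perm (3 ℕ.+ m′)) v → Perm (3 ℕ.+ m′))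
  (G : Fin (3 ℕ.+ m′) → Vec (Fin (3 ℕ.+ m′)) v → Fin nb) where

  m : ℕ
  m = suc (suc m′)

  open Approximation {m} {nb} {v} b f G public

  -- `c` is 1/(8n): if all n dependences stay below it, they add up to at most 1/8. `L` is the
  -- number of ballots, the inverse of the mass of a single one.
  N c L : ℚ
  N = ℕtoℚ n
  c = recip n * eighth
  L = ℕtoℚ (length (allPerms n))

  0≤N : 0ℚ ≤ℚ N
  0≤N = 0≤ℕtoℚ n

  0≤c : 0ℚ ≤ℚ c
  0≤c = 0≤* (0≤recip n) 0≤eighth

  dep : Fin n → Mask v → ℚ
  dep j = Dependence.dependence (fins m) _≟_ (G j)

  none : Mask v
  none _ = false

  simpleColour : Simple n v → Vec (Perm n) v → Fin n → Fin nb
  simpleColour (const y)      x j = b (rank y j)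
  simpleColour (dictator i y) x j = b (rank y (rank (lookup x i) j))

  error : Simple n v → ℚ
  error h = E V (λ x → ∑ names (λ j → d (colour x j) (simpleColour h x j)))

  error≤N : ∀ h → error h ≤ℚ N
  error≤N h = E-bound V λ x → ≤-trans (∑-mono names λ j → dist≤1 _≟_ (colour x j) (simpleColour h x j))
    (≤-reflexive (trans (∑-const-fins n 1ℚ) (*-identityʳ N)))

  ranks-uniform : ∀ j → MeasurePreserving V R (ranks j)
  ranks-uniform j = mapᵢ-preserving λ _ → rank-uniform m j

  module NearConstant (θ : ℚ) (bad≤ : E V bad ≤ℚ θ) (θ≤ : θ ≤ℚ eighth) (dep≤c : ∀ j → dep j none ≤ℚ c) where

    -- The expected number of names whose value of `G` at a random profile differs from that at u.
    -- Adding `bad u` lets one choice of u make both small, and a value of `bad u` below 1 means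
    -- that u is good.
    Q₁ : Vec (Perm n) v → ℚ
    Q₁ u = ∑ names (λ j → E V (λ x → d (G j (ranks j u)) (G j (ranks j x))))

    E-Q₁ : E V Q₁ ≡ ∑ names (λ j → dep j none)
    E-Q₁ = trans (E-∑ V names _) (∑-cong names λ j → trans
      (trans (E-cong V λ u → ranks-uniform j (λ s → d (G j (ranks j u)) (G j s))) (ranks-uniform j (λ r → E R (λ s → d (G j r) (G j s)))))
      (sym (Dependence.dependence-false (fins m) _≟_ (G j))))

    Nc : N * c ≡ eighth
    Nc = trans (sym (*-assoc N (recip n) eighth)) (trans (cong (_* eighth) (recip-inverse m)) (*-identityˡ eighth))

    E-Q : E V (λ u → Q₁ u + bad u) ≤ℚ quarter
    E-Q = ≤-trans (≤-reflexive (E-+ V Q₁ bad)) (≤-trans (+-mono-≤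
      (≤-trans (≤-reflexive E-Q₁) (≤-trans (∑-mono names dep≤c) (≤-reflexive (trans (∑-const-fins n c) Nc))))
      (≤-trans bad≤ θ≤)) (≤-reflexive eighth+eighth))

    module _ (u : Vec (Perm n) v) (Q≤ : Q₁ u + bad u ≤ℚ quarter) where

      0≤Q₁ : 0ℚ ≤ℚ Q₁ u
      0≤Q₁ = 0≤∑ names λ j → 0≤E V λ x → 0≤dist _≟_ (G j (ranks j u)) (G j (ranks j x))

      good-u : Good u
      good-u = resolve (good? u)
        where
        resolve : Certain (Good u) (bad u) → Good u
        resolve (inj₁ g)     = g
        resolve (inj₂ 1≤bad) = contradiction
          (≤-trans 1≤bad (≤-trans (≤-slack (Q₁ u) 0≤Q₁ (+-comm (Q₁ u) (bad u))) Q≤)) ¬1≤quarter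

      κ : Fin n → Fin nb
      κ = colour u

      μ : Fin n → Vec (Fin n) v → ℚ
      μ j r = d (G j r) (κ j)

      0≤μ : ∀ j r → 0ℚ ≤ℚ μ j r
      0≤μ j r = 0≤dist _≟_ (G j r) (κ j)

      W : Vec (Perm n) v → ℚ
      W x = ∑ names (λ j → μ j (ranks j x))

      M : ℚ
      M = ∑ names (λ j → E R (μ j))

      0≤M : 0ℚ ≤ℚ M
      0≤M = 0≤∑ names λ j → 0≤E R (0≤μ j)

      E-W : E V W ≡ M
      E-W = trans (E-∑ V names _) (∑-cong names λ j → ranks-uniform j (μ j))

      M≤¼ : M ≤ℚ quarter
      M≤¼ = ≤-trans (≤-reflexive (trans (sym (∑-cong names λ j → ranks-uniform j (μ j)))
          (∑-cong names λ j → E-cong V λ x → trans (cong (d (G j (ranks j x))) (good-u j)) (dist-sym _≟_ _ _))))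
        (≤-trans (≤-slack (bad u) (0≤bad u) refl) Q≤)

      -- `variance` with the squared means dropped; the deviations are 0 or 1, so their second
      -- moments add up to `M` itself.
      second-moment : 2ℚ * E V (λ x → W x * W x) ≤ℚ 2ℚ * (M * M) + 3ℚ * M
      second-moment = ≤-trans
        (≤-slack (3ℚ * ∑ names (λ j → E R (μ j) * E R (μ j))) (0≤* (0≤+ (0≤+ 0≤1 0≤1) 0≤1) (0≤∑ names λ j → 0≤sq (E R (μ j)))) refl)
        (≤-trans (variance m′ v μ) (≤-reflexive (cong (λ s → 2ℚ * (M * M) + 3ℚ * s)
          (∑-cong names λ j → E-cong R λ r → dist-idem _≟_ (G j r) (κ j)))))

      -- The colours of a good profile have the same counts as κ, so they cannot differ from κ at a single name.
      not-single : ∀ {x} → Good x → ∀ {j} → G j (ranks j x) ≢ κ j → ∃[ k ] (k ≢ j × G k (ranks k x) ≢ κ k)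
      not-single {x} g {j} ≢κ = resolve (FinP.any? (λ k → (¬? (k ≟ j)) ×-dec (¬? (G k (ranks k x) ≟ κ k))))
        where
        Witness : Set
        Witness = ∃[ k ] (k ≢ j × G k (ranks k x) ≢ κ k)
        module _ (none-other : ¬ Witness) where
          agree : ∀ k → k ≢ j → G k (ranks k x) ≡ κ k
          agree k k≢j = decidable-stable (G k (ranks k x) ≟ κ k) (λ ne → none-other (k , k≢j , ne))
          other : ∃[ i ] (j ≢ i × j ≢ i)
          other = third-name j j
          φ : Fin nb → Fin n → ℚ
          φ l k = δ _≟_ (G k (ranks k x)) l - δ _≟_ (κ k) l
          φ-agree : ∀ l k → k ≢ j → φ l k ≡ 0ℚ
          φ-agree l k k≢j = trans (cong (λ c → δ _≟_ c l - δ _≟_ (κ k) l) (agree k k≢j)) (+-inverseʳ (δ _≟_ (κ k) l))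
          φ≡0 : ∀ l → φ l j ≡ 0ℚ
          φ≡0 l = begin
            φ l j
              ≡⟨ sym (trans (cong (φ l j +_) (φ-agree l (proj₁ other) (proj₁ (proj₂ other) ∘ sym))) (+-identityʳ (φ l j))) ⟩
            φ l j + φ l (proj₁ other)
              ≡⟨ sym (∑-supported₂ (allFin-enumerates n) (proj₁ (proj₂ other)) (φ l) (λ k k≢j _ → φ-agree l k k≢j)) ⟩
            ∑ names (φ l)
              ≡⟨ ∑-- names _ _ ⟩
            ∑ names (λ k → δ _≟_ (G k (ranks k x)) l) - ∑ names (λ k → δ _≟_ (κ k) l)
              ≡⟨ cong₂ _-_ (good-count g l) (colour-count (f u) (λ a → δ _≟_ (b a) l)) ⟩
            ∑ names (λ a → δ _≟_ (b a) l) - ∑ names (λ a → δ _≟_ (b a) l)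
              ≡⟨ +-inverseʳ (∑ names (λ a → δ _≟_ (b a) l)) ⟩
            0ℚ ∎
            where open ≡-Reasoning
          balanced : ∀ l → δ _≟_ (G j (ranks j x)) l ≡ δ _≟_ (κ j) l
          balanced l = trans (move (δ _≟_ (G j (ranks j x)) l) (δ _≟_ (κ j) l)) (trans (cong (_+ δ _≟_ (κ j) l) (φ≡0 l)) (+-identityˡ (δ _≟_ (κ j) l)))
            where
            move : ∀ a b → a ≡ (a - b) + b
            move = solve-∀ ℚ-ring
        resolve : Dec Witness → Witness
        resolve (yes found)     = found
        resolve (no none-other) = contradiction (δ-determines _≟_ (balanced none-other)) ≢κ

      -- On a good profile W is 0 or at least 2, so W(W-2) is nonnegative. Elsewhere `bad x` is at
      -- least 1 and W² - 2W is never below -1.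
      2W≤ : ∀ x → W x + W x ≤ℚ W x * W x + bad x
      2W≤ x = cases (good? x)
        where
        Claim : Set
        Claim = W x + W x ≤ℚ W x * W x + bad x
        spread : ∀ {j k} → k ≢ j → G j (ranks j x) ≢ κ j → G k (ranks k x) ≢ κ k → Claim
        spread {j} {k} k≢j ≢κ ≢κ′ = ≤-slack (W x * (W x - 2ℚ) + bad x)
          (0≤+ (0≤* (0≤∑ names λ j → 0≤μ j (ranks j x)) (0≤sub 2≤W)) (0≤bad x)) (complete (W x) (bad x))
          where
          2≤W : 2ℚ ≤ℚ W x
          2≤W = subst (_≤ℚ W x) (cong₂ _+_ (dist-≢ _≟_ ≢κ′) (dist-≢ _≟_ ≢κ))
            (terms≤∑ (allFin-enumerates n) k≢j (λ j → 0≤μ j (ranks j x)))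
          complete : ∀ w β → w * w + β ≡ (w + w) + (w * (w - (1ℚ + 1ℚ)) + β)
          complete = solve-∀ ℚ-ring
        good-case : Good x → Dec (∀ j → G j (ranks j x) ≡ κ j) → Claim
        good-case g (yes all≡) = subst (λ w → w + w ≤ℚ w * w + bad x) (sym W≡0)
          (≤-trans (0≤bad x) (≤-reflexive (sym (+-identityˡ (bad x)))))
          where
          W≡0 : W x ≡ 0ℚ
          W≡0 = trans (∑-cong names λ j → dist-refl _≟_ (all≡ j)) (∑-0 names)
        good-case g (no ¬all) = differing (FinP.¬∀⟶∃¬ n _ (λ j → G j (ranks j x) ≟ κ j) ¬all)
          where
          differing : ∃[ j ] G j (ranks j x) ≢ κ j → Claim
          differing (j , ≢κ) = let k , k≢j , ≢κ′ = not-single g ≢κ in spread k≢j ≢κ ≢κ′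
        cases : Certain (Good x) (bad x) → Claim
        cases (inj₁ g) = good-case g (FinP.all? (λ j → G j (ranks j x) ≟ κ j))
        cases (inj₂ 1≤bad) = ≤-slack ((W x - 1ℚ) * (W x - 1ℚ) + (bad x - 1ℚ))
          (0≤+ (0≤sq (W x - 1ℚ)) (0≤sub 1≤bad)) (complete (W x) (bad x))
          where
          complete : ∀ w β → w * w + β ≡ (w + w) + ((w - 1ℚ) * (w - 1ℚ) + (β - 1ℚ))
          complete = solve-∀ ℚ-ring

      -- With X the mean of W²: 8M ≤ 4X + 4θ ≤ 4M² + 6M + 4θ ≤ 7M + 4θ. The last step is where the
      -- choice of a quarter is used, as it gives 4M² ≤ M.
      M≤4θ : M ≤ℚ (θ + θ) + (θ + θ)
      M≤4θ = ≤-slack (slack₁ + slack₂ + slack₃) (0≤+ (0≤+ (0≤sub step₁) (0≤sub step₂)) (0≤sub step₃)) (collect M θ X)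
        where
        X slack₁ slack₂ slack₃ : ℚ
        X = E V (λ x → W x * W x)
        slack₁ = (2ℚ + 2ℚ) * (X + θ) - (2ℚ + 2ℚ) * (M + M)
        slack₂ = 2ℚ * (2ℚ * (M * M) + 3ℚ * M) - 2ℚ * (2ℚ * X)
        slack₃ = M - (2ℚ + 2ℚ) * (M * M)
        step₁ : (2ℚ + 2ℚ) * (M + M) ≤ℚ (2ℚ + 2ℚ) * (X + θ)
        step₁ = *-monoˡ-≤ (0≤+ (0≤+ 0≤1 0≤1) (0≤+ 0≤1 0≤1)) (begin
          M + M                                 ≡⟨ cong₂ _+_ (sym E-W) (sym E-W) ⟩
          E V W + E V W                         ≡⟨ sym (E-+ V W W) ⟩
          E V (λ x → W x + W x)                 ≤⟨ E-mono V 2W≤ ⟩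
          E V (λ x → W x * W x + bad x)         ≡⟨ E-+ V _ _ ⟩
          X + E V bad                           ≤⟨ +-monoʳ-≤ X bad≤ ⟩
          X + θ                                 ∎)
          where open ≤-Reasoning
        step₂ : 2ℚ * (2ℚ * X) ≤ℚ 2ℚ * (2ℚ * (M * M) + 3ℚ * M)
        step₂ = *-monoˡ-≤ (0≤+ 0≤1 0≤1) second-moment
        step₃ : (2ℚ + 2ℚ) * (M * M) ≤ℚ M
        step₃ = ≤-trans (*-monoˡ-≤ (0≤+ (0≤+ 0≤1 0≤1) (0≤+ 0≤1 0≤1)) (*-monoˡ-≤ 0≤M M≤¼)) (≤-reflexive (trans (four-quarters M quarter) (trans (cong (M *_) quarters) (*-identityʳ M))))
          where
          four-quarters : ∀ M q → ((1ℚ + 1ℚ) + (1ℚ + 1ℚ)) * (M * q) ≡ M * ((q + q) + (q + q))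
          four-quarters = solve-∀ ℚ-ring
        collect : ∀ M θ X → (θ + θ) + (θ + θ) ≡ M +
          ((((1ℚ + 1ℚ) + (1ℚ + 1ℚ)) * (X + θ) - ((1ℚ + 1ℚ) + (1ℚ + 1ℚ)) * (M + M)) +
          ((1ℚ + 1ℚ) * ((1ℚ + 1ℚ) * (M * M) + ((1ℚ + 1ℚ) + 1ℚ) * M) - (1ℚ + 1ℚ) * ((1ℚ + 1ℚ) * X)) +
          (M - ((1ℚ + 1ℚ) + (1ℚ + 1ℚ)) * (M * M)))
        collect = solve-∀ ℚ-ring

      near-constant-at : error (const (f u)) ≤ℚ θ + ((θ + θ) + (θ + θ))
      near-constant-at = begin
        E V (λ x → ∑ names (λ j → d (colour x j) (κ j)))
          ≤⟨ E-mono V (λ x → ∑-mono names λ j → dist-triangle _≟_ (colour x j) (G j (ranks j x)) (κ j)) ⟩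
        E V (λ x → ∑ names (λ j → d (colour x j) (G j (ranks j x)) + μ j (ranks j x)))
          ≡⟨ trans (E-cong V λ x → ∑-+ names _ _) (E-+ V bad W) ⟩
        E V bad + E V W
          ≤⟨ +-mono-≤ bad≤ (≤-trans (≤-reflexive E-W) M≤4θ) ⟩
        θ + ((θ + θ) + (θ + θ)) ∎
        where open ≤-Reasoning

    near-constant : ∃[ h ] error h ≤ℚ θ + ((θ + θ) + (θ + θ))
    near-constant =
      let u , le = E-attained V (λ u → Q₁ u + bad u) in const (f u) , near-constant-at u (≤-trans le E-Q)

-- Near-dictatorial colourings

eight : ℚ
eight = (2ℚ + 2ℚ) + (2ℚ + 2ℚ)

0≤eight : 0ℚ ≤ℚ eight
0≤eight = 0≤+ {2ℚ + 2ℚ} (0≤+ {2ℚ} (0≤+ 0≤1 0≤1) (0≤+ 0≤1 0≤1)) (0≤+ {2ℚ} (0≤+ 0≤1 0≤1) (0≤+ 0≤1 0≤1))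

eight*eighth : eight * eighth ≡ 1ℚ
eight*eighth = trans (spread eighth) (trans (cong₂ _+_ (cong₂ _+_ eighth+eighth eighth+eighth) (cong₂ _+_ eighth+eighth eighth+eighth)) quarters)
  where
  spread : ∀ e → (((1ℚ + 1ℚ) + (1ℚ + 1ℚ)) + ((1ℚ + 1ℚ) + (1ℚ + 1ℚ))) * e ≡ ((e + e) + (e + e)) + ((e + e) + (e + e))
  spread = solve-∀ ℚ-ring

module _ (N L : ℚ) where

  -- `Z-factor` is `Z-bound` divided by θ, with D = 8N · 96 for the dependence on the decisive
  -- voter. `factor` adds one summand for each case of `core`: 5 near a constant, 8N for large θ,
  -- `Z-factor` near a dictator, and N L times it when the single-voter argument is out of reach. A
  -- sum dominates each of them.
  Z-factor factor : ℚ
  Z-factor = ((1ℚ + N * (((D + D) + 2ℚ) + ((D + D) + 2ℚ))) + 1ℚ) + 1ℚ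
    where
    D : ℚ
    D = (eight * N) * ((((eight + eight) + eight) + ((eight + eight) + eight)) + (((eight + eight) + eight) + ((eight + eight) + eight)))
  factor = ((1ℚ + (2ℚ + 2ℚ)) + N * eight) + (Z-factor + N * (L * Z-factor))

  module _ (0≤N : 0ℚ ≤ℚ N) where

    0≤Z-factor : 0ℚ ≤ℚ Z-factor
    0≤Z-factor = 0≤+ (0≤+ (0≤+ 0≤1 (0≤* 0≤N (0≤+ 0≤D 0≤D))) 0≤1) 0≤1
      where
      0≤24 : 0ℚ ≤ℚ (eight + eight) + eight
      0≤24 = 0≤+ (0≤+ 0≤eight 0≤eight) 0≤eight
      0≤96 : 0ℚ ≤ℚ (eight * N) * ((((eight + eight) + eight) + ((eight + eight) + eight)) + (((eight + eight) + eight) + ((eight + eight) + eight)))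
      0≤96 = 0≤* (0≤* 0≤eight 0≤N) (0≤+ (0≤+ 0≤24 0≤24) (0≤+ 0≤24 0≤24))
      0≤D : 0ℚ ≤ℚ ((eight * N) * ((((eight + eight) + eight) + ((eight + eight) + eight)) + (((eight + eight) + eight) + ((eight + eight) + eight)))
        + (eight * N) * ((((eight + eight) + eight) + ((eight + eight) + eight)) + (((eight + eight) + eight) + ((eight + eight) + eight)))) + 2ℚ
      0≤D = 0≤+ (0≤+ 0≤96 0≤96) (0≤+ 0≤1 0≤1)

module Dictatorial {m′ nb v : ℕ} (b : Fin (3 ℕ.+ m′) → Fin nb) (f : Vec (Perm (3 ℕ.+ m′)) v → Perm (3 ℕ.+ m′))
  (G : Fin (3 ℕ.+ m′) → Vec (Fin (3 ℕ.+ m′)) v → Fin nb) where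

  open Cases {m′} {nb} {v} b f G public

  only : Fin v → Mask v
  only i k = does (k ≟ i)

  module SingleVoter (u : Vec (Perm n) v) (i : Fin v) (good-at : ∀ p → Good (u [ i ]≔ p)) where

    ψ : Fin n → Fin n → Fin nb
    ψ j a = G j (ranks j u [ i ]≔ a)

    colour-ψ : ∀ p j → colour (u [ i ]≔ p) j ≡ ψ j (rank p j)
    colour-ψ p j = trans (good-at p j) (cong (G j) (mapᵢ-[]≔ (λ p → rank p j) u i p))

    sel-but : ∀ {A : Set} (r s : Vec A v) → sel (not ∘ only i) r s ≡ r [ i ]≔ lookup s i
    sel-but r s = trans (sel-not (only i) r s) (sel-single i s r)

    -- `exchange` off the complement of `only i` swaps j and k on the ballot of i alone. The swapped
    -- profile is again u with another ballot at i, hence good by assumption, so the identity is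
    -- exact.
    swap-ψ : ∀ p {j k} → j ≢ k → SamePair (ψ j (rank p j)) (ψ k (rank p k)) (ψ j (rank p k)) (ψ k (rank p j))
    swap-ψ p {j} {k} j≢k = subst₂ (λ r s → SamePair (G j r) (G k s) (ψ j (rank p k)) (ψ k (rank p j)))
      (ranks-at j) (ranks-at k)
      (subst₂ (λ r s → SamePair (G j (ranks j x)) (G k (ranks k x)) (G j r) (G k s)) (mixed j k) (mixed k j)
        (δ-sums⇒SamePair _≟_ (exchange j≢k (not ∘ only i) x (good-at p) (subst Good (sym swapped) (good-at (lookup y i))))))
      where
      x y : Vec (Perm n) v
      x = u [ i ]≔ p
      y = mapᵢ (λ _ → swapNames j k) x
      ranks-at : ∀ l → ranks l x ≡ ranks l u [ i ]≔ rank p l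
      ranks-at l = mapᵢ-[]≔ (λ p → rank p l) u i p
      swapped : swapOff (not ∘ only i) j k x ≡ u [ i ]≔ lookup y i
      swapped = trans (mapᵢ-if (not ∘ only i) (λ p → p) (swapNames j k) x)
        (trans (cong (λ z → sel (not ∘ only i) z y) (mapᵢ-id x)) (trans (sel-but x y) (VecP.[]≔-idempotent u i)))
      mixed : ∀ j k → sel (not ∘ only i) (ranks j x) (ranks k x) ≡ ranks j u [ i ]≔ rank p k
      mixed j k = trans (sel-but (ranks j x) (ranks k x)) (trans (cong₂ (λ r a → r [ i ]≔ a) (ranks-at j)
        (trans (lookup-mapᵢ (λ _ p → rank p k) x i) (cong (λ p → rank p k) (VecP.lookup∘updateAt i u))))
        (VecP.[]≔-idempotent (ranks j u) i))

    Agrees : Simple n v → Set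
    Agrees h = ∀ x j → simpleColour h x j ≡ colour (u [ i ]≔ lookup x i) j

    -- The identity ballot gives name j rank j, so `y₀` colours j by `ψ j j`. Names serve as ranks
    -- here, which is why the same `y₀` is the constant output and also the rearrangement applied by
    -- the dictator.
    y₀ : Perm n
    y₀ = f (u [ i ]≔ identity)

    y₀-colour : ∀ j → b (rank y₀ j) ≡ ψ j j
    y₀-colour j = trans (colour-ψ identity j) (cong (ψ j) (rank-identity j))

    Varying : Set
    Varying = ∃[ j ] ∃[ a ] ∃[ a′ ] ψ j a ≢ ψ j a′

    varying? : Dec Varying
    varying? = FinP.any? λ j → FinP.any? λ a → FinP.any? λ a′ → ¬? (ψ j a ≟ ψ j a′)

    constant-agrees : ¬ Varying → Agrees (const y₀)
    constant-agrees ¬varying x j = trans (y₀-colour j) (trans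
      (decidable-stable (ψ j j ≟ ψ j (rank (lookup x i) j)) (λ ne → ¬varying (j , j , rank (lookup x i) j , ne)))
      (sym (colour-ψ (lookup x i) j)))

    -- Giving k a rank a′ with ψ j a′ ≢ ψ j a forces ψ k a = ψ j a.
    dictator-agrees : Varying → Agrees (dictator i y₀)
    dictator-agrees (j , a₁ , a₂ , ψ₁≢ψ₂) x k = begin
      b (rank y₀ (rank (lookup x i) k))
        ≡⟨ y₀-colour (rank (lookup x i) k) ⟩
      ψ (rank (lookup x i) k) (rank (lookup x i) k)
        ≡⟨ common (rank (lookup x i) k) (rank (lookup x i) k) ⟩
      ψ j (rank (lookup x i) k)
        ≡⟨ sym (common k (rank (lookup x i) k)) ⟩
      ψ k (rank (lookup x i) k)
        ≡⟨ sym (colour-ψ (lookup x i) k) ⟩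
      colour (u [ i ]≔ lookup x i) k ∎
      where
      open ≡-Reasoning
      contrast : ∀ a → ∃[ a′ ] ψ j a ≢ ψ j a′
      contrast a = choose (ψ j a ≟ ψ j a₁)
        where
        choose : Dec (ψ j a ≡ ψ j a₁) → ∃[ a′ ] ψ j a ≢ ψ j a′
        choose (yes eq) = a₂ , λ eq′ → ψ₁≢ψ₂ (trans (sym eq) eq′)
        choose (no ne)  = a₁ , ne
      common : ∀ l a → ψ l a ≡ ψ j a
      common l a = same (j ≟ l)
        where
        same : Dec (j ≡ l) → ψ l a ≡ ψ j a
        same (yes refl) = refl
        same (no j≢l)   =
          let a′ , ne = contrast a
              p , pj , pl = two-ranks m {j} {l} {a} {a′} j≢l (λ a≡a′ → ne (cong (ψ j) a≡a′))
          in conclude ne (subst₂ (λ r s → SamePair (ψ j r) (ψ l s) (ψ j s) (ψ l r)) pj pl (swap-ψ p j≢l))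
          where
          conclude : ∀ {a′} → ψ j a ≢ ψ j a′ → SamePair (ψ j a) (ψ l a′) (ψ j a′) (ψ l a) → ψ l a ≡ ψ j a
          conclude ne (inj₁ (eq , _)) = contradiction eq ne
          conclude ne (inj₂ (eq , _)) = sym eq

    single-voter : ∃[ h ] Agrees h
    single-voter = resolve varying?
      where
      resolve : Dec Varying → ∃[ h ] Agrees h
      resolve (yes varying) = dictator i y₀ , dictator-agrees varying
      resolve (no ¬varying) = const y₀ , constant-agrees ¬varying

  module _ (θ : ℚ) (0≤θ : 0ℚ ≤ℚ θ) (bad≤ : E V bad ≤ℚ θ) where

    module Localised (i : Fin v) (D : ℚ) (dep≤D : ∀ j → dep j (only i) ≤ℚ D) where

      -- The summands bound the badness of x, the change of `G` over all names, and the badness of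
      -- the mixed profile, which is counted twice: once inside `moved` and once as the second term
      -- of `Q₂`.
      Z : ℚ
      Z = ((θ + N * D) + θ) + θ

      moved : Vec (Perm n) v → Vec (Perm n) v → ℚ
      moved u x = ∑ names (λ j → d (colour x j) (colour (sel (only i) x u) j))

      0≤moved : ∀ u x → 0ℚ ≤ℚ moved u x
      0≤moved u x = 0≤∑ names λ j → 0≤dist _≟_ (colour x j) (colour (sel (only i) x u) j)

      -- The first term becomes the final error, the second makes u good at every ballot of voter i;
      -- a single u must serve both.
      Q₂ : Vec (Perm n) v → ℚ
      Q₂ u = E V (λ x → moved u x + bad (sel (only i) x u))

      E-bad-sel : E V (λ x → E V (λ u → bad (sel (only i) x u))) ≤ℚ θ
      E-bad-sel = ≤-trans (≤-reflexive (E-sel P (only i) bad)) bad≤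

      dep-ranks : ∀ j → E V (λ x → E V (λ u → d (G j (ranks j x)) (G j (ranks j (sel (only i) x u))))) ≡ dep j (only i)
      dep-ranks j = trans (E-cong V λ x → trans
          (E-cong V λ u → cong (λ r → d (G j (ranks j x)) (G j r)) (mapᵢ-sel (only i) (λ p → rank p j) x u))
          (ranks-uniform j (λ s → d (G j (ranks j x)) (G j (sel (only i) (ranks j x) s)))))
        (ranks-uniform j (λ r → E R (λ s → d (G j r) (G j (sel (only i) r s)))))

      moved≤ : ∀ x u → moved u x ≤ℚ
        (bad x + ∑ names (λ j → d (G j (ranks j x)) (G j (ranks j (sel (only i) x u))))) + bad (sel (only i) x u)
      moved≤ x u = ≤-trans
        (∑-mono names λ j → ≤-trans (dist-triangle _≟_ (colour x j) (G j (ranks j w)) (colour w j))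
          (+-mono-≤ (dist-triangle _≟_ (colour x j) (G j (ranks j x)) (G j (ranks j w)))
            (≤-reflexive (dist-sym _≟_ (G j (ranks j w)) (colour w j)))))
        (≤-reflexive (trans (∑-+ names _ _) (cong (_+ bad w) (∑-+ names _ _))))
        where
        w : Vec (Perm n) v
        w = sel (only i) x u

      E-Q₂ : E V Q₂ ≤ℚ Z
      E-Q₂ = begin
        E V (λ u → E V (λ x → moved u x + bad (sel (only i) x u)))
          ≡⟨ E-swap V V _ ⟩
        E V (λ x → E V (λ u → moved u x + bad (sel (only i) x u)))
          ≤⟨ E-mono V (λ x → E-mono V λ u → +-monoˡ-≤ (bad (sel (only i) x u)) (moved≤ x u)) ⟩
        E V (λ x → E V (λ u → ((bad x + dG x u) + bad (sel (only i) x u)) + bad (sel (only i) x u)))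
          ≡⟨ trans (E-cong V λ x → trans (E-+ V _ _) (cong (_+ Bs x) (trans (E-+ V _ _) (cong (_+ Bs x) (trans (E-+ V _ _)
               (cong (_+ E V (dG x)) (E-const V (bad x)))))))) (trans (E-+ V _ _) (cong (_+ E V Bs) (trans (E-+ V _ _) (cong (_+ E V Bs) (E-+ V _ _))))) ⟩
        ((E V bad + E V (λ x → E V (dG x))) + E V Bs) + E V Bs
          ≤⟨ +-mono-≤ (+-mono-≤ (+-mono-≤ bad≤ E-dG) E-bad-sel) E-bad-sel ⟩
        Z ∎
        where
        open ≤-Reasoning
        dG : Vec (Perm n) v → Vec (Perm n) v → ℚ
        dG x u = ∑ names (λ j → d (G j (ranks j x)) (G j (ranks j (sel (only i) x u))))
        Bs : Vec (Perm n) v → ℚ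
        Bs x = E V (λ u → bad (sel (only i) x u))
        E-dG : E V (λ x → E V (dG x)) ≤ℚ N * D
        E-dG = ≤-trans (≤-reflexive (trans (E-cong V λ x → E-∑ V names _) (trans (E-∑ V names _) (∑-cong names dep-ranks))))
          (≤-trans (∑-mono names dep≤D) (≤-reflexive (∑-const-fins n D)))

      -- At the chosen u the mean badness over the ballot of i is at most `Z`. Each ballot carries
      -- mass 1/L, so a bad one would force L Z ≥ 1.
      localised : ¬ (1ℚ ≤ℚ L * Z) → ∃[ h ] error h ≤ℚ Z
      localised ¬1≤LZ =
        let u , le = E-attained V Q₂
            h , agrees = SingleVoter.single-voter u i (good-at u (≤-trans le E-Q₂))
        in h , ≤-trans (error≤ u h agrees) (≤-trans le E-Q₂)
        where
        good-at : ∀ u → Q₂ u ≤ℚ Z → ∀ p → Good (u [ i ]≔ p)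
        good-at u Q₂≤Z p = resolve (good? (u [ i ]≔ p))
          where
          bad-at : Perm n → ℚ
          bad-at p = bad (u [ i ]≔ p)
          E-bad-at : E P bad-at ≤ℚ Z
          E-bad-at = ≤-trans (≤-reflexive (trans (sym (E-lookup P i bad-at)) (E-cong V λ x → cong bad (sym (sel-single i x u)))))
            (≤-trans (E-mono V λ x → ≤-slack (moved u x) (0≤moved u x) (+-comm (moved u x) (bad (sel (only i) x u)))) Q₂≤Z)
          resolve : Certain (Good (u [ i ]≔ p)) (bad (u [ i ]≔ p)) → Good (u [ i ]≔ p)
          resolve (inj₁ g)     = g
          resolve (inj₂ 1≤bad) = contradiction (≤-trans 1≤bad (≤-trans
            (term≤∑ (allPerms-enumerates n) (λ p → 0≤bad (u [ i ]≔ p)) p)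
            (≤-trans (≤-reflexive (sym (E-total P bad-at))) (*-monoˡ-≤ (0≤ℕtoℚ (length (allPerms n))) E-bad-at)))) ¬1≤LZ
        error≤ : ∀ u h → (∀ x j → simpleColour h x j ≡ colour (u [ i ]≔ lookup x i) j) → error h ≤ℚ Q₂ u
        error≤ u h agrees = E-mono V λ x → ≤-trans
          (≤-reflexive (∑-cong names λ j → cong (d (colour x j)) (trans (agrees x j) (cong (λ w → colour w j) (sym (sel-single i x u))))))
          (≤-slack (bad (sel (only i) x u)) (0≤bad (sel (only i) x u)) refl)

    module NearDictator (i₀ : Fin v) (j₀ : Fin n) (c≤ : c ≤ℚ dep j₀ none) where

      private
        module D₀ = Dependence (fins m) _≟_ (G j₀)
        ρ : ℚ
        ρ = 8θ bad≤

        0≤ρ : 0ℚ ≤ℚ ρ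
        0≤ρ = 0≤+ 0≤4θ 0≤4θ
          where
          0≤4θ : 0ℚ ≤ℚ 4θ bad≤
          0≤4θ = 0≤+ (0≤+ 0≤θ 0≤θ) (0≤+ 0≤θ 0≤θ)

        defects : ∀ S → D₀.rectangleDefect S ≤ℚ ρ
        defects S =
          let k , j≢k , _ = third-name j₀ j₀
              i , j≢i , k≢i = third-name j₀ k
          in rectangleDefect≤ bad≤ j≢k j≢i k≢i S

      scale : ℚ
      scale = eight * N

      0≤scale : 0ℚ ≤ℚ scale
      0≤scale = 0≤* 0≤eight 0≤N

      scale-c : scale * c ≡ 1ℚ
      scale-c = trans (shuffle eight N (recip n) eighth) (trans (cong₂ _*_ (recip-inverse m) eight*eighth) (*-identityˡ 1ℚ))
        where
        shuffle : ∀ a b c d → (a * b) * (c * d) ≡ (b * c) * (a * d)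
        shuffle = solve-∀ ℚ-ring

      -- `96θ` is twelve times ρ = 8θ, the output of `essential-coordinate`; `scale` is 1/c and
      -- removes its factor `c`; `D-bound` is what `dependence-transfer` then gives for the other
      -- names.
      96θ D₀-bound D-bound : ℚ
      96θ = (((ρ + ρ) + ρ) + ((ρ + ρ) + ρ)) + (((ρ + ρ) + ρ) + ((ρ + ρ) + ρ))
      D₀-bound = scale * 96θ
      D-bound = ((D₀-bound + D₀-bound) + 2θ bad≤) + ((D₀-bound + D₀-bound) + 2θ bad≤)

      essential : ∃[ i ] D₀.dependence (only i) * c ≤ℚ 96θ
      essential = D₀.essential-coordinate defects c≤ 0≤c 0≤ρ i₀

      module _ (i : Fin v) (essential-i : D₀.dependence (only i) * c ≤ℚ 96θ) where

        dep₀≤ : dep j₀ (only i) ≤ℚ D₀-bound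
        dep₀≤ = ≤-trans (≤-reflexive (trans (sym (*-identityˡ _)) (trans (cong (_* dep j₀ (only i)) (sym scale-c))
          (rotate scale c (dep j₀ (only i)))))) (*-monoˡ-≤ 0≤scale essential-i)
          where
          rotate : ∀ a b c → (a * b) * c ≡ a * (c * b)
          rotate = solve-∀ ℚ-ring

        dep≤ : ∀ j → dep j (only i) ≤ℚ D-bound
        dep≤ j = resolve (j ≟ j₀)
          where
          0≤D₀ : 0ℚ ≤ℚ D₀-bound
          0≤D₀ = ≤-trans (D₀.0≤dependence (only i)) dep₀≤
          0≤2θ : 0ℚ ≤ℚ 2θ bad≤
          0≤2θ = 0≤+ 0≤θ 0≤θ
          split : ∀ a t → ((a + a) + t) + ((a + a) + t) ≡ a + ((a + t) + ((a + a) + t))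
          split = solve-∀ ℚ-ring
          resolve : Dec (j ≡ j₀) → dep j (only i) ≤ℚ D-bound
          resolve (yes refl) = ≤-trans dep₀≤ (≤-slack _ (0≤+ (0≤+ 0≤D₀ 0≤2θ) (0≤+ (0≤+ 0≤D₀ 0≤D₀) 0≤2θ)) (split D₀-bound (2θ bad≤)))
          resolve (no j≢j₀)  =
            let h , j≢h , j₀≢h = third-name j j₀
            in ≤-trans (dependence-transfer bad≤ j≢j₀ j≢h j₀≢h (only i))
              (+-mono-≤ (+-monoˡ-≤ (2θ bad≤) (+-mono-≤ dep₀≤ dep₀≤)) (+-monoˡ-≤ (2θ bad≤) (+-mono-≤ dep₀≤ dep₀≤)))

      Z-bound : ℚ
      Z-bound = ((θ + N * D-bound) + θ) + θ

      Z-linear : Z-bound ≡ Z-factor N L * θ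
      Z-linear = trans (cong (λ t → ((θ + N * (((scale * t + scale * t) + (θ + θ)) + ((scale * t + scale * t) + (θ + θ)))) + θ) + θ)
          (trans (cong (λ r → (((r + r) + r) + ((r + r) + r)) + (((r + r) + r) + ((r + r) + r))) (8-fold θ)) (12-fold eight θ)))
        (outer N scale ((((eight + eight) + eight) + ((eight + eight) + eight)) + (((eight + eight) + eight) + ((eight + eight) + eight))) θ)
        where
        8-fold : ∀ θ → ((θ + θ) + (θ + θ)) + ((θ + θ) + (θ + θ)) ≡ (((1ℚ + 1ℚ) + (1ℚ + 1ℚ)) + ((1ℚ + 1ℚ) + (1ℚ + 1ℚ))) * θ
        8-fold = solve-∀ ℚ-ring
        12-fold : ∀ e θ → ((((e * θ + e * θ) + e * θ) + ((e * θ + e * θ) + e * θ)) + (((e * θ + e * θ) + e * θ) + ((e * θ + e * θ) + e * θ))) ≡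
          ((((e + e) + e) + ((e + e) + e)) + (((e + e) + e) + ((e + e) + e))) * θ
        12-fold = solve-∀ ℚ-ring
        outer : ∀ N S x θ →
          ((θ + N * (((S * (x * θ) + S * (x * θ)) + (θ + θ)) + ((S * (x * θ) + S * (x * θ)) + (θ + θ)))) + θ) + θ ≡
          (((1ℚ + N * (((S * x + S * x) + (1ℚ + 1ℚ)) + ((S * x + S * x) + (1ℚ + 1ℚ)))) + 1ℚ) + 1ℚ) * θ
        outer = solve-∀ ℚ-ring

      near-dictator : ¬ (1ℚ ≤ℚ L * Z-bound) → ∃[ h ] error h ≤ℚ Z-bound
      near-dictator = let i , essential-i = essential in Localised.localised i D-bound (dep≤ i essential-i)

  -- Combining the near-constant and the near-dictatorial case

  module _ (θ : ℚ) (0≤θ : 0ℚ ≤ℚ θ) (bad≤ : E V bad ≤ℚ θ) where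

    private
      Z₁ K : ℚ
      Z₁ = Z-factor N L
      K = factor N L

      0≤L : 0ℚ ≤ℚ L
      0≤L = 0≤ℕtoℚ (length (allPerms n))

      0≤Z₁ : 0ℚ ≤ℚ Z₁
      0≤Z₁ = 0≤Z-factor N L 0≤N

      0≤NLZ₁ : 0ℚ ≤ℚ N * (L * Z₁)
      0≤NLZ₁ = 0≤* 0≤N (0≤* 0≤L 0≤Z₁)

      0≤5 : 0ℚ ≤ℚ 1ℚ + (2ℚ + 2ℚ)
      0≤5 = 0≤+ 0≤1 (0≤+ {2ℚ} (0≤+ 0≤1 0≤1) (0≤+ 0≤1 0≤1))

      0≤8N : 0ℚ ≤ℚ N * eight
      0≤8N = 0≤* 0≤N 0≤eight

      weaken : ∀ a s → 0ℚ ≤ℚ s → K ≡ a + s → a * θ ≤ℚ K * θ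
      weaken a s 0≤s eq = *-monoʳ-≤ {θ} {a} {K} 0≤θ (≤-slack {a} s 0≤s eq)

    -- When θ exceeds 1/8 or L times `Z-bound` reaches 1, the trivial bound `error≤N` is already
    -- linear in θ and any constant serves. Otherwise the two structural cases are told apart by
    -- whether some `dep j none` reaches `c`.
    core : Fin v → ∃[ h ] error h ≤ℚ K * θ
    core i₀ = by-size (θ ≤? eighth)
      where
      by-case : θ ≤ℚ eighth → Dec (∃[ j ] c ≤ℚ dep j none) → ∃[ h ] error h ≤ℚ K * θ
      by-case θ≤ (no ¬c≤) =
        let h , le = NearConstant.near-constant θ bad≤ θ≤ (λ j → <⇒≤ (≰⇒> λ c≤ → ¬c≤ (j , c≤)))
        in h , ≤-trans le (≤-trans (≤-reflexive (five θ)) (weaken (1ℚ + (2ℚ + 2ℚ)) (N * eight + (Z₁ + N * (L * Z₁)))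
             (0≤+ 0≤8N (0≤+ 0≤Z₁ 0≤NLZ₁)) (+-assoc (1ℚ + (2ℚ + 2ℚ)) (N * eight) (Z₁ + N * (L * Z₁)))))
        where
        five : ∀ θ → θ + ((θ + θ) + (θ + θ)) ≡ (1ℚ + ((1ℚ + 1ℚ) + (1ℚ + 1ℚ))) * θ
        five = solve-∀ ℚ-ring
      by-case θ≤ (yes (j₀ , c≤)) = by-mass (1ℚ ≤? L * Z-bound)
        where
        open NearDictator θ 0≤θ bad≤ i₀ j₀ c≤
        by-mass : Dec (1ℚ ≤ℚ L * Z-bound) → ∃[ h ] error h ≤ℚ K * θ
        by-mass (no ¬1≤LZ) =
          let h , le = near-dictator ¬1≤LZ
          in h , ≤-trans le (≤-trans (≤-reflexive Z-linear) (weaken Z₁ (((1ℚ + (2ℚ + 2ℚ)) + N * eight) + N * (L * Z₁)) (0≤+ (0≤+ 0≤5 0≤8N) 0≤NLZ₁)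
               (move ((1ℚ + (2ℚ + 2ℚ)) + N * eight) Z₁ (N * (L * Z₁)))))
          where
          move : ∀ a b c → a + (b + c) ≡ b + (a + c)
          move = solve-∀ ℚ-ring
        by-mass (yes 1≤LZ) = const identity , (begin
          error (const identity)   ≤⟨ error≤N (const identity) ⟩
          N                        ≡⟨ sym (*-identityʳ N) ⟩
          N * 1ℚ                   ≤⟨ *-monoˡ-≤ 0≤N 1≤LZ ⟩
          N * (L * Z-bound)        ≡⟨ cong (λ z → N * (L * z)) Z-linear ⟩
          N * (L * (Z₁ * θ))       ≡⟨ reassociate N L Z₁ θ ⟩
          (N * (L * Z₁)) * θ       ≤⟨ weaken (N * (L * Z₁)) (((1ℚ + (2ℚ + 2ℚ)) + N * eight) + Z₁) (0≤+ (0≤+ 0≤5 0≤8N) 0≤Z₁)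
                                      (move ((1ℚ + (2ℚ + 2ℚ)) + N * eight) Z₁ (N * (L * Z₁))) ⟩
          K * θ                    ∎)
          where
          open ≤-Reasoning
          reassociate : ∀ a b c d → a * (b * (c * d)) ≡ (a * (b * c)) * d
          reassociate = solve-∀ ℚ-ring
          move : ∀ a b c → a + (b + c) ≡ c + (a + b)
          move = solve-∀ ℚ-ring
      by-size : Dec (θ ≤ℚ eighth) → ∃[ h ] error h ≤ℚ K * θ
      by-size (yes θ≤) = by-case θ≤ (FinP.any? λ j → c ≤? dep j none)
      by-size (no θ≰)  = const identity , (begin
        error (const identity)   ≤⟨ error≤N (const identity) ⟩
        N                        ≡⟨ sym (trans (cong (N *_) eight*eighth) (*-identityʳ N)) ⟩
        N * (eight * eighth)     ≤⟨ *-monoˡ-≤ 0≤N (*-monoˡ-≤ 0≤eight (<⇒≤ (≰⇒> θ≰))) ⟩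
        N * (eight * θ)          ≡⟨ sym (*-assoc N eight θ) ⟩
        (N * eight) * θ          ≤⟨ weaken (N * eight) ((1ℚ + (2ℚ + 2ℚ)) + (Z₁ + N * (L * Z₁))) (0≤+ 0≤5 (0≤+ 0≤Z₁ 0≤NLZ₁))
                                    (move (1ℚ + (2ℚ + 2ℚ)) (N * eight) (Z₁ + N * (L * Z₁))) ⟩
        K * θ                    ∎)
        where
        open ≤-Reasoning
        move : ∀ a b c → (a + b) + c ≡ b + (a + c)
        move = solve-∀ ℚ-ring

-- Profile and Frobenius distances in terms of block colours

𝔼-E : ∀ {A : Set} (s : Space A) φ → 𝔼 (Space.elements s) φ ≡ E s φ
𝔼-E s φ = trans (cong (_* recip (length (Space.elements s))) (sym (∑-def (Space.elements s) φ))) (sym (E-def s φ))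

indicator-δ : ∀ {m} (a c : Fin m) → indicator a c ≡ δ _≟_ a c
indicator-δ a c with a ≟ c
... | yes a≡c = sym (δ-refl _≟_ a≡c)
... | no  a≢c = sym (δ-≢ _≟_ a≢c)

enumerates⇒∈ : ∀ {A : Set} {_≟ᴬ_ : DecidableEquality A} {L} → Enumerates _≟ᴬ_ L → ∀ a → a ∈ L
enumerates⇒∈ {A} {_≟ᴬ_} {L} enum a = search L λ eq → 1≢0 (trans (sym (enum a)) eq)
  where
  search : ∀ M → ∑ M (λ x → δ _≟ᴬ_ x a) ≢ 0ℚ → a ∈ M
  search []      ne = contradiction (∑-[] _) ne
  search (x ∷ M) ne with x ≟ᴬ a
  ... | yes refl = here refl
  ... | no  x≢a  = there (search M λ eq → ne (trans (∑-∷ x M _) (cong₂ _+_ (δ-≢ _≟ᴬ_ x≢a) eq)))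

length-∈ : ∀ {A : Set} {a : A} {L} → a ∈ L → ∃[ k ] length L ≡ suc k
length-∈ {L = _ ∷ L} _ = length L , refl

module _ {m nb : ℕ} (b : Fin m → Fin nb) where

  private
    names : List (Fin m)
    names = allFin m
    H : List (Perm m)
    H = Hlist b
    h w : ℚ
    h = ℕtoℚ (∣H∣ b)
    w = recip (∣H∣ b)
    d : Fin nb → Fin nb → ℚ
    d = dist _≟_
    N : ℚ
    N = ℕtoℚ m

  BlockPreserving : Perm m → Set
  BlockPreserving p = ∀ a → b (⟦ p ⟧ a) ≡ b a

  blockPreserving? : ∀ p → Dec (BlockPreserving p)
  blockPreserving? p = FinP.all? λ a → b (⟦ p ⟧ a) ≟ b a

  ⟦identity⟧ : ∀ a → ⟦ identity {m} ⟧ a ≡ a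
  ⟦identity⟧ a = trans (cong ⟦ identity ⟧ (sym (rank-identity a))) (⟦⟧-rank identity a)

  identity∈H : identity ∈ H
  identity∈H = ∈-filter⁺ blockPreserving? (enumerates⇒∈ (allPerms-enumerates m) identity) (λ a → cong b (⟦identity⟧ a))

  h*w : h * w ≡ 1ℚ
  h*w = recip-inverse-≡ (proj₂ (length-∈ identity∈H))

  preimage-∘ : ∀ (y p : Perm m) j → preimage (λ a → ⟦ y ⟧ (⟦ p ⟧ a)) j ≡ rank p (rank y j)
  preimage-∘ y p j = sym (rank-unique p (sym (rank-unique y (preimage-correct (λ a → ⟦ y ⟧ (⟦ p ⟧ a)) (rank p (rank y j) ,
    trans (cong ⟦ y ⟧ (⟦⟧-rank p (rank y j))) (⟦⟧-rank y j))))))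

  ∈jProfile : ∀ y j → rank y j ∈ jProfile b ⟦ y ⟧ j
  ∈jProfile y j = subst (_∈ jProfile b ⟦ y ⟧ j) (trans (preimage-∘ y identity j) (rank-identity (rank y j)))
    (∈-map⁺ (λ z → preimage z j) (∈-map⁺ (λ p a → ⟦ y ⟧ (⟦ p ⟧ a)) identity∈H))

  jProfile-block : ∀ y j {a} → a ∈ jProfile b ⟦ y ⟧ j → b a ≡ b (rank y j)
  jProfile-block y j {a} a∈ =
    let z , z∈ , a≡ = ∈-map⁻ (λ z → preimage z j) a∈
        p , p∈ , z≡ = ∈-map⁻ (λ p a → ⟦ y ⟧ (⟦ p ⟧ a)) z∈
        block = proj₂ (∈-filter⁻ blockPreserving? {xs = allPerms m} p∈)
        a≡rank = trans a≡ (trans (cong (λ z → preimage z j) z≡) (preimage-∘ y p j))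
    in trans (cong b a≡rank) (trans (sym (block (rank p (rank y j)))) (cong b (⟦⟧-rank p (rank y j))))

  count-∈ : ∀ {a : Fin m} {S} → a ∈ S → ∃[ k ] count a S ≡ suc k
  count-∈ {a} a∈ = length-∈ (∈-filter⁺ (_≟ a) a∈ refl)

  count-∉ : ∀ {a : Fin m} {S} → (∀ {x} → x ∈ S → x ≢ a) → count a S ≡ 0
  count-∉ {a} {S} ≢a = cong length (List.filter-none (_≟ a) {S} (All.tabulate ≢a))

  frequencyGap : (y y′ : Fin m → Fin m) (j a : Fin m) → ℚ
  frequencyGap y y′ j a = (ℕtoℚ (count a (jProfile b y j)) - ℕtoℚ (count a (jProfile b y′ j))) * w

  0≤profDist : ∀ y y′ j → 0ℚ ≤ℚ profDist b y y′ j
  0≤profDist y y′ j = subst (0ℚ ≤ℚ_) (∑-def names (λ a → sq (frequencyGap y y′ j a))) (0≤∑ names λ a → 0≤sq (frequencyGap y y′ j a))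

  -- If the blocks differ, the rank of j in y occurs in the j-profile of its own coset and never in
  -- that of y′, since a j-profile stays inside one block. The frequencies there differ by at least
  -- 1/|H|, whence the factor `h * h`.
  dist≤profDist : ∀ y y′ j → d (b (rank y j)) (b (rank y′ j)) ≤ℚ (h * h) * profDist b ⟦ y ⟧ ⟦ y′ ⟧ j
  dist≤profDist y y′ j = cases (b (rank y j) ≟ b (rank y′ j))
    where
    term : Fin m → ℚ
    term a = sq (frequencyGap ⟦ y ⟧ ⟦ y′ ⟧ j a)
    cases : Dec (b (rank y j) ≡ b (rank y′ j)) → d (b (rank y j)) (b (rank y′ j)) ≤ℚ (h * h) * profDist b ⟦ y ⟧ ⟦ y′ ⟧ j
    cases (yes eq) = ≤-trans (≤-reflexive (dist-refl _≟_ eq)) (0≤* (0≤sq h) (0≤profDist ⟦ y ⟧ ⟦ y′ ⟧ j))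
    cases (no ne)  =
      let k , count≡ = count-∈ (∈jProfile y j)
          count′≡ = count-∉ {rank y j} (λ x∈ x≡ → ne (trans (sym (cong b x≡)) (jProfile-block y′ j x∈)))
      in begin
        d (b (rank y j)) (b (rank y′ j))
          ≤⟨ dist≤1 _≟_ _ _ ⟩
        1ℚ * 1ℚ
          ≤⟨ *-mono-≤ (0≤ℕtoℚ (suc k)) 0≤1 (1≤ℕtoℚ-suc k) (1≤ℕtoℚ-suc k) ⟩
        ℕtoℚ (suc k) * ℕtoℚ (suc k)
          ≡⟨ sym (trans (cong (λ x → (ℕtoℚ (suc k) * ℕtoℚ (suc k)) * (x * x)) h*w) (trans (cong (ℕtoℚ (suc k) * ℕtoℚ (suc k) *_) (*-identityˡ 1ℚ)) (*-identityʳ _))) ⟩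
        (ℕtoℚ (suc k) * ℕtoℚ (suc k)) * ((h * w) * (h * w))
          ≡⟨ rearrange (ℕtoℚ (suc k)) h w ⟩
        (h * h) * (((ℕtoℚ (suc k) - 0ℚ) * w) * ((ℕtoℚ (suc k) - 0ℚ) * w))
          ≡⟨ cong₂ (λ p q → (h * h) * (((ℕtoℚ p - ℕtoℚ q) * w) * ((ℕtoℚ p - ℕtoℚ q) * w))) (sym count≡) (sym count′≡) ⟩
        (h * h) * term (rank y j)
          ≤⟨ *-monoˡ-≤ (0≤sq h) (term≤∑ (allFin-enumerates m) {term} (λ a → 0≤sq (frequencyGap ⟦ y ⟧ ⟦ y′ ⟧ j a)) (rank y j)) ⟩
        (h * h) * ∑ names term
          ≡⟨ cong ((h * h) *_) (∑-def names term) ⟩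
        (h * h) * profDist b ⟦ y ⟧ ⟦ y′ ⟧ j ∎
      where
      open ≤-Reasoning
      rearrange : ∀ k h w → (k * k) * ((h * w) * (h * w)) ≡ (h * h) * (((k - 0ℚ) * w) * ((k - 0ℚ) * w))
      rearrange = solve-∀ ℚ-ring

  Pbar-∑ : ∀ y a c → Pbar b y a c ≡ ∑ H (λ p → δ _≟_ (y (⟦ p ⟧ a)) c) * w
  Pbar-∑ y a c = cong (_* w) (trans (sym (∑-def (coset b y) _)) (trans (∑-map (λ p a → y (⟦ p ⟧ a)) H _)
    (∑-cong H λ p → indicator-δ (y (⟦ p ⟧ a)) c)))

  Pbar-cong : ∀ {y y′} → (∀ a → y a ≡ y′ a) → ∀ a c → Pbar b y a c ≡ Pbar b y′ a c
  Pbar-cong {y} {y′} eq a c = trans (Pbar-∑ y a c) (trans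
    (cong (_* w) (∑-cong H λ p → cong (λ x → δ _≟_ x c) (eq (⟦ p ⟧ a)))) (sym (Pbar-∑ y′ a c)))

  Pbar-range : ∀ y a c → 0ℚ ≤ℚ Pbar b y a c × Pbar b y a c ≤ℚ 1ℚ
  Pbar-range y a c = subst (λ x → 0ℚ ≤ℚ x × x ≤ℚ 1ℚ) (sym (Pbar-∑ y a c))
    (0≤* (0≤∑ H λ p → 0≤δ _≟_ (y (⟦ p ⟧ a)) c) (0≤recip (∣H∣ b)) ,
     ≤-trans (*-monoʳ-≤ (0≤recip (∣H∣ b)) (≤-trans (∑-mono H λ p → δ≤1 _≟_ (y (⟦ p ⟧ a)) c)
       (≤-reflexive (trans (∑-const H 1ℚ) (*-identityʳ h))))) (≤-reflexive h*w))

  ⟦∙⟧-inverse : ∀ (q p : Perm m) a → ⟦ q ⟧ (⟦ (q ⁻¹) ∙ p ⟧ a) ≡ ⟦ p ⟧ a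
  ⟦∙⟧-inverse q p a = trans (cong ⟦ q ⟧ (trans (⟦∙⟧ (q ⁻¹) p a) (⟦⁻¹⟧ q (⟦ p ⟧ a)))) (⟦⟧-rank q (⟦ p ⟧ a))

  ∙-inverseˡ : ∀ (q p : Perm m) → (q ⁻¹) ∙ (q ∙ p) ≡ p
  ∙-inverseˡ q p = Perm-ext λ a → trans (⟦∙⟧ (q ⁻¹) (q ∙ p) a) (trans (⟦⁻¹⟧ q (⟦ q ∙ p ⟧ a))
    (trans (cong (rank q) (⟦∙⟧ q p a)) (rank-⟦⟧ q (⟦ p ⟧ a))))

  ∙-inverseʳ : ∀ (q p : Perm m) → q ∙ ((q ⁻¹) ∙ p) ≡ p
  ∙-inverseʳ q p = Perm-ext λ a → trans (⟦∙⟧ q ((q ⁻¹) ∙ p) a) (⟦∙⟧-inverse q p a)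

  -- If y and y′ colour the names alike, y′⁻¹ y lies in H, and translating by it matches the two cosets.
  Pbar-same-colours : ∀ y y′ → (∀ j → b (rank y j) ≡ b (rank y′ j)) → ∀ a c → Pbar b ⟦ y ⟧ a c ≡ Pbar b ⟦ y′ ⟧ a c
  Pbar-same-colours y y′ same a c = trans (Pbar-∑ ⟦ y ⟧ a c) (trans (cong (_* w) (begin
    ∑ H (λ p → δ _≟_ (⟦ y ⟧ (⟦ p ⟧ a)) c)
      ≡⟨ ∑-filter blockPreserving? (allPerms m) _ ⟩
    ∑ (allPerms m) (λ p → 𝟙 (blockPreserving? p) * δ _≟_ (⟦ y ⟧ (⟦ p ⟧ a)) c)
      ≡⟨ ∑-cong (allPerms m) (λ p → cong₂ _*_ (𝟙-cong (blockPreserving? p) (blockPreserving? (g ∙ p)) (translate p) (untranslate p))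
           (cong (λ x → δ _≟_ x c) (sym (trans (cong ⟦ y′ ⟧ (⟦∙⟧ g p a)) (⟦∙⟧-inverse y′ y (⟦ p ⟧ a)))))) ⟩
    ∑ (allPerms m) (λ p → Φ (g ∙ p))
      ≡⟨ ∑-bijection (allPerms-enumerates m) (g ∙_) ((g ⁻¹) ∙_) (∙-inverseʳ g) (∙-inverseˡ g) Φ ⟩
    ∑ (allPerms m) Φ
      ≡⟨ sym (∑-filter blockPreserving? (allPerms m) _) ⟩
    ∑ H (λ p → δ _≟_ (⟦ y′ ⟧ (⟦ p ⟧ a)) c) ∎)) (sym (Pbar-∑ ⟦ y′ ⟧ a c)))
    where
    open ≡-Reasoning
    g : Perm m
    g = (y′ ⁻¹) ∙ y
    g-block : BlockPreserving g
    g-block a = trans (cong b (trans (⟦∙⟧ (y′ ⁻¹) y a) (⟦⁻¹⟧ y′ (⟦ y ⟧ a)))) (trans (sym (same (⟦ y ⟧ a))) (cong b (rank-⟦⟧ y a)))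
    translate : ∀ p → BlockPreserving p → BlockPreserving (g ∙ p)
    translate p block a = trans (cong b (⟦∙⟧ g p a)) (trans (g-block (⟦ p ⟧ a)) (block a))
    untranslate : ∀ p → BlockPreserving (g ∙ p) → BlockPreserving p
    untranslate p block a = trans (sym (g-block (⟦ p ⟧ a))) (trans (sym (cong b (⟦∙⟧ g p a))) (block a))
    Φ : Perm m → ℚ
    Φ p = 𝟙 (blockPreserving? p) * δ _≟_ (⟦ y′ ⟧ (⟦ p ⟧ a)) c

  frobDist-∑ : ∀ y y′ → frobDist b y y′ ≡ ∑ names (λ a → ∑ names (λ c → sq (Pbar b y a c - Pbar b y′ a c)))
  frobDist-∑ y y′ = trans (sym (∑-def names _)) (∑-cong names λ a → sym (∑-def names _))

  frobDist-cong : ∀ y {z z′} → (∀ a → z a ≡ z′ a) → frobDist b y z ≡ frobDist b y z′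
  frobDist-cong y {z} {z′} eq = trans (frobDist-∑ y z) (trans
    (∑-cong names λ a → ∑-cong names λ c → cong (λ x → sq (Pbar b y a c - x)) (Pbar-cong eq a c)) (sym (frobDist-∑ y z′)))

  frobDist≤N² : ∀ y y′ → frobDist b y y′ ≤ℚ N * N
  frobDist≤N² y y′ = ≤-trans (≤-reflexive (frobDist-∑ y y′)) (≤-trans
    (∑-mono names λ a → ∑-mono names λ c → let 0≤p , p≤1 = Pbar-range y a c ; 0≤q , q≤1 = Pbar-range y′ a c in sq-diff≤1 0≤p p≤1 0≤q q≤1)
    (≤-reflexive (trans (∑-cong names λ a → trans (∑-const-fins m 1ℚ) (*-identityʳ N)) (∑-const-fins m N))))
    where
    sq-diff≤1 : ∀ {p q} → 0ℚ ≤ℚ p → p ≤ℚ 1ℚ → 0ℚ ≤ℚ q → q ≤ℚ 1ℚ → sq (p - q) ≤ℚ 1ℚ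
    sq-diff≤1 {p} {q} 0≤p p≤1 0≤q q≤1 = ≤-slack (((1ℚ - p) + q) * ((1ℚ - q) + p))
      (0≤* (0≤+ (0≤sub p≤1) 0≤q) (0≤+ (0≤sub q≤1) 0≤p)) (split p q)
      where
      split : ∀ p q → 1ℚ ≡ (p - q) * (p - q) + ((1ℚ - p) + q) * ((1ℚ - q) + p)
      split = solve-∀ ℚ-ring

  -- Equal colours mean equal cosets and distance 0. Otherwise the sum over names is at least 1, and
  -- the crude bound N² on the distance is enough.
  frobDist≤dist : ∀ y y′ → frobDist b ⟦ y ⟧ ⟦ y′ ⟧ ≤ℚ (N * N) * ∑ names (λ j → d (b (rank y j)) (b (rank y′ j)))
  frobDist≤dist y y′ = cases (FinP.all? λ j → b (rank y j) ≟ b (rank y′ j))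
    where
    Goal : Set
    Goal = frobDist b ⟦ y ⟧ ⟦ y′ ⟧ ≤ℚ (N * N) * ∑ names (λ j → d (b (rank y j)) (b (rank y′ j)))
    0≤dist-colours : ∀ j → 0ℚ ≤ℚ d (b (rank y j)) (b (rank y′ j))
    0≤dist-colours j = 0≤dist _≟_ (b (rank y j)) (b (rank y′ j))
    0≤N² : 0ℚ ≤ℚ N * N
    0≤N² = 0≤sq N
    differing : ∃[ j ] b (rank y j) ≢ b (rank y′ j) → Goal
    differing (j , ne) = ≤-trans (frobDist≤N² ⟦ y ⟧ ⟦ y′ ⟧) (≤-trans (≤-reflexive (sym (*-identityʳ (N * N))))
      (*-monoˡ-≤ 0≤N² (≤-trans (≤-reflexive (sym (dist-≢ _≟_ ne))) (term≤∑ (allFin-enumerates m) 0≤dist-colours j))))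
    cases : Dec (∀ j → b (rank y j) ≡ b (rank y′ j)) → Goal
    cases (yes same) = ≤-trans (≤-reflexive (trans (frobDist-∑ ⟦ y ⟧ ⟦ y′ ⟧)
      (trans (∑-cong names λ a → trans (∑-cong names λ c → vanish a c) (∑-0 names)) (∑-0 names))))
      (0≤* 0≤N² (0≤∑ names 0≤dist-colours))
      where
      vanish : ∀ a c → sq (Pbar b ⟦ y ⟧ a c - Pbar b ⟦ y′ ⟧ a c) ≡ 0ℚ
      vanish a c = trans (cong (λ x → sq (Pbar b ⟦ y ⟧ a c - x)) (sym (Pbar-same-colours y y′ same a c)))
        (trans (cong₂ _*_ (+-inverseʳ (Pbar b ⟦ y ⟧ a c)) (+-inverseʳ (Pbar b ⟦ y ⟧ a c))) (*-zeroˡ 0ℚ))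
    cases (no ¬same) = differing (FinP.¬∀⟶∃¬ m _ (λ j → b (rank y j) ≟ b (rank y′ j)) ¬same)

-- Influences on block colours are bounded by `IR`

module _ {m nb v : ℕ} (b : Fin (suc m) → Fin nb) (f : Profile (suc m) v → Perm (suc m)) where

  private
    n : ℕ
    n = suc m
    P : Space (Perm n)
    P = perms n
    V : Space (Vec (Perm n) v)
    V = vectors P v
    h : ℚ
    h = ℕtoℚ (∣H∣ b)

  E-profiles : ∀ φ → 𝔼 (allProfiles n v) φ ≡ E V φ
  E-profiles φ = trans (cong (λ L → 𝔼 L φ) (sym (vectors-elements P v))) (𝔼-E V φ)

  private
    local : Fin v → Fin n → ℚ
    local i j = E V (λ x → E P (λ y →
      δ _≟_ (rank (lookup x i) j) (rank y j) * profDist b ⟦ f x ⟧ ⟦ f (x [ i ]≔ y) ⟧ j))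

    0≤local : ∀ i j → 0ℚ ≤ℚ local i j
    0≤local i j = 0≤E V λ x → 0≤E P λ y →
      0≤* (0≤δ _≟_ (rank (lookup x i) j) (rank y j)) (0≤profDist b ⟦ f x ⟧ ⟦ f (x [ i ]≔ y) ⟧ j)

  IR-∑ : IR b f ≡ ∑ (allFin v) (λ i → ∑ (allFin n) (local i))
  IR-∑ = trans (sym (∑-def (allFin v) _)) (∑-cong (allFin v) λ i → trans (sym (∑-def (allFin n) _)) (∑-cong (allFin n) λ j →
    trans (E-profiles _) (E-cong V λ x → trans (𝔼-E P _) (E-cong P λ y →
      cong (_* profDist b ⟦ f x ⟧ ⟦ f (x [ i ]≔ y) ⟧ j) (trans (indicator-δ (preimage ⟦ lookup x i ⟧ j) (preimage ⟦ y ⟧ j))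
        (sym (cong₂ (δ _≟_) (rank-def (lookup x i) j) (rank-def y j))))))))

  totalInfluence≤IR : ∀ j → totalInfluence m _≟_ j (λ x → b (rank (f x) j)) ≤ℚ (h * h) * IR b f
  totalInfluence≤IR j = begin
    totalInfluence m _≟_ j (λ x → b (rank (f x) j))
      ≤⟨ ∑-mono (allFin v) (λ i → E-mono V λ x → E-mono P λ y →
           *-monoˡ-≤ (0≤δ _≟_ (rank (lookup x i) j) (rank y j)) (dist≤profDist b (f x) (f (x [ i ]≔ y)) j)) ⟩
    ∑ (allFin v) (λ i → E V (λ x → E P (λ y → δ _≟_ (rank (lookup x i) j) (rank y j) * ((h * h) * profDist b ⟦ f x ⟧ ⟦ f (x [ i ]≔ y) ⟧ j))))
      ≡⟨ ∑-cong (allFin v) (λ i → trans (E-cong V λ x → trans (E-cong P λ y →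
           swap (δ _≟_ (rank (lookup x i) j) (rank y j)) (h * h) (profDist b ⟦ f x ⟧ ⟦ f (x [ i ]≔ y) ⟧ j)) (E-*ˡ P (h * h) _)) (E-*ˡ V (h * h) _)) ⟩
    ∑ (allFin v) (λ i → (h * h) * local i j)
      ≤⟨ ∑-mono (allFin v) (λ i → *-monoˡ-≤ (0≤sq h) (term≤∑ (allFin-enumerates n) (0≤local i) j)) ⟩
    ∑ (allFin v) (λ i → (h * h) * ∑ (allFin n) (local i))
      ≡⟨ trans (∑-*ˡ (allFin v) (h * h) _) (cong ((h * h) *_) (sym IR-∑)) ⟩
    (h * h) * IR b f ∎
    where
    open ≤-Reasoning
    swap : ∀ a b c → a * (b * c) ≡ b * (a * c)
    swap = solve-∀ ℚ-ring

-- The stability bound and its constant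

module _ {m′ nb : ℕ} (b : Fin (3 ℕ.+ m′) → Fin nb) where

  private
    n : ℕ
    n = 3 ℕ.+ m′
    N L h : ℚ
    N = ℕtoℚ n
    L = ℕtoℚ (length (allPerms n))
    h = ℕtoℚ (∣H∣ b)

    0≤N : 0ℚ ≤ℚ N
    0≤N = 0≤ℕtoℚ n

  stabilityConstant : ℚ
  stabilityConstant = (N * N) * (factor N L * (N * (N * (h * h))))

  stability : ∀ v (f : Profile n v → Perm n) → Fin v → ∀ ε → 0ℚ ≤ℚ ε → IR b f ≤ℚ ε →
    ∃[ s ] 𝔼 (allProfiles n v) (λ x → frobDist b ⟦ f x ⟧ (simpleRep s x)) ≤ℚ stabilityConstant * ε
  stability v f i₀ ε 0≤ε IR≤ε =
    let s , error≤ = core θ 0≤θ bad≤ i₀ in s , (begin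
      𝔼 (allProfiles n v) (λ x → frobDist b ⟦ f x ⟧ (simpleRep s x))
        ≡⟨ E-profiles b f _ ⟩
      E V (λ x → frobDist b ⟦ f x ⟧ (simpleRep s x))
        ≤⟨ E-mono V (frobDist≤ s) ⟩
      E V (λ x → (N * N) * ∑ names (λ j → d (colour x j) (simpleColour s x j)))
        ≡⟨ E-*ˡ V (N * N) _ ⟩
      (N * N) * error s
        ≤⟨ *-monoˡ-≤ (0≤sq N) error≤ ⟩
      (N * N) * (factor N L * (N * (N * ((h * h) * ε))))
        ≡⟨ reassociate (N * N) (factor N L) N (h * h) ε ⟩
      stabilityConstant * ε ∎)
    where
    open ≤-Reasoning
    F : Fin n → Vec (Perm n) v → Fin nb
    F j x = b (rank (f x) j)
    approximation : ∀ j → ∃[ g ] E (vectors (perms n) v) (λ x → dist _≟_ (F j x) (g (ranks j x))) ≤ℚ N * totalInfluence (suc (suc m′)) _≟_ j (F j)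
    approximation j = rank-approximation (suc (suc m′)) _≟_ j (F j)
    G : Fin n → Vec (Fin n) v → Fin nb
    G j = proj₁ (approximation j)
    open Dictatorial {m′} {nb} {v} b f G hiding (n; N; L; 0≤N)
    -- The inner N comes from `rank-approximation` for one name, the outer N from summing over the
    -- names, and `h * h` from `totalInfluence≤IR`.
    θ : ℚ
    θ = N * (N * ((h * h) * ε))
    0≤θ : 0ℚ ≤ℚ θ
    0≤θ = 0≤* 0≤N (0≤* 0≤N (0≤* (0≤sq h) 0≤ε))
    bad≤ : E V bad ≤ℚ θ
    bad≤ = ≤-trans (≤-reflexive (E-∑ V names _)) (≤-trans
      (∑-mono names λ j → ≤-trans (proj₂ (approximation j)) (*-monoˡ-≤ 0≤N
        (≤-trans (totalInfluence≤IR b f j) (*-monoˡ-≤ (0≤sq h) IR≤ε))))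
      (≤-reflexive (∑-const-fins n (N * ((h * h) * ε)))))
    frobDist≤ : ∀ s x → frobDist b ⟦ f x ⟧ (simpleRep s x) ≤ℚ (N * N) * ∑ names (λ j → d (colour x j) (simpleColour s x j))
    frobDist≤ (const y)      x = frobDist≤dist b (f x) y
    frobDist≤ (dictator i y) x = ≤-trans
      (≤-reflexive (frobDist-cong b ⟦ f x ⟧ (λ a → sym (⟦∙⟧ (lookup x i) y a))))
      (≤-trans (frobDist≤dist b (f x) (lookup x i ∙ y))
        (≤-reflexive (cong ((N * N) *_) (∑-cong names λ j → cong (λ r → d (colour x j) (b r)) (rank-∙ (lookup x i) y j)))))
    reassociate : ∀ a b c d e → a * (b * (c * (c * (d * e)))) ≡ (a * (b * (c * (c * d)))) * e
    reassociate = solve-∀ ℚ-ring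

theorem3p10 : ∃[ k ] ((m : ℕ) → 3 ≤ m → {nb : ℕ} → (b : Fin m → Fin nb) → 2 ≤ nb →
    ((l : Fin nb) → ∃[ a ] (b a ≡ l)) →
    ∃[ c ] ((n : ℕ) → 1 ≤ n → (ε : ℚ) → 0ℚ ≤ℚ ε → (f : Profile m n → Perm m) →
    IR b f ≤ℚ ε →
    ∃[ h ] (𝔼 (allProfiles m n) (λ x → frobDist b ⟦ f x ⟧ (simpleRep h x))
    ≤ℚ c * (ℕtoℚ (m ^ k) * ε))))
theorem3p10 = 0 , λ { _ (ℕ.s≤s (ℕ.s≤s (ℕ.s≤s ℕ.z≤n))) b _ _ → stabilityConstant b , λ { (suc n) _ ε 0≤ε f IR≤ε →
  -- `zero` is some voter, available because there is at least one; it only serves as the fallback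
  -- of `essential-coordinate`.
  let h , le = stability b (suc n) f zero ε 0≤ε IR≤ε
  in h , ≤-trans le (≤-reflexive (cong (stabilityConstant b *_) (sym (*-identityˡ ε)))) } }
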